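{- Let $\Gamma\in\mathscr G_3$, i.e. let $\Gamma$ be a connected graph with precisely three distinct eigenvalues. Then the coherent rank of $\Gamma$ is not $7$.
   Context: All graphs are finite, undirected and simple; the eigenvalues of a graph are those of its adjacency matrix $A(\Gamma)$. $\mathscr G_3$ denotes the set of all connected graphs having precisely three distinct eigenvalues. A coherent algebra on a finite set $X$ is a matrix algebra $\mathcal A\subset \operatorname{Mat}_X(\mathbb C)$ that contains the identity matrix $I$ and the all-ones matrix $J$, and is closed under transposition, ordinary matrix multiplication and entrywise multiplication. Each coherent algebra has a unique linear basis consisting of $\{0,1\}$-matrices whose sum is $J$; the number of these matrices is the rank of $\mathcal A$. The coherent closure $\mathcal W(\Gamma)$ of $\Gamma$ is the smallest coherent algebra containing $A(\Gamma)$, and the coherent rank of $\Gamma$ is the rank of $\mathcal W(\Gamma)$. -}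

module Defs where

open import Algebra.Bundles.Raw using (RawRing)
open import Data.Bool.Base using (if_then_else_)
open import Data.Fin.Base using (Fin)
open import Data.Fin.Properties using (_≟_)
open import Data.Nat.Base as ℕ using (ℕ)
import Data.Nat.Properties as ℕ
open import Data.Product.Base using (∃-syntax; _×_; _,_)
open import Data.Rational as ℚ using (ℚ; 0ℚ; 1ℚ; ½)
import Data.Rational.Properties as ℚ
open import Data.Rational.Solver using (module +-*-Solver)
open import Data.Sum.Base using (_⊎_)
open import Data.Vec.Functional using (Vector)
open import Function.Definitions using (Injective)
open import Level using (Level; 0ℓ)
open import Relation.Binary.Construct.Closure.ReflexiveTransitive using (Star)
open import Relation.Binary.Core using (Rel)
open import Relation.Binary.Definitions using (Decidable; Symmetric; Irreflexive)
open import Relation.Binary.PropositionalEquality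
  using (_≡_; refl; sym; cong; subst)
open import Relation.Nullary.Decidable using (does)
open import Relation.Nullary.Negation using (¬_)
open import Relation.Unary using (Pred; _∈_; _⊆_)

-- ℝ is built as Cauchy sequences of rationals, compared by the setoid
-- equality "the difference tends to 0".

Cauchy : (ℕ → ℚ) → Set
Cauchy s = ∀ ε → 0ℚ ℚ.< ε →
  ∃[ N ] (∀ m n → N ℕ.≤ m → N ℕ.≤ n → ℚ.∣ s m ℚ.- s n ∣ ℚ.< ε)

record ℝ : Set where
  constructor mkℝ
  field
    seq    : ℕ → ℚ
    cauchy : Cauchy seq

open ℝ public

infix 4 _≈ᴿ_

record _≈ᴿ_ (x y : ℝ) : Set where
  constructor mk≈ᴿ
  field
    tends-to-0 : ∀ ε → 0ℚ ℚ.< ε →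
      ∃[ N ] (∀ n → N ℕ.≤ n → ℚ.∣ seq x n ℚ.- seq y n ∣ ℚ.< ε)

open _≈ᴿ_ public

private
  opaque
    half-pos : ∀ {ε} → 0ℚ ℚ.< ε → 0ℚ ℚ.< ½ ℚ.* ε
    half-pos {ε} ε>0 = subst (ℚ._< ½ ℚ.* ε) (ℚ.*-zeroʳ ½) (ℚ.*-monoʳ-<-pos ½ ε>0)

    half+half : ∀ ε → ½ ℚ.* ε ℚ.+ ½ ℚ.* ε ≡ ε
    half+half = solve 1 (λ e → con ½ :* e :+ con ½ :* e := e) refl
      where open +-*-Solver

    eventually-bounded : ∀ s → Cauchy s →
      ∃[ b ] (0ℚ ℚ.< b × ∃[ N ] (∀ n → N ℕ.≤ n → ℚ.∣ s n ∣ ℚ.≤ b))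
    eventually-bounded s s-cauchy =
      let N , s-close = s-cauchy 1ℚ (ℚ.positive⁻¹ 1ℚ)
      in 1ℚ ℚ.+ ℚ.∣ s N ∣
       , ℚ.+-mono-<-≤ (ℚ.positive⁻¹ 1ℚ) (ℚ.0≤∣p∣ (s N))
       , N , λ n ≤n → begin
         ℚ.∣ s n ∣                          ≡⟨ cong ℚ.∣_∣ (rearrange (s n) (s N)) ⟩
         ℚ.∣ (s n ℚ.- s N) ℚ.+ s N ∣        ≤⟨ ℚ.∣p+q∣≤∣p∣+∣q∣ (s n ℚ.- s N) (s N) ⟩
         ℚ.∣ s n ℚ.- s N ∣ ℚ.+ ℚ.∣ s N ∣
           ≤⟨ ℚ.+-monoˡ-≤ ℚ.∣ s N ∣ (ℚ.<⇒≤ (s-close n N ≤n ℕ.≤-refl)) ⟩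
         1ℚ ℚ.+ ℚ.∣ s N ∣                   ∎
      where
      open ℚ.≤-Reasoning
      rearrange : ∀ a b → a ≡ (a ℚ.- b) ℚ.+ b
      rearrange = solve 2 (λ a b → a := (a :- b) :+ b) refl
        where open +-*-Solver

    product-close : ∀ {b e} → 0ℚ ℚ.< b → 0ℚ ℚ.< e →
      ∃[ δ ] (0ℚ ℚ.< δ × (∀ x y → ℚ.∣ x ∣ ℚ.≤ b → ℚ.∣ y ∣ ℚ.< δ → ℚ.∣ x ℚ.* y ∣ ℚ.< e))
    product-close {b} {e} b>0 e>0 = 1/b ℚ.* e , δ>0 , λ x y x≤b y<δ → begin-strict
        ℚ.∣ x ℚ.* y ∣          ≡⟨ ℚ.∣p*q∣≡∣p∣*∣q∣ x y ⟩
        ℚ.∣ x ∣ ℚ.* ℚ.∣ y ∣    ≤⟨ ℚ.*-monoʳ-≤-nonNeg ℚ.∣ y ∣ {{ℚ.∣-∣-nonNeg y}} x≤b ⟩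
        b ℚ.* ℚ.∣ y ∣          <⟨ ℚ.*-monoʳ-<-pos b y<δ ⟩
        b ℚ.* (1/b ℚ.* e)      ≡⟨ ℚ.*-assoc b 1/b e ⟨
        b ℚ.* 1/b ℚ.* e        ≡⟨ cong (ℚ._* e) (ℚ.*-inverseʳ b) ⟩
        1ℚ ℚ.* e               ≡⟨ ℚ.*-identityˡ e ⟩
        e                      ∎
      where
      open ℚ.≤-Reasoning
      instance
        b-pos : ℚ.Positive b
        b-pos = ℚ.positive b>0
        b-nonZero : ℚ.NonZero b
        b-nonZero = ℚ.pos⇒nonZero b
      1/b : ℚ
      1/b = ℚ.1/ b
      δ>0 : 0ℚ ℚ.< 1/b ℚ.* e
      δ>0 = ℚ.positive⁻¹ (1/b ℚ.* e)
        {{ℚ.pos*pos⇒pos 1/b {{ℚ.1/pos⇒pos b}} e {{ℚ.positive e>0}}}}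

  opaque
    const-cauchy : ∀ q → Cauchy (λ _ → q)
    const-cauchy q ε ε>0 = 0 , λ _ _ _ _ →
      subst (ℚ._< ε) (sym (cong ℚ.∣_∣ (ℚ.+-inverseʳ q))) ε>0

  opaque
    +-cauchy : ∀ s t → Cauchy s → Cauchy t → Cauchy (λ n → s n ℚ.+ t n)
    +-cauchy s t s-cauchy t-cauchy ε ε>0
      with M , s-close ← s-cauchy (½ ℚ.* ε) (half-pos ε>0)
         | N , t-close ← t-cauchy (½ ℚ.* ε) (half-pos ε>0)
      = M ℕ.⊔ N , λ m n ≤m ≤n → begin-strict
      ℚ.∣ (s m ℚ.+ t m) ℚ.- (s n ℚ.+ t n) ∣
        ≡⟨ cong ℚ.∣_∣ (rearrange (s m) (t m) (s n) (t n)) ⟩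
      ℚ.∣ (s m ℚ.- s n) ℚ.+ (t m ℚ.- t n) ∣
        ≤⟨ ℚ.∣p+q∣≤∣p∣+∣q∣ (s m ℚ.- s n) (t m ℚ.- t n) ⟩
      ℚ.∣ s m ℚ.- s n ∣ ℚ.+ ℚ.∣ t m ℚ.- t n ∣
        <⟨ ℚ.+-mono-< (s-close m n (ℕ.m⊔n≤o⇒m≤o M N ≤m) (ℕ.m⊔n≤o⇒m≤o M N ≤n))
                      (t-close m n (ℕ.m⊔n≤o⇒n≤o M N ≤m) (ℕ.m⊔n≤o⇒n≤o M N ≤n)) ⟩
      ½ ℚ.* ε ℚ.+ ½ ℚ.* ε
        ≡⟨ half+half ε ⟩
      ε ∎
      where
      open ℚ.≤-Reasoning
      rearrange : ∀ a b c d → (a ℚ.+ b) ℚ.- (c ℚ.+ d) ≡ (a ℚ.- c) ℚ.+ (b ℚ.- d)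
      rearrange = solve 4 (λ a b c d → (a :+ b) :- (c :+ d) := (a :- c) :+ (b :- d)) refl
        where open +-*-Solver

  opaque
    neg-cauchy : ∀ s → Cauchy s → Cauchy (λ n → ℚ.- s n)
    neg-cauchy s s-cauchy ε ε>0
      with N , s-close ← s-cauchy ε ε>0
      = N , λ m n ≤m ≤n →
        subst (λ q → ℚ.∣ q ∣ ℚ.< ε) (rearrange (s m) (s n)) (s-close n m ≤n ≤m)
      where
      rearrange : ∀ a b → b ℚ.- a ≡ ℚ.- a ℚ.- (ℚ.- b)
      rearrange = solve 2 (λ a b → b :- a := :- a :- (:- b)) refl
        where open +-*-Solver

  opaque
    *-cauchy : ∀ s t → Cauchy s → Cauchy t → Cauchy (λ n → s n ℚ.* t n)
    *-cauchy s t s-cauchy t-cauchy ε ε>0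
      with b , b>0 , K , s-bounded ← eventually-bounded s s-cauchy
         | c , c>0 , L , t-bounded ← eventually-bounded t t-cauchy
      with δ , δ>0 , b*δ<½ε ← product-close b>0 (half-pos ε>0)
         | η , η>0 , c*η<½ε ← product-close c>0 (half-pos ε>0)
      with M , s-close ← s-cauchy η η>0
         | N , t-close ← t-cauchy δ δ>0
      = (K ℕ.⊔ L) ℕ.⊔ (M ℕ.⊔ N) , bound
      where
      open ℚ.≤-Reasoning

      rearrange : ∀ a b c d →
        a ℚ.* b ℚ.- c ℚ.* d ≡ a ℚ.* (b ℚ.- d) ℚ.+ d ℚ.* (a ℚ.- c)
      rearrange = solve 4 (λ a b c d → a :* b :- c :* d := a :* (b :- d) :+ d :* (a :- c)) refl
        where open +-*-Solver

      bound : ∀ m n → (K ℕ.⊔ L) ℕ.⊔ (M ℕ.⊔ N) ℕ.≤ m → (K ℕ.⊔ L) ℕ.⊔ (M ℕ.⊔ N) ℕ.≤ n →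
        ℚ.∣ s m ℚ.* t m ℚ.- s n ℚ.* t n ∣ ℚ.< ε
      bound m n ≤m ≤n = begin-strict
        ℚ.∣ s m ℚ.* t m ℚ.- s n ℚ.* t n ∣
          ≡⟨ cong ℚ.∣_∣ (rearrange (s m) (t m) (s n) (t n)) ⟩
        ℚ.∣ s m ℚ.* (t m ℚ.- t n) ℚ.+ t n ℚ.* (s m ℚ.- s n) ∣
          ≤⟨ ℚ.∣p+q∣≤∣p∣+∣q∣ (s m ℚ.* (t m ℚ.- t n)) (t n ℚ.* (s m ℚ.- s n)) ⟩
        ℚ.∣ s m ℚ.* (t m ℚ.- t n) ∣ ℚ.+ ℚ.∣ t n ℚ.* (s m ℚ.- s n) ∣
          <⟨ ℚ.+-mono-<
               (b*δ<½ε (s m) (t m ℚ.- t n)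
                 (s-bounded m (ℕ.m⊔n≤o⇒m≤o K L KL≤m))
                 (t-close m n (ℕ.m⊔n≤o⇒n≤o M N MN≤m) (ℕ.m⊔n≤o⇒n≤o M N MN≤n)))
               (c*η<½ε (t n) (s m ℚ.- s n)
                 (t-bounded n (ℕ.m⊔n≤o⇒n≤o K L KL≤n))
                 (s-close m n (ℕ.m⊔n≤o⇒m≤o M N MN≤m) (ℕ.m⊔n≤o⇒m≤o M N MN≤n))) ⟩
        ½ ℚ.* ε ℚ.+ ½ ℚ.* ε
          ≡⟨ half+half ε ⟩
        ε ∎
        where
        KL≤m : K ℕ.⊔ L ℕ.≤ m
        KL≤m = ℕ.m⊔n≤o⇒m≤o (K ℕ.⊔ L) (M ℕ.⊔ N) ≤m
        KL≤n : K ℕ.⊔ L ℕ.≤ n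
        KL≤n = ℕ.m⊔n≤o⇒m≤o (K ℕ.⊔ L) (M ℕ.⊔ N) ≤n
        MN≤m : M ℕ.⊔ N ℕ.≤ m
        MN≤m = ℕ.m⊔n≤o⇒n≤o (K ℕ.⊔ L) (M ℕ.⊔ N) ≤m
        MN≤n : M ℕ.⊔ N ℕ.≤ n
        MN≤n = ℕ.m⊔n≤o⇒n≤o (K ℕ.⊔ L) (M ℕ.⊔ N) ≤n

infix  8 -ᴿ_
infixl 7 _*ᴿ_
infixl 6 _+ᴿ_

fromℚᴿ : ℚ → ℝ
fromℚᴿ q = mkℝ (λ _ → q) (const-cauchy q)

_+ᴿ_ : ℝ → ℝ → ℝ
x +ᴿ y = mkℝ (λ n → seq x n ℚ.+ seq y n) (+-cauchy (seq x) (seq y) (cauchy x) (cauchy y))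

-ᴿ_ : ℝ → ℝ
-ᴿ x = mkℝ (λ n → ℚ.- seq x n) (neg-cauchy (seq x) (cauchy x))

_*ᴿ_ : ℝ → ℝ → ℝ
x *ᴿ y = mkℝ (λ n → seq x n ℚ.* seq y n) (*-cauchy (seq x) (seq y) (cauchy x) (cauchy y))

record ℂ : Set where
  constructor _+i_
  field
    re : ℝ
    im : ℝ

open ℂ public

infix  8 -_
infixl 7 _*_
infixl 6 _+_
infix  4 _≈_

record _≈_ (z w : ℂ) : Set where
  constructor mk≈
  field
    re-≈ : re z ≈ᴿ re w
    im-≈ : im z ≈ᴿ im w

open _≈_ public

_+_ : ℂ → ℂ → ℂ
z + w = (re z +ᴿ re w) +i (im z +ᴿ im w)

_*_ : ℂ → ℂ → ℂ
z * w = ((re z *ᴿ re w) +ᴿ (-ᴿ (im z *ᴿ im w))) +i ((re z *ᴿ im w) +ᴿ (im z *ᴿ re w))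

-_ : ℂ → ℂ
- z = (-ᴿ re z) +i (-ᴿ im z)

0# 1# : ℂ
0# = fromℚᴿ 0ℚ +i fromℚᴿ 0ℚ
1# = fromℚᴿ 1ℚ +i fromℚᴿ 0ℚ

ℂ-rawRing : RawRing 0ℓ 0ℓ
ℂ-rawRing = record
  { _≈_ = _≈_
  ; _+_ = _+_
  ; _*_ = _*_
  ; -_  = -_
  ; 0#  = 0#
  ; 1#  = 1#
  }

open RawRing ℂ-rawRing using (+-rawMonoid)
open import Algebra.Definitions.RawMonoid +-rawMonoid public using (sum)

private
  variable
    n : ℕ
    ℓ : Level

Matrix : ℕ → Set
Matrix n = Fin n → Fin n → ℂ

infix  4 _≋_
infixl 7 _⊗_ _⊙_
infixl 6 _⊕_
infixr 8 _·_

_≋_ : Rel (Matrix n) 0ℓ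
M ≋ N = ∀ i j → M i j ≈ N i j

𝐈 : Matrix n
𝐈 i j = if does (i ≟ j) then 1# else 0#

𝐉 : Matrix n
𝐉 _ _ = 1#

_⊕_ : Matrix n → Matrix n → Matrix n
(M ⊕ N) i j = M i j + N i j

_·_ : ℂ → Matrix n → Matrix n
(c · M) i j = c * M i j

_⊗_ : Matrix n → Matrix n → Matrix n
(M ⊗ N) i j = sum (λ k → M i k * N k j)

-- Entrywise product.
_⊙_ : Matrix n → Matrix n → Matrix n
(M ⊙ N) i j = M i j * N i j

infix 9 _ᵀ

_ᵀ : Matrix n → Matrix n
(M ᵀ) i j = M j i

linearCombination : ∀ {r} → Vector ℂ r → Vector (Matrix n) r → Matrix n
linearCombination c B i j = sum (λ k → c k * B k i j)

record IsEigenvalue (M : Matrix n) (θ : ℂ) : Set where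
  field
    vector  : Vector ℂ n
    nonzero : ¬ (∀ i → vector i ≈ 0#)
    eigen   : ∀ i → sum (λ j → M i j * vector j) ≈ θ * vector i

record HasDistinctEigenvalues (M : Matrix n) (k : ℕ) : Set where
  field
    θ          : Fin k → ℂ
    distinct   : Injective _≡_ _≈_ θ
    eigenvalue : ∀ a → IsEigenvalue M (θ a)
    exhaustive : ∀ {μ} → IsEigenvalue M μ → ∃[ a ] μ ≈ θ a

record Graph (n : ℕ) : Set₁ where
  infix 4 _~_ _~?_
  field
    _~_      : Rel (Fin n) 0ℓ
    _~?_     : Decidable _~_
    ~-sym    : Symmetric _~_
    ~-irrefl : Irreflexive _≡_ _~_

Connected : Graph n → Set
Connected Γ = ∀ i j → Star (Graph._~_ Γ) i j

adjacencyMatrix : Graph n → Matrix n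
adjacencyMatrix Γ i j = if does (i ~? j) then 1# else 0#
  where open Graph Γ

record 𝒢₃ (Γ : Graph n) : Set where
  field
    connected        : Connected Γ
    threeEigenvalues : HasDistinctEigenvalues (adjacencyMatrix Γ) 3

-- Matrices are compared up to ≋, so a set of matrices has to respect it.
record IsCoherentAlgebra (𝒜 : Pred (Matrix n) ℓ) : Set ℓ where
  field
    resp      : ∀ {M N} → M ≋ N → M ∈ 𝒜 → N ∈ 𝒜
    ⊕-closed  : ∀ {M N} → M ∈ 𝒜 → N ∈ 𝒜 → M ⊕ N ∈ 𝒜
    ·-closed  : ∀ c {M} → M ∈ 𝒜 → c · M ∈ 𝒜
    𝐈-mem     : 𝐈 ∈ 𝒜
    𝐉-mem     : 𝐉 ∈ 𝒜
    ᵀ-closed  : ∀ {M} → M ∈ 𝒜 → M ᵀ ∈ 𝒜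
    ⊗-closed  : ∀ {M N} → M ∈ 𝒜 → N ∈ 𝒜 → M ⊗ N ∈ 𝒜
    ⊙-closed  : ∀ {M N} → M ∈ 𝒜 → N ∈ 𝒜 → M ⊙ N ∈ 𝒜

-- The smallest coherent algebra containing A.  It is generated inductively
-- because the intersection of all coherent algebras containing A would live
-- one universe higher; closure-isCoherentAlgebra, closure-contains and
-- closure-least establish the universal property.
data CoherentClosure (A : Matrix n) : Pred (Matrix n) 0ℓ where
  gen    : A ∈ CoherentClosure A
  resp   : ∀ {M N} → M ≋ N → M ∈ CoherentClosure A → N ∈ CoherentClosure A
  add    : ∀ {M N} → M ∈ CoherentClosure A → N ∈ CoherentClosure A → M ⊕ N ∈ CoherentClosure A
  scale  : ∀ c {M} → M ∈ CoherentClosure A → c · M ∈ CoherentClosure A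
  ident  : 𝐈 ∈ CoherentClosure A
  ones   : 𝐉 ∈ CoherentClosure A
  transp : ∀ {M} → M ∈ CoherentClosure A → M ᵀ ∈ CoherentClosure A
  mult   : ∀ {M N} → M ∈ CoherentClosure A → N ∈ CoherentClosure A → M ⊗ N ∈ CoherentClosure A
  schur  : ∀ {M N} → M ∈ CoherentClosure A → N ∈ CoherentClosure A → M ⊙ N ∈ CoherentClosure A

closure-isCoherentAlgebra : (A : Matrix n) → IsCoherentAlgebra (CoherentClosure A)
closure-isCoherentAlgebra A = record
  { resp     = resp
  ; ⊕-closed = add
  ; ·-closed = scale
  ; 𝐈-mem    = ident
  ; 𝐉-mem    = ones
  ; ᵀ-closed = transp
  ; ⊗-closed = mult
  ; ⊙-closed = schur
  }

closure-contains : (A : Matrix n) → A ∈ CoherentClosure A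
closure-contains A = gen

closure-least : {A : Matrix n} {𝒜 : Pred (Matrix n) ℓ} →
  IsCoherentAlgebra 𝒜 → A ∈ 𝒜 → CoherentClosure A ⊆ 𝒜
closure-least {A = A} {𝒜} isCoherent A∈𝒜 = go
  where
  module 𝒜 = IsCoherentAlgebra isCoherent
  go : CoherentClosure A ⊆ 𝒜
  go gen          = A∈𝒜
  go (resp M≋N p) = 𝒜.resp M≋N (go p)
  go (add p q)    = 𝒜.⊕-closed (go p) (go q)
  go (scale c p)  = 𝒜.·-closed c (go p)
  go ident        = 𝒜.𝐈-mem
  go ones         = 𝒜.𝐉-mem
  go (transp p)   = 𝒜.ᵀ-closed (go p)
  go (mult p q)   = 𝒜.⊗-closed (go p) (go q)
  go (schur p q)  = 𝒜.⊙-closed (go p) (go q)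

-- A coherent algebra has exactly one basis of this kind, up to order; its
-- size r is the rank.
record StandardBasis (𝒜 : Pred (Matrix n) ℓ) (r : ℕ) : Set ℓ where
  field
    B           : Vector (Matrix n) r
    member      : ∀ k → B k ∈ 𝒜
    zero-one    : ∀ k i j → B k i j ≈ 0# ⊎ B k i j ≈ 1#
    sum-ones    : ∀ i j → sum (λ k → B k i j) ≈ 1#
    independent : ∀ c → (∀ i j → linearCombination c B i j ≈ 0#) → ∀ k → c k ≈ 0#
    spanning    : ∀ {M} → M ∈ 𝒜 → ∃[ c ] M ≋ linearCombination c B

HasCoherentRank : Graph n → ℕ → Set
HasCoherentRank Γ r = StandardBasis (CoherentClosure (adjacencyMatrix Γ)) r

{-# OPTIONS --safe #-}
module Submission where

-- Let A be the adjacency matrix of a connected graph Γ with three distinct eigenvalues, the largest being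
-- λ₀ and the other two b and c.  A is symmetric, so its eigenvectors span the space and
-- (A - λ₀)(A - b)(A - c) = 0.  By Perron-Frobenius theory λ₀ is simple with a positive eigenvector α, so the
-- symmetric matrix C = (A - b)(A - c) = A² - sA + pI, whose columns are eigenvectors for λ₀, is a multiple
-- of α αᵀ.  The diagonal of C shows that vertices of equal degree have equal rows in C.  This is
-- three-eigenvalues⇒rank-one.
--
-- Suppose that the coherent rank is 7.  The basis matrices colour the pairs of vertices with 7 colours, and
-- the fibres are the classes of vertices i with equal colour of (i , i).  Colours of pairs between different
-- ordered pairs of fibres are different, so three fibres would give nine colours.  If there is one fibre,
-- or more generally if Γ is regular, then C is constant, the matrices I, A, J span a coherent algebra, and
-- the rank is at most 3 (not-regular).  So there are two fibres, and degrees are constant on them.  If two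
-- colours occurred from one fibre to the other, then neither fibre would be a single vertex, and there would
-- be eight colours; hence (cross-colour) there is one colour, and as Γ is connected it is the join of the
-- graphs induced on the fibres.
--
-- For such a join the formula for A² shows that the matrices depending only on the label of a pair
-- (the fibre of the first vertex; whether the two are equal, adjacent in the same fibre, nonadjacent in the
-- same fibre, or in different fibres) form a coherent algebra (block-product, labels-coherent).  Hence
-- colours and labels coincide, and exactly seven of the eight labels occur: one fibre is a clique or a
-- coclique on at least two vertices, and the other one is neither.  The row sums of A² inside the fibres and
-- the equation C_ij² = C_ii C_jj for i and j in different fibres rule this out: in the first case they make
-- the other fibre a clique too (no-complete-part), and in the second case they make Γ regular
-- (empty-part⇒regular).
--
-- Spectral theory for the constructive real numbers.  The goal is a negation, so classical reasoning about
-- finitely many statements is available under double negation, but the eigenvalues have to be constructed as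
-- real numbers.  The largest eigenvalue is the least upper bound μ of the form x·Hx on the unit sphere.  It is
-- computed as a limit of rational grid points, since completing squares decides (approximately) whether a
-- rational form is nonnegative (TopOfRealForm).  Completing squares over ℝ also shows that μ - H either has
-- a kernel vector or is positive definite, and the latter contradicts the choice of μ (top-eigenvector).
-- Deflation by the eigenvectors found then shows that eigenvectors span the space (complete).

open import Data.Nat.Base using (ℕ)
open import Relation.Nullary.Negation using (¬_)
open import Defs using
  (Cauchy; ℝ; mkℝ; seq; cauchy; _≈ᴿ_; mk≈ᴿ; tends-to-0; fromℚᴿ; _+ᴿ_; -ᴿ_; _*ᴿ_;
   Graph; Connected; adjacencyMatrix; IsEigenvalue; HasDistinctEigenvalues; 𝒢₃;
   Matrix; IsCoherentAlgebra; gen; mult; closure-isCoherentAlgebra; closure-least;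
   StandardBasis; HasCoherentRank)
open import Algebra.Bundles using (CommutativeRing)
import Algebra.Properties.Ring as RingProperties
import Algebra.Properties.Semiring.Sum as SemiringSum
import Algebra.Solver.Ring
open import Algebra.Solver.Ring.AlmostCommutativeRing
  using (fromCommutativeRing; _-Raw-AlmostCommutative⟶_)
open import Data.Bool.Base using (Bool; true; false; not; if_then_else_)
import Data.Bool.Properties as Bool
open import Data.Empty using (⊥; ⊥-elim)
open import Data.Fin.Base using (Fin; zero; suc; punchOut; combine; remQuot)
open import Data.Fin.Patterns
import Data.Fin.Properties as Fin
import Data.Integer.Base as ℤ
import Data.Integer.Properties as ℤ
open import Data.Maybe.Base using (Maybe; just; nothing)
open import Data.Nat.Base as ℕ using (zero; suc)
import Data.Nat.Coprimality as Coprime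
import Data.Nat.Properties as ℕ
open import Data.Product.Base using (∃-syntax; Σ-syntax; _×_; _,_; proj₁; proj₂; uncurry)
open import Data.Rational as ℚ using (ℚ; mkℚ; 0ℚ; 1ℚ; ½)
import Data.Rational.Properties as ℚ
import Data.Rational.Unnormalised.Base as ℚᵘ
import Data.Rational.Unnormalised.Properties as ℚᵘ
open import Data.Sum.Base using (_⊎_; inj₁; inj₂)
open import Data.Vec.Functional using (_∷_)
open import Function.Base using (_∘_; id; case_of_)
open import Function.Definitions using (Injective)
open import Level using (0ℓ)
open import Relation.Binary.Construct.Closure.ReflexiveTransitive as Star using (Star; _◅_)
open import Relation.Binary.PropositionalEquality as ≡ using (_≡_)
import Relation.Binary.Reasoning.Setoid as SetoidReasoning
open import Relation.Binary.Structures using (IsEquivalence)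
open import Relation.Nullary.Decidable using (Dec; does; yes; no; _×-dec_; ¬?; decidable-stable)

-- Linear algebra over commutative ℚ-algebras

-- A commutative ring, up to its setoid equality, with a homomorphism from ℚ.  The homomorphism
-- supplies the rational coefficients of the ring solver.
record ℚAlgebra : Set₁ where
  field
    commutativeRing : CommutativeRing 0ℓ 0ℓ
  open CommutativeRing commutativeRing hiding (zero) public
  field
    ι    : ℚ → Carrier
    ι-+  : ∀ p q → ι (p ℚ.+ q) ≈ ι p + ι q
    ι-*  : ∀ p q → ι (p ℚ.* q) ≈ ι p * ι q
    ι-neg : ∀ p → ι (ℚ.- p) ≈ - ι p
    ι-0  : ι 0ℚ ≈ 0#
    ι-1  : ι 1ℚ ≈ 1#

module LinearAlgebra (𝕜 : ℚAlgebra) where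
  open ℚAlgebra 𝕜
  private module Σ = SemiringSum semiring
  open SetoidReasoning setoid

  private
    ι-homomorphism : ℚ.+-*-rawRing -Raw-AlmostCommutative⟶ fromCommutativeRing commutativeRing
    ι-homomorphism = record
      { ⟦_⟧ = ι ; +-homo = ι-+ ; *-homo = ι-* ; -‿homo = ι-neg ; 0-homo = ι-0 ; 1-homo = ι-1 }

    ι-≟ : ∀ p q → Maybe (ι p ≈ ι q)
    ι-≟ p q with p ℚ.≟ q
    ... | yes ≡.refl = just refl
    ... | no _       = nothing

  open Algebra.Solver.Ring ℚ.+-*-rawRing (fromCommutativeRing commutativeRing) ι-homomorphism ι-≟ public
    using (solve; _:+_; _:*_; _:-_; :-_; _:=_; con)

  Vec : ℕ → Set
  Vec n = Fin n → Carrier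

  Mat : ℕ → Set
  Mat n = Fin n → Fin n → Carrier

  -0≈0 : ∀ {x} → x ≈ 0# → - x ≈ 0#
  -0≈0 p = trans (-‿cong p) (RingProperties.-0#≈0# ring)

  difference≈0 : ∀ {x y} → x ≈ y → x - y ≈ 0#
  difference≈0 {x} {y} p = trans (+-congʳ p) (-‿inverseʳ y)

  ≈-difference : ∀ {x y} → x - y ≈ 0# → x ≈ y
  ≈-difference {x} {y} p = begin
    x            ≈⟨ solve 2 (λ x y → x := (x :- y) :+ y) refl x y ⟩
    (x - y) + y  ≈⟨ +-congʳ p ⟩
    0# + y       ≈⟨ +-identityˡ y ⟩
    y ∎

  infix 4 _≐_
  _≐_ : ∀ {n} → Vec n → Vec n → Set
  u ≐ v = ∀ i → u i ≈ v i

  -- Sums are opaque so that unification can read off their length.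
  opaque
    sum : ∀ {n} → Vec n → Carrier
    sum = Σ.sum

    sum-def : ∀ {n} (u : Vec n) → sum u ≡ Σ.sum u
    sum-def u = ≡.refl

    sum-empty : (u : Vec 0) → sum u ≈ 0#
    sum-empty u = refl

    sum-suc : ∀ {n} (u : Vec (suc n)) → sum u ≈ u zero + sum (λ i → u (suc i))
    sum-suc u = refl

    sum-cong : ∀ {n} {u v : Vec n} → u ≐ v → sum u ≈ sum v
    sum-cong u≐v = Σ.sum-cong-≋ u≐v

    sum-zero : ∀ {n} (u : Vec n) → (∀ i → u i ≈ 0#) → sum u ≈ 0#
    sum-zero {n} u u≐0 = trans (sum-cong u≐0) (Σ.sum-replicate-zero n)

    sum-+ : ∀ {n} (u v : Vec n) → sum (λ i → u i + v i) ≈ sum u + sum v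
    sum-+ = Σ.∑-distrib-+

    sum-comm : ∀ {m n} (f : Fin m → Fin n → Carrier) →
      sum (λ i → sum (λ j → f i j)) ≈ sum (λ j → sum (λ i → f i j))
    sum-comm = Σ.∑-comm

    *-sumˡ : ∀ {n} c (u : Vec n) → c * sum u ≈ sum (λ i → c * u i)
    *-sumˡ = Σ.*-distribˡ-sum

    *-sumʳ : ∀ {n} c (u : Vec n) → sum u * c ≈ sum (λ i → u i * c)
    *-sumʳ = Σ.*-distribʳ-sum

  sum-neg : ∀ {n} (u : Vec n) → sum (λ i → - u i) ≈ - sum u
  sum-neg u = begin
    sum (λ i → - u i)               ≈⟨ sum-cong (λ i → solve 1 (λ a → :- a := con (ℚ.- 1ℚ) :* a) refl (u i)) ⟩
    sum (λ i → ι (ℚ.- 1ℚ) * u i)    ≈⟨ *-sumˡ _ u ⟨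
    ι (ℚ.- 1ℚ) * sum u              ≈⟨ solve 1 (λ a → con (ℚ.- 1ℚ) :* a := :- a) refl (sum u) ⟩
    - sum u ∎

  -- The bilinear dot product; there is no conjugation, and all quadratic forms below are real.
  infix 8 _∙_
  _∙_ : ∀ {n} → Vec n → Vec n → Carrier
  u ∙ v = sum (λ i → u i * v i)

  _·ᵥ_ : ∀ {n} → Mat n → Vec n → Vec n
  (M ·ᵥ v) i = M i ∙ v
  infixr 9 _·ᵥ_

  ∙-cong : ∀ {n} {u u′ v v′ : Vec n} → u ≐ u′ → v ≐ v′ → u ∙ v ≈ u′ ∙ v′
  ∙-cong p q = sum-cong (λ i → *-cong (p i) (q i))

  ∙-comm : ∀ {n} (u v : Vec n) → u ∙ v ≈ v ∙ u
  ∙-comm u v = sum-cong (λ i → *-comm (u i) (v i))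

  ∙-+ʳ : ∀ {n} (u v w : Vec n) → u ∙ (λ i → v i + w i) ≈ u ∙ v + u ∙ w
  ∙-+ʳ u v w = trans (sum-cong (λ i → distribˡ (u i) (v i) (w i))) (sum-+ _ _)

  ∙-*ʳ : ∀ {n} (u : Vec n) c v → u ∙ (λ i → c * v i) ≈ c * u ∙ v
  ∙-*ʳ u c v = trans
    (sum-cong (λ i → solve 3 (λ a b d → a :* (b :* d) := b :* (a :* d)) refl (u i) c (v i)))
    (sym (*-sumˡ c _))

  ∙-+ˡ : ∀ {n} (u v w : Vec n) → (λ i → u i + v i) ∙ w ≈ u ∙ w + v ∙ w
  ∙-+ˡ u v w = trans (∙-comm _ w) (trans (∙-+ʳ w u v) (+-cong (∙-comm w u) (∙-comm w v)))

  ∙-*ˡ : ∀ {n} c (u v : Vec n) → (λ i → c * u i) ∙ v ≈ c * u ∙ v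
  ∙-*ˡ c u v = trans (∙-comm _ v) (trans (∙-*ʳ v c u) (*-congˡ (∙-comm v u)))

  ∙-linʳ : ∀ {n} (u : Vec n) a v b w → u ∙ (λ i → a * v i + b * w i) ≈ a * u ∙ v + b * u ∙ w
  ∙-linʳ u a v b w = trans (∙-+ʳ u _ _) (+-cong (∙-*ʳ u a v) (∙-*ʳ u b w))

  ∙-linˡ : ∀ {n} a (u : Vec n) b v w → (λ i → a * u i + b * v i) ∙ w ≈ a * u ∙ w + b * v ∙ w
  ∙-linˡ a u b v w = trans (∙-+ˡ _ _ w) (+-cong (∙-*ˡ a u w) (∙-*ˡ b v w))

  ∙-zeroʳ : ∀ {n} (u v : Vec n) → (∀ i → v i ≈ 0#) → u ∙ v ≈ 0#
  ∙-zeroʳ u v v≐0 = sum-zero _ (λ i → trans (*-congˡ (v≐0 i)) (zeroʳ (u i)))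

  ∙-·ᵥ : ∀ {n} (u : Vec n) (M : Mat n) v → u ∙ (M ·ᵥ v) ≈ (λ j → u ∙ (λ i → M i j)) ∙ v
  ∙-·ᵥ u M v = begin
    sum (λ i → u i * sum (λ j → M i j * v j))
      ≈⟨ sum-cong (λ i → *-sumˡ (u i) _) ⟩
    sum (λ i → sum (λ j → u i * (M i j * v j)))
      ≈⟨ sum-comm _ ⟩
    sum (λ j → sum (λ i → u i * (M i j * v j)))
      ≈⟨ sum-cong (λ j → trans (sum-cong (λ i → sym (*-assoc (u i) (M i j) (v j)))) (sym (*-sumʳ (v j) _))) ⟩
    sum (λ j → sum (λ i → u i * M i j) * v j) ∎

  SymmetricM : ∀ {n} → Mat n → Set
  SymmetricM M = ∀ i j → M i j ≈ M j i

  selfadjoint : ∀ {n} (M : Mat n) → SymmetricM M → ∀ u v → u ∙ (M ·ᵥ v) ≈ (M ·ᵥ u) ∙ v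
  selfadjoint M M-sym u v = trans (∙-·ᵥ u M v)
    (∙-cong (λ j → trans (∙-comm u _) (∙-cong (λ i → M-sym i j) (λ _ → refl))) (λ _ → refl))

  form-expand : ∀ {n} (M : Mat n) x → x ∙ (M ·ᵥ x) ≈ sum (λ i → sum (λ j → M i j * (x i * x j)))
  form-expand M x = sum-cong (λ i → trans (*-sumˡ (x i) _) (sum-cong (λ j →
    solve 3 (λ a m b → a :* (m :* b) := m :* (a :* b)) refl (x i) (M i j) (x j))))

  form-difference : ∀ {n} (M N : Mat n) x →
    x ∙ ((λ i j → M i j - N i j) ·ᵥ x) ≈ x ∙ (M ·ᵥ x) - x ∙ (N ·ᵥ x)
  form-difference M N x = begin
    x ∙ ((λ i j → M i j - N i j) ·ᵥ x)
      ≈⟨ ∙-cong (λ _ → refl) (λ i → trans (∙-+ˡ (M i) _ x) (+-congˡ (trans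
           (sum-cong (λ j → solve 2 (λ a b → (:- a) :* b := :- (a :* b)) refl (N i j) (x j))) (sum-neg _)))) ⟩
    x ∙ (λ i → (M ·ᵥ x) i - (N ·ᵥ x) i)
      ≈⟨ trans (∙-+ʳ x _ _) (+-congˡ (trans
          (sum-cong (λ i → solve 2 (λ a b → a :* (:- b) := :- (a :* b)) refl (x i) _)) (sum-neg _))) ⟩
    x ∙ (M ·ᵥ x) - x ∙ (N ·ᵥ x) ∎

  -- Completing the square: if a is the corner entry of P, g the mean of the rest of its first row
  -- and of its first column, and a′ = 1/a, then x·Px = a (x₀ + a′ g·u)² + u·Su with x = (x₀ , u)
  -- and S the Schur complement of a.  Taking the mean makes symmetry of P unnecessary.
  module _ {n : ℕ} (P : Mat (suc n)) (g : Vec n) (a′ : Carrier) where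

    Schur : Mat n
    Schur i j = P (suc i) (suc j) + - (a′ * (g i * g j))

    complete-square :
      (∀ i → g i + g i ≈ P zero (suc i) + P (suc i) zero) → P zero zero * a′ ≈ 1# → ∀ x →
      let u = λ i → x (suc i) ; t = x zero + a′ * g ∙ u in
      x ∙ (P ·ᵥ x) ≈ P zero zero * (t * t) + u ∙ (Schur ·ᵥ u)
    complete-square g-mean a*a′ x = begin
      x ∙ (P ·ᵥ x)
        ≈⟨ trans (sum-suc _) (+-cong (*-congˡ (sum-suc _)) (sum-cong (λ i → *-congˡ (sum-suc _)))) ⟩
      x₀ * (a * x₀ + r ∙ u) + sum (λ i → u i * (c i * x₀ + C i ∙ u))
        ≈⟨ +-congˡ (trans (sum-cong (λ i → distribˡ (u i) _ _)) (sum-+ _ _)) ⟩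
      x₀ * (a * x₀ + r ∙ u) + (sum (λ i → u i * (c i * x₀)) + u ∙ (C ·ᵥ u))
        ≈⟨ +-congˡ (+-congʳ (trans (sum-cong (λ i → sym (*-assoc (u i) (c i) x₀))) (sym (*-sumʳ x₀ _)))) ⟩
      x₀ * (a * x₀ + r ∙ u) + (u ∙ c * x₀ + u ∙ (C ·ᵥ u))
        ≈⟨ solve 5 (λ x a r c q → x :* (a :* x :+ r) :+ (c :* x :+ q) := a :* (x :* x) :+ (r :+ c) :* x :+ q) refl x₀
            a (r ∙ u) (u ∙ c) (u ∙ (C ·ᵥ u)) ⟩
      a * (x₀ * x₀) + (r ∙ u + u ∙ c) * x₀ + u ∙ (C ·ᵥ u)
        ≈⟨ +-congʳ (+-congˡ (*-congʳ mean)) ⟩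
      a * (x₀ * x₀) + (γ + γ) * x₀ + u ∙ (C ·ᵥ u)
        ≈⟨ solve 5 (λ x a γ a′ q → a :* (x :* x) :+ (γ :+ γ) :* x :+ q
              := a :* (x :* x) :+ con 1ℚ :* ((γ :+ γ) :* x :+ a′ :* (γ :* γ)) :+ (q :- a′ :* (γ :* γ))) refl x₀ a γ a′
                  (u ∙ (C ·ᵥ u)) ⟩
      a * (x₀ * x₀) + ι 1ℚ * ((γ + γ) * x₀ + a′ * (γ * γ)) + (u ∙ (C ·ᵥ u) - a′ * (γ * γ))
        ≈⟨ +-cong (+-congˡ (*-congʳ (trans ι-1 (sym a*a′)))) (sym schur-form) ⟩
      a * (x₀ * x₀) + (a * a′) * ((γ + γ) * x₀ + a′ * (γ * γ)) + u ∙ (Schur ·ᵥ u)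
        ≈⟨ +-congʳ (solve 4 (λ x a γ a′ → a :* (x :* x) :+ (a :* a′) :* ((γ :+ γ) :* x :+ a′ :* (γ :* γ))
              := a :* ((x :+ a′ :* γ) :* (x :+ a′ :* γ))) refl x₀ a γ a′) ⟩
      a * (t * t) + u ∙ (Schur ·ᵥ u) ∎
      where
      a = P zero zero
      x₀ = x zero
      u : Vec n
      u i = x (suc i)
      r c : Vec n
      r i = P zero (suc i)
      c i = P (suc i) zero
      C : Mat n
      C i j = P (suc i) (suc j)
      γ = g ∙ u
      t = x₀ + a′ * γ
      mean : r ∙ u + u ∙ c ≈ γ + γ
      mean = begin
        r ∙ u + u ∙ c                  ≈⟨ +-congˡ (∙-comm u c) ⟩
        r ∙ u + c ∙ u                  ≈⟨ ∙-+ˡ r c u ⟨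
        (λ i → r i + c i) ∙ u          ≈⟨ ∙-cong (λ i → sym (g-mean i)) (λ _ → refl) ⟩
        (λ i → g i + g i) ∙ u          ≈⟨ ∙-+ˡ g g u ⟩
        γ + γ ∎
      schur-form : u ∙ (Schur ·ᵥ u) ≈ u ∙ (C ·ᵥ u) - a′ * (γ * γ)
      schur-form = begin
        u ∙ (Schur ·ᵥ u)
          ≈⟨ ∙-cong (λ _ → refl) row ⟩
        u ∙ (λ i → (C ·ᵥ u) i + - (a′ * γ) * g i)
          ≈⟨ ∙-+ʳ u _ _ ⟩
        u ∙ (C ·ᵥ u) + u ∙ (λ i → - (a′ * γ) * g i)
          ≈⟨ +-congˡ (trans (∙-*ʳ u _ g) (*-congˡ (∙-comm u g))) ⟩
        u ∙ (C ·ᵥ u) + - (a′ * γ) * γ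
          ≈⟨ solve 3 (λ q a γ → q :+ :- (a :* γ) :* γ := q :- a :* (γ :* γ)) refl _ a′ γ ⟩
        u ∙ (C ·ᵥ u) - a′ * (γ * γ) ∎
        where
        row : ∀ i → (Schur ·ᵥ u) i ≈ (C ·ᵥ u) i + - (a′ * γ) * g i
        row i = begin
          (Schur i) ∙ u
            ≈⟨ ∙-cong (λ j → +-congˡ {C i j} (solve 3 (λ a x y → :- (a :* (x :* y)) := (:- (a :* x)) :* y) refl a′
                (g i) (g j))) (λ _ → refl) ⟩
          (λ j → C i j + - (a′ * g i) * g j) ∙ u
            ≈⟨ trans (∙-+ˡ (C i) _ u) (+-congˡ (∙-*ˡ _ g u)) ⟩
          (C i) ∙ u + - (a′ * g i) * γ
            ≈⟨ +-congˡ (solve 3 (λ a x y → (:- (a :* x)) :* y := :- (a :* y) :* x) refl a′ (g i) γ) ⟩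
          (C i) ∙ u + - (a′ * γ) * g i ∎

¬¬-lem : {P : Set} → ¬ ¬ (P ⊎ ¬ P)
¬¬-lem k = k (inj₂ (k ∘ inj₁))

¬¬-choice : ∀ {n} {P : Fin n → Set} → (∀ i → ¬ ¬ P i) → ¬ ¬ (∀ i → P i)
¬¬-choice {zero}  p k = k λ ()
¬¬-choice {suc n} p k = p zero λ p₀ → ¬¬-choice (p ∘ suc) λ ps → k λ { zero → p₀ ; (suc i) → ps i }

-- Ordered fields

module IdentityMatrix (𝕜 : ℚAlgebra) where
  open ℚAlgebra 𝕜
  open LinearAlgebra 𝕜
  open SetoidReasoning setoid

  𝟙 : ∀ {n} → Mat n
  𝟙 i j = if does (i Fin.≟ j) then 1# else 0#

  𝟙-sym : ∀ {n} → SymmetricM (𝟙 {n})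
  𝟙-sym zero    zero    = refl
  𝟙-sym zero    (suc j) = refl
  𝟙-sym (suc i) zero    = refl
  𝟙-sym (suc i) (suc j) = 𝟙-sym i j

  𝟙-diag : ∀ {n} (i : Fin n) → 𝟙 i i ≈ 1#
  𝟙-diag zero    = refl
  𝟙-diag (suc i) = 𝟙-diag i

  𝟙-· : ∀ {n} (v : Vec n) → 𝟙 ·ᵥ v ≐ v
  𝟙-· v zero    = begin
    𝟙 zero ∙ v                 ≈⟨ sum-suc _ ⟩
    1# * v zero + _            ≈⟨ +-cong (*-identityˡ _) (sum-zero _ (λ i → zeroˡ _)) ⟩
    v zero + 0#                ≈⟨ +-identityʳ _ ⟩
    v zero ∎
  𝟙-· v (suc i) = begin
    𝟙 (suc i) ∙ v              ≈⟨ sum-suc _ ⟩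
    0# * v zero + 𝟙 i ∙ (v ∘ suc)  ≈⟨ +-cong (zeroˡ _) (𝟙-· (v ∘ suc) i) ⟩
    0# + v (suc i)             ≈⟨ +-identityˡ _ ⟩
    v (suc i) ∎

  -- The matrix μ𝟙 - H
  _⊝_ : ∀ {n} → Carrier → Mat n → Mat n
  (μ ⊝ H) i j = μ * 𝟙 i j + - 1# * H i j

  ⊝-· : ∀ {n} μ (H : Mat n) x i → ((μ ⊝ H) ·ᵥ x) i ≈ μ * x i + - 1# * (H ·ᵥ x) i
  ⊝-· μ H x i = trans (∙-linˡ μ (𝟙 i) (- 1#) (H i) x) (+-congʳ (*-congˡ (𝟙-· x i)))

  ⊝-form : ∀ {n} μ (H : Mat n) x → x ∙ ((μ ⊝ H) ·ᵥ x) ≈ μ * x ∙ x - x ∙ (H ·ᵥ x)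
  ⊝-form μ H x = begin
    x ∙ ((μ ⊝ H) ·ᵥ x)                          ≈⟨ ∙-cong (λ _ → refl) (⊝-· μ H x) ⟩
    x ∙ (λ i → μ * x i + - 1# * (H ·ᵥ x) i)     ≈⟨ ∙-linʳ x μ x (- 1#) (H ·ᵥ x) ⟩
    μ * x ∙ x + - 1# * x ∙ (H ·ᵥ x)             ≈⟨ +-congˡ (*-congʳ (-‿cong (sym ι-1))) ⟩
    μ * x ∙ x + - ι 1ℚ * x ∙ (H ·ᵥ x)
      ≈⟨ solve 2 (λ a b → a :+ :- con 1ℚ :* b := a :- b) refl (μ * x ∙ x) (x ∙ (H ·ᵥ x)) ⟩
    μ * x ∙ x - x ∙ (H ·ᵥ x) ∎

  nat : ℕ → Carrier
  nat zero    = 0#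
  nat (suc k) = 1# + nat k

-- An ordered field in the classical sense, stated so that the constructive real numbers are an
-- instance: the order is given by its nonnegative elements, and dichotomy, inverses and the
-- Archimedean property hold up to double negation.  Since nonnegativity is stable under double
-- negation, so is equality, and classical case distinctions are available in proofs of both.
record OrderedField : Set₁ where
  field
    algebra : ℚAlgebra
  open ℚAlgebra algebra public
  open LinearAlgebra algebra public
  open IdentityMatrix algebra public
  field
    NonNeg      : Carrier → Set
    nn-resp     : ∀ {x y} → x ≈ y → NonNeg x → NonNeg y
    nn-+        : ∀ {x y} → NonNeg x → NonNeg y → NonNeg (x + y)
    nn-*        : ∀ {x y} → NonNeg x → NonNeg y → NonNeg (x * y)
    nn-ι        : ∀ {q} → 0ℚ ℚ.≤ q → NonNeg (ι q)
    nn-antisym  : ∀ {x} → NonNeg x → NonNeg (- x) → x ≈ 0#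
    nn-stable   : ∀ {x} → ¬ ¬ NonNeg x → NonNeg x
    nn-total    : ∀ x → ¬ ¬ (NonNeg x ⊎ NonNeg (- x))
    1≉0         : ¬ 1# ≈ 0#
    inverse     : ∀ {x} → ¬ x ≈ 0# → ¬ ¬ (∃[ y ] x * y ≈ 1#)
    archimedean : ∀ x → ¬ ¬ (∃[ k ] NonNeg (nat k - x))

module Rayleigh (F : OrderedField) where
  open OrderedField F

  -- x·Hx ≤ μ x·x for all x
  Top : ∀ {n} → Mat n → Carrier → Set
  Top H μ = ∀ x → NonNeg (μ * x ∙ x - x ∙ (H ·ᵥ x))

  -- Every quadratic form has a least upper bound μ on the unit sphere.  That no smaller bound
  -- exists is expressed by vectors x ≠ 0 with k (μ x·x - x·Hx) ≤ x·x, for every natural number k.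
  NearTop : Set
  NearTop = ∀ {n} (H : Mat (suc n)) → ∃[ μ ] Top H μ ×
    (∀ k → ∃[ x ] ¬ (∀ i → x i ≈ 0#) × NonNeg (x ∙ x - nat k * (μ * x ∙ x - x ∙ (H ·ᵥ x))))

module OrderedFieldProperties (F : OrderedField) where
  open OrderedField F
  open SetoidReasoning setoid

  nn-0 : NonNeg 0#
  nn-0 = nn-resp ι-0 (nn-ι ℚ.≤-refl)

  nn-1 : NonNeg 1#
  nn-1 = nn-resp ι-1 (nn-ι (ℚ.<⇒≤ (ℚ.positive⁻¹ 1ℚ)))

  nn-½ : NonNeg (ι ½)
  nn-½ = nn-ι (ℚ.<⇒≤ (ℚ.positive⁻¹ ½))

  nn-≈0 : ∀ {x} → x ≈ 0# → NonNeg x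
  nn-≈0 x≈0 = nn-resp (sym x≈0) nn-0

  ≈-stable : ∀ {x y} → ¬ ¬ x ≈ y → x ≈ y
  ≈-stable {x} {y} ¬¬eq = ≈-difference
    (nn-antisym (stable d≈0 nn-≈0) (stable d≈0 (λ e → nn-≈0 (-0≈0 e))))
    where
    d≈0 : ¬ ¬ (x - y ≈ 0#)
    d≈0 k = ¬¬eq λ e → k (difference≈0 e)
    stable : ∀ {z} → ¬ ¬ (x - y ≈ 0#) → (x - y ≈ 0# → NonNeg z) → NonNeg z
    stable p f = nn-stable (λ k → p (k ∘ f))

  sq-nn : ∀ x → NonNeg (x * x)
  sq-nn x = nn-stable λ k → nn-total x λ
    { (inj₁ p) → k (nn-* p p)
    ; (inj₂ p) → k (nn-resp (solve 1 (λ x → (:- x) :* (:- x) := x :* x) refl x) (nn-* p p)) }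

  *-cancel : ∀ {x y} → ¬ x ≈ 0# → x * y ≈ 0# → y ≈ 0#
  *-cancel {x} {y} x≉0 xy≈0 = ≈-stable λ k → inverse x≉0 λ (x′ , e) → k (begin
    y             ≈⟨ *-identityˡ y ⟨
    1# * y        ≈⟨ *-congʳ e ⟨
    x * x′ * y    ≈⟨ solve 3 (λ x x′ y → x :* x′ :* y := x′ :* (x :* y)) refl x x′ y ⟩
    x′ * (x * y)  ≈⟨ *-congˡ xy≈0 ⟩
    x′ * 0#       ≈⟨ zeroʳ x′ ⟩
    0# ∎)

  sq≈0 : ∀ {x} → x * x ≈ 0# → x ≈ 0#
  sq≈0 {x} e = ≈-stable λ k → k (*-cancel k e)

  ½-double : ∀ {x} → NonNeg (x + x) → NonNeg x
  ½-double {x} p = nn-resp (solve 1 (λ x → con ½ :* (x :+ x) := x) refl x) (nn-* nn-½ p)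

  squeeze : ∀ {x y} → NonNeg x → NonNeg y → NonNeg (- (x + y)) → x ≈ 0#
  squeeze {x} {y} p q r = nn-antisym p
    (nn-resp (solve 2 (λ x y → y :+ :- (x :+ y) := :- x) refl x y) (nn-+ q r))

  ¬nn-−1 : ¬ NonNeg (- 1#)
  ¬nn-−1 p = 1≉0 (nn-antisym nn-1 p)

  sum-nn : ∀ {n} (u : Vec n) → (∀ i → NonNeg (u i)) → NonNeg (sum u)
  sum-nn {zero}  u p = nn-≈0 (sum-empty u)
  sum-nn {suc n} u p = nn-resp (sym (sum-suc u)) (nn-+ (p zero) (sum-nn (u ∘ suc) (p ∘ suc)))

  sum-nn≈0 : ∀ {n} (u : Vec n) → (∀ i → NonNeg (u i)) → NonNeg (- sum u) → ∀ i → u i ≈ 0#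
  sum-nn≈0 {suc n} u p s = λ
    { zero    → squeeze (p zero) tail-nn s′
    ; (suc i) → sum-nn≈0 (u ∘ suc) (p ∘ suc)
        (nn-resp (solve 2 (λ x y → x :+ :- (x :+ y) := :- y) refl _ _) (nn-+ (p zero) s′)) i }
    where
    tail-nn = sum-nn (u ∘ suc) (p ∘ suc)
    s′ = nn-resp (-‿cong (sum-suc u)) s

  ∙-nn : ∀ {n} (u : Vec n) → NonNeg (u ∙ u)
  ∙-nn u = sum-nn _ (λ i → sq-nn (u i))

  ∙-definite : ∀ {n} (u : Vec n) → NonNeg (- (u ∙ u)) → ∀ i → u i ≈ 0#
  ∙-definite u p i = sq≈0 (sum-nn≈0 _ (λ i → sq-nn (u i)) p i)

  term≤sum : ∀ {n} (u : Vec n) → (∀ i → NonNeg (u i)) → ∀ i → NonNeg (sum u - u i)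
  term≤sum u p zero    = nn-resp (trans (solve 2 (λ a s → s := (a :+ s) :- a) refl (u zero) _)
      (+-congʳ (sym (sum-suc u))))
    (sum-nn (u ∘ suc) (p ∘ suc))
  term≤sum u p (suc i) = nn-resp (trans (solve 3 (λ a s b → a :+ (s :- b) := (a :+ s) :- b) refl (u zero) _
      (u (suc i))) (+-congʳ (sym (sum-suc u))))
    (nn-+ (p zero) (term≤sum (u ∘ suc) (p ∘ suc) i))

  sum-const : ∀ n c → sum {n} (λ _ → c) ≈ nat n * c
  sum-const zero    c = trans (sum-empty _) (sym (zeroˡ c))
  sum-const (suc n) c = trans (sum-suc _) (trans (+-cong (sym (*-identityˡ c)) (sum-const n c))
      (sym (distribʳ c 1# (nat n))))

  -- If all entries of M are bounded by c in absolute value, then x·Mx ≤ n²c x·x.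
  form-bound : ∀ {n} (M : Mat n) c → (∀ i j → NonNeg (c - M i j)) → (∀ i j → NonNeg (c + M i j)) →
    ∀ x → NonNeg (nat n * (nat n * c) * x ∙ x - x ∙ (M ·ᵥ x))
  form-bound {n} M c lower upper x = nn-resp (begin
    sum (λ i → sum (λ j → c * X - M i j * (x i * x j)))
      ≈⟨ sum-cong (λ i → trans (sum-+ _ _) (+-cong (sum-const n _) (sum-neg _))) ⟩
    sum (λ i → nat n * (c * X) - sum (λ j → M i j * (x i * x j)))
      ≈⟨ trans (sum-+ _ _) (+-cong (sum-const n _) (sum-neg _)) ⟩
    nat n * (nat n * (c * X)) - sum (λ i → sum (λ j → M i j * (x i * x j)))
      ≈⟨ +-cong (solve 3 (λ n c X → n :* (n :* (c :* X)) := n :* (n :* c) :* X) refl (nat n) c X)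
          (-‿cong (sym (form-expand M x))) ⟩
    nat n * (nat n * c) * X - x ∙ (M ·ᵥ x) ∎) (sum-nn _ λ i → sum-nn _ λ j → term i j)
    where
    X = x ∙ x
    square≤X : ∀ i → NonNeg (X - x i * x i)
    square≤X = term≤sum _ (λ i → sq-nn (x i))
    term : ∀ i j → NonNeg (c * X - M i j * (x i * x j))
    term i j = ½-double (nn-resp
      (solve 5 (λ c m X a b → (c :- m) :* (X :+ a :* b) :+ (c :+ m) :* (X :- a :* b)
         := (c :* X :- m :* (a :* b)) :+ (c :* X :- m :* (a :* b))) refl c (M i j) X (x i) (x j))
      (nn-+ (nn-* (lower i j) (½-double (nn-resp
          (solve 3 (λ X a b → (X :- a :* a) :+ (X :- b :* b) :+ (a :+ b) :* (a :+ b) := (X :+ a :* b) :+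
              (X :+ a :* b)) refl X (x i) (x j))
          (nn-+ (nn-+ (square≤X i) (square≤X j)) (sq-nn (x i + x j))))))
        (nn-* (upper i j) (½-double (nn-resp
          (solve 3 (λ X a b → (X :- a :* a) :+ (X :- b :* b) :+ (a :- b) :* (a :- b) := (X :- a :* b) :+
              (X :- a :* b)) refl X (x i) (x j))
          (nn-+ (nn-+ (square≤X i) (square≤X j)) (sq-nn (x i - x j))))))))

  inverse-nn : ∀ {x y} → NonNeg x → x * y ≈ 1# → NonNeg y
  inverse-nn {x} {y} p e = nn-resp (begin
    x * (y * y)  ≈⟨ *-assoc x y y ⟨
    x * y * y    ≈⟨ *-congʳ e ⟩
    1# * y       ≈⟨ *-identityˡ y ⟩
    y ∎) (nn-* p (sq-nn y))

  PSD : ∀ {n} → Mat n → Set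
  PSD P = ∀ x → NonNeg (x ∙ (P ·ᵥ x))

  -- A zero of a positive semidefinite form lies in the kernel.  With y = Px, a = y·y and b = y·Py,
  -- the form takes the value -a²(b + 2) at z = (b + 1)x - a y, which forces a = 0.
  psd-kernel : ∀ {n} (P : Mat n) → SymmetricM P → PSD P → ∀ x →
    NonNeg (- (x ∙ (P ·ᵥ x))) → ∀ i → (P ·ᵥ x) i ≈ 0#
  psd-kernel P P-sym psd x xPx≤0 = ∙-definite y (nn-≈0 (-0≈0 (sq≈0 (nn-antisym (sq-nn a) −a²≥0))))
    where
    y = P ·ᵥ x
    a = y ∙ y
    b = y ∙ (P ·ᵥ y)
    β = b + ι 1ℚ
    z : Vec _
    z i = β * x i + - a * y i
    xPx≈0 : x ∙ y ≈ 0#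
    xPx≈0 = nn-antisym (psd x) xPx≤0
    xPy : x ∙ (P ·ᵥ y) ≈ a
    xPy = selfadjoint P P-sym x y
    zPz : z ∙ (P ·ᵥ z) ≈ - (a * a * (b + ι 1ℚ + ι 1ℚ))
    zPz = begin
      z ∙ (P ·ᵥ z)
        ≈⟨ ∙-cong (λ _ → refl) (λ i → ∙-linʳ (P i) β x (- a) y) ⟩
      z ∙ (λ i → β * y i + - a * (P ·ᵥ y) i)
        ≈⟨ ∙-linʳ z β y (- a) (P ·ᵥ y) ⟩
      β * z ∙ y + - a * z ∙ (P ·ᵥ y)
        ≈⟨ +-cong (*-congˡ (∙-linˡ β x (- a) y y)) (*-congˡ (∙-linˡ β x (- a) y (P ·ᵥ y))) ⟩
      β * (β * x ∙ y + - a * a) + - a * (β * x ∙ (P ·ᵥ y) + - a * b)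
        ≈⟨ +-cong (*-congˡ (+-congʳ (*-congˡ (trans xPx≈0 (sym ι-0))))) (*-congˡ (+-congʳ (*-congˡ xPy))) ⟩
      β * (β * ι 0ℚ + - a * a) + - a * (β * a + - a * b)
        ≈⟨ solve 2 (λ a b → let β = b :+ con 1ℚ in
             β :* (β :* con 0ℚ :+ :- a :* a) :+ :- a :* (β :* a :+ :- a :* b)
               := :- (a :* a :* (b :+ con 1ℚ :+ con 1ℚ))) refl a b ⟩
      - (a * a * (b + ι 1ℚ + ι 1ℚ)) ∎
    −a²≥0 : NonNeg (- (a * a))
    −a²≥0 = ½-double (nn-resp
      (solve 2 (λ a b → :- (a :* a :* (b :+ con 1ℚ :+ con 1ℚ)) :+ a :* a :* b := :- (a :* a) :+ :- (a :* a)) refl a b)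
      (nn-+ (nn-resp zPz (psd z)) (nn-* (sq-nn a) (psd y))))

  -- The form of P is nonpositive at some nonzero vector.
  Degenerate : ∀ {n} → Mat n → Set
  Degenerate P = ∃[ x ] ¬ (∀ i → x i ≈ 0#) × NonNeg (- (x ∙ (P ·ᵥ x)))

  -- The form of P is nonnegative and controls every linear functional ℓ: (ℓ·x)² ≤ K x·Px.  This is
  -- positive definiteness in a shape that passes from a Schur complement to the matrix.
  Definite : ∀ {n} → Mat n → Set
  Definite P = PSD P × (∀ ℓ → ∃[ K ] NonNeg K × (∀ x → NonNeg (K * x ∙ (P ·ᵥ x) - ℓ ∙ x * ℓ ∙ x)))

  -- The dichotomy behind the existence of eigenvectors, by repeated completion of squares: if the
  -- corner entry is not positive, the first basis vector shows degeneracy; otherwise pass to the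
  -- Schur complement.
  degenerate-or-definite : ∀ {n} (P : Mat n) → SymmetricM P → ¬ ¬ (Degenerate P ⊎ Definite P)
  degenerate-or-definite {zero} P _ k = k (inj₂ ((λ x → nn-≈0 (sum-empty _)) , λ ℓ → 0# , nn-0 , λ x → nn-≈0 (begin
    0# * x ∙ (P ·ᵥ x) - ℓ ∙ x * ℓ ∙ x  ≈⟨ +-cong (zeroˡ _) (-0≈0 (trans (*-congʳ (sum-empty _)) (zeroˡ _))) ⟩
    0# + 0#                            ≈⟨ +-identityˡ 0# ⟩
    0# ∎)))
  degenerate-or-definite {suc n} P P-sym k = nn-total a λ
    { (inj₂ −a≥0) → a≤0 −a≥0
    ; (inj₁ a≥0)  → ¬¬-lem λ
      { (inj₁ a≈0) → a≤0 (nn-≈0 (-0≈0 a≈0))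
      ; (inj₂ a≉0) → inverse a≉0 λ (a′ , aa′) → a>0 a≥0 a′ aa′ } }
    where
    a = P zero zero
    e₀ : Vec (suc n)
    e₀ = 𝟙 zero
    a≤0 : NonNeg (- a) → ⊥
    a≤0 −a≥0 = k (inj₁ (e₀ , (λ z → 1≉0 (z zero)) , nn-resp (-‿cong (sym e₀-form)) −a≥0))
      where
      e₀-form : e₀ ∙ (P ·ᵥ e₀) ≈ a
      e₀-form = trans (𝟙-· _ zero) (trans (∙-comm (P zero) e₀) (𝟙-· (P zero) zero))
    a>0 : NonNeg a → ∀ a′ → a * a′ ≈ 1# → ⊥
    a>0 a≥0 a′ aa′ = degenerate-or-definite S S-sym λ
      { (inj₁ (u , u≉0 , uSu≤0)) → k (inj₁ (lift u , (λ z → u≉0 (z ∘ suc)) ,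
          nn-resp (-‿cong (sym (lift-form u))) uSu≤0))
      ; (inj₂ (psd , bound)) → k (inj₂ (P-psd psd , λ ℓ → P-bound psd ℓ (bound (reduce ℓ)))) }
      where
      g : Vec n
      g i = P zero (suc i)
      S = Schur P g a′
      a′≥0 = inverse-nn a≥0 aa′
      S-sym : SymmetricM S
      S-sym i j = +-cong (P-sym (suc i) (suc j)) (-‿cong (*-congˡ (*-comm (g i) (g j))))
      -- The linear form that is squared in x·Px = a (top x)² + u·Su.
      top : Vec (suc n) → Carrier
      top x = x zero + a′ * g ∙ (x ∘ suc)
      square : ∀ x → x ∙ (P ·ᵥ x) ≈ a * (top x * top x) + (x ∘ suc) ∙ (S ·ᵥ (x ∘ suc))
      square = complete-square P g a′ (λ i → +-congˡ (P-sym zero (suc i))) aa′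
      lift : Vec n → Vec (suc n)
      lift u = - (a′ * g ∙ u) ∷ u
      lift-form : ∀ u → lift u ∙ (P ·ᵥ lift u) ≈ u ∙ (S ·ᵥ u)
      lift-form u = begin
        lift u ∙ (P ·ᵥ lift u)                                    ≈⟨ square (lift u) ⟩
        a * (top (lift u) * top (lift u)) + u ∙ (S ·ᵥ u)          ≈⟨ +-congʳ (*-congˡ (*-congʳ (-‿inverseˡ _))) ⟩
        a * (0# * top (lift u)) + u ∙ (S ·ᵥ u)                    ≈⟨ +-congʳ (trans (*-congˡ (zeroˡ _)) (zeroʳ a)) ⟩
        0# + u ∙ (S ·ᵥ u)                                         ≈⟨ +-identityˡ _ ⟩
        u ∙ (S ·ᵥ u) ∎
      P-psd : PSD S → PSD P
      P-psd psd x = nn-resp (sym (square x)) (nn-+ (nn-* a≥0 (sq-nn (top x))) (psd (x ∘ suc)))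
      -- The functional with ℓ·x = ℓ₀ (top x) + reduce ℓ · u; then (p + q)² ≤ 2p² + 2q² gives the bound.
      reduce : Vec (suc n) → Vec n
      reduce ℓ i = ι 1ℚ * ℓ (suc i) + - (ℓ zero * a′) * g i
      P-bound : PSD S → ∀ ℓ →
        ∃[ K ] NonNeg K × (∀ u → NonNeg (K * u ∙ (S ·ᵥ u) - reduce ℓ ∙ u * reduce ℓ ∙ u)) →
        ∃[ K ] NonNeg K × (∀ x → NonNeg (K * x ∙ (P ·ᵥ x) - ℓ ∙ x * ℓ ∙ x))
      P-bound psd ℓ (K , K≥0 , bound) = K₂ , K₂≥0 , λ x →
        let u = x ∘ suc ; t = top x ; s = u ∙ (S ·ᵥ u) ; m = reduce ℓ ∙ u
            split : ℓ ∙ x ≈ ℓ₀ * t + m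
            split = begin
              ℓ ∙ x
                ≈⟨ sum-suc _ ⟩
              ℓ₀ * x zero + (ℓ ∘ suc) ∙ u
                ≈⟨ solve 5 (λ l x a γ d → l :* x :+ d := l :* (x :+ a :* γ) :+ (con 1ℚ :* d :+ :- (l :* a) :* γ))
                     refl ℓ₀ (x zero) a′ (g ∙ u) ((ℓ ∘ suc) ∙ u) ⟩
              ℓ₀ * t + (ι 1ℚ * (ℓ ∘ suc) ∙ u + - (ℓ₀ * a′) * g ∙ u)
                ≈⟨ +-congˡ (∙-linˡ (ι 1ℚ) (ℓ ∘ suc) _ g u) ⟨
              ℓ₀ * t + m ∎
            decomposition : (K * s - m * m) + (K * s - m * m)
                + (ℓ₀ * t - m) * (ℓ₀ * t - m)
                + ((K + K) * (a * (t * t)) + (ℓ₀ * ℓ₀ * a′ + ℓ₀ * ℓ₀ * a′) * s) ≈ K₂ * x ∙ (P ·ᵥ x) - ℓ ∙ x * ℓ ∙ x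
            decomposition = begin
              (K * s - m * m) + (K * s - m * m) + (ℓ₀ * t - m) * (ℓ₀ * t - m)
                + ((K + K) * (a * (t * t)) + (ℓ₀ * ℓ₀ * a′ + ℓ₀ * ℓ₀ * a′) * s)
                ≈⟨ solve 7 (λ K s m l t a a′ →
                     (K :* s :- m :* m) :+ (K :* s :- m :* m) :+ (l :* t :- m) :* (l :* t :- m)
                       :+ ((K :+ K) :* (a :* (t :* t)) :+ (l :* l :* a′ :+ l :* l :* a′) :* s)
                     := (l :* l :+ l :* l) :* (t :* t) :* con 1ℚ :+ (K :+ K) :* (a :* (t :* t))
                        :+ (l :* l :* a′ :+ l :* l :* a′ :+ (K :+ K)) :* s
                        :- (l :* t :+ m) :* (l :* t :+ m)) refl K s m ℓ₀ t a a′ ⟩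
              (ℓ₀ * ℓ₀ + ℓ₀ * ℓ₀) * (t * t) * ι 1ℚ + (K + K) * (a * (t * t)) + K₂ * s - (ℓ₀ * t + m) * (ℓ₀ * t + m)
                ≈⟨ +-congʳ (+-congʳ (+-congʳ (*-congˡ (trans ι-1 (sym aa′))))) ⟩
              (ℓ₀ * ℓ₀ + ℓ₀ * ℓ₀) * (t * t) * (a * a′) + (K + K) * (a * (t * t)) + K₂ * s - (ℓ₀ * t + m) *
                  (ℓ₀ * t + m)
                ≈⟨ solve 7 (λ K s m l t a a′ →
                     (l :* l :+ l :* l) :* (t :* t) :* (a :* a′) :+ (K :+ K) :* (a :* (t :* t))
                        :+ (l :* l :* a′ :+ l :* l :* a′ :+ (K :+ K)) :* s
                        :- (l :* t :+ m) :* (l :* t :+ m)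
                     := (l :* l :* a′ :+ l :* l :* a′ :+ (K :+ K)) :* (a :* (t :* t) :+ s)
                        :- (l :* t :+ m) :* (l :* t :+ m)) refl K s m ℓ₀ t a a′ ⟩
              K₂ * (a * (t * t) + s) - (ℓ₀ * t + m) * (ℓ₀ * t + m)
                ≈⟨ +-cong (*-congˡ (square x)) (-‿cong (*-cong split split)) ⟨
              K₂ * x ∙ (P ·ᵥ x) - ℓ ∙ x * ℓ ∙ x ∎
        in nn-resp decomposition (nn-+ (nn-+ (nn-+ (bound u) (bound u)) (sq-nn _))
             (nn-+ (nn-* (nn-+ K≥0 K≥0) (nn-* a≥0 (sq-nn t))) (nn-* ℓ²a′≥0 (psd u))))
        where
        ℓ₀ = ℓ zero
        K₂ = ℓ₀ * ℓ₀ * a′ + ℓ₀ * ℓ₀ * a′ + (K + K)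
        ℓ²a′≥0 : NonNeg (ℓ₀ * ℓ₀ * a′ + ℓ₀ * ℓ₀ * a′)
        ℓ²a′≥0 = nn-+ (nn-* (sq-nn ℓ₀) a′≥0) (nn-* (sq-nn ℓ₀) a′≥0)
        K₂≥0 : NonNeg K₂
        K₂≥0 = nn-+ ℓ²a′≥0 (nn-+ K≥0 K≥0)

-- Eigenvectors of symmetric matrices

module Spectral (F : OrderedField) (near-top : Rayleigh.NearTop F) where
  open OrderedField F
  open OrderedFieldProperties F
  open Rayleigh F
  open SetoidReasoning setoid

  -- v is an eigenvector of H with eigenvalue μ, both over the ordered field.
  record Eigen {n} (H : Mat n) (μ : Carrier) (v : Vec n) : Set where
    constructor mkEigen
    field
      nonzero : ¬ (∀ i → v i ≈ 0#)
      eigen   : ∀ i → (H ·ᵥ v) i ≈ μ * v i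

  ⊝-sym : ∀ {n} μ {H : Mat n} → SymmetricM H → SymmetricM (μ ⊝ H)
  ⊝-sym μ H-sym i j = +-cong (*-congˡ (𝟙-sym i j)) (*-congˡ (H-sym i j))

  -1*≈ : ∀ x → - 1# * x ≈ - x
  -1*≈ x = trans (*-congʳ (-‿cong (sym ι-1))) (solve 1 (λ x → :- con 1ℚ :* x := :- x) refl x)

  ⊝-kernel : ∀ {n} μ (H : Mat n) x → (∀ i → ((μ ⊝ H) ·ᵥ x) i ≈ 0#) → ∀ i → (H ·ᵥ x) i ≈ μ * x i
  ⊝-kernel μ H x z i = sym (≈-difference (begin
    μ * x i - (H ·ᵥ x) i         ≈⟨ +-congˡ (-1*≈ _) ⟨
    μ * x i + - 1# * (H ·ᵥ x) i  ≈⟨ ⊝-· μ H x i ⟨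
    ((μ ⊝ H) ·ᵥ x) i             ≈⟨ z i ⟩
    0# ∎))

  top-kernel : ∀ {n} (H : Mat n) → SymmetricM H → ∀ {μ} → Top H μ → ∀ x →
    NonNeg (- (μ * x ∙ x - x ∙ (H ·ᵥ x))) → ∀ i → (H ·ᵥ x) i ≈ μ * x i
  top-kernel H H-sym {μ} top x p = ⊝-kernel μ H x
    (psd-kernel (μ ⊝ H) (⊝-sym μ H-sym) (λ y → nn-resp (sym (⊝-form μ H y)) (top y)) x
      (nn-resp (-‿cong (sym (⊝-form μ H x))) p))

  -- The least upper bound μ of the form of H is attained at an eigenvector.  Otherwise μ𝟙 - H is
  -- definite, hence x·x ≤ K (μ x·x - x·Hx) for some K, against the choice of μ as the least bound.
  top-eigenvector : ∀ {n} (H : Mat (suc n)) → SymmetricM H →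
    ¬ ¬ (∃[ μ ] Top H μ × ∃[ v ] Eigen H μ v)
  top-eigenvector {n} H H-sym k with near-top H
  ... | μ , top , near = degenerate-or-definite P (⊝-sym μ H-sym) λ
    { (inj₁ (x , x≉0 , p)) → k (μ , top , x ,
        mkEigen x≉0 (top-kernel H H-sym top x (nn-resp (-‿cong (⊝-form μ H x)) p)))
    ; (inj₂ (psd , bound)) → archimedean (sum (λ i → proj₁ (bound (𝟙 i)))) (λ (m , p) → absurd psd bound m p) }
    where
    P = μ ⊝ H
    absurd : PSD P → (bound : ∀ ℓ → ∃[ K ] NonNeg K × (∀ x → NonNeg (K * x ∙ (P ·ᵥ x) - ℓ ∙ x * ℓ ∙ x))) →
      ∀ m → NonNeg (nat m - sum (λ i → proj₁ (bound (𝟙 i)))) → ⊥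
    absurd psd bound m m≥K with near (suc m)
    ... | x , x≉0 , small = x≉0 (∙-definite x (nn-resp x∙x-bound (nn-+ Kq≥xx (nn-* K≥0 −q≥0))))
      where
      K = sum (λ i → proj₁ (bound (𝟙 i)))
      K≥0 : NonNeg K
      K≥0 = sum-nn _ (λ i → proj₁ (proj₂ (bound (𝟙 i))))
      q = x ∙ (P ·ᵥ x)
      Kq≥xx : NonNeg (K * q - x ∙ x)
      Kq≥xx = nn-resp (begin
        sum (λ i → proj₁ (bound (𝟙 i)) * q - 𝟙 i ∙ x * 𝟙 i ∙ x)
          ≈⟨ sum-+ _ _ ⟩
        sum (λ i → proj₁ (bound (𝟙 i)) * q) + sum (λ i → - (𝟙 i ∙ x * 𝟙 i ∙ x))
          ≈⟨ +-cong (sym (*-sumʳ q _)) (trans (sum-neg _) (-‿cong (∙-cong (𝟙-· x) (𝟙-· x)))) ⟩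
        K * q - x ∙ x ∎) (sum-nn _ (λ i → proj₂ (proj₂ (bound (𝟙 i))) x))
      −q≥0 : NonNeg (- q)
      −q≥0 = nn-resp (begin
        (K * q - x ∙ x) + ((x ∙ x - nat (suc m) * (μ * x ∙ x - x ∙ (H ·ᵥ x))) + (nat m - K) * q)
          ≈⟨ +-congˡ (+-congʳ (+-congˡ (-‿cong (*-cong (+-congʳ (sym ι-1)) (sym (⊝-form μ H x)))))) ⟩
        (K * q - x ∙ x) + ((x ∙ x - (ι 1ℚ + nat m) * q) + (nat m - K) * q)
          ≈⟨ solve 4 (λ K q x m → (K :* q :- x) :+ ((x :- (con 1ℚ :+ m) :* q) :+ (m :- K) :* q) := :- q) refl K q
              (x ∙ x) (nat m) ⟩
        - q ∎) (nn-+ Kq≥xx (nn-+ small (nn-* m≥K (psd x))))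
      x∙x-bound : (K * q - x ∙ x) + K * - q ≈ - (x ∙ x)
      x∙x-bound = solve 3 (λ K q x → (K :* q :- x) :+ K :* (:- q) := :- x) refl K q (x ∙ x)

  trace : ∀ {n} → Mat n → Carrier
  trace M = sum (λ i → M i i)

  psd-trace : ∀ {n} (M : Mat n) → PSD M → NonNeg (trace M)
  psd-trace M psd = sum-nn _ λ i → nn-resp (trans (𝟙-· _ i) (trans (∙-comm (M i) _) (𝟙-· (M i) i))) (psd (𝟙 i))

  -- Let B = A + s𝟙 ≥ 1 and let r be orthogonal to all eigenvectors of A.  A deflation of B is a
  -- symmetric positive semidefinite H with BH = H², that is, B composed with a spectral projection;
  -- an eigenvector of H with nonzero eigenvalue μ is then an eigenvector of B with the same
  -- eigenvalue, so μ ≥ 1.  Subtracting μ times the projection onto it gives a new deflation H′ with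
  -- smaller trace and the same value at r.
  module Deflation {n : ℕ} (A : Mat (suc n)) (s : Carrier) (B : Mat (suc n))
    (B-·     : ∀ x i → (B ·ᵥ x) i ≈ (A ·ᵥ x) i + s * x i)
    (B≥1     : ∀ x → NonNeg (x ∙ (B ·ᵥ x) - x ∙ x))
    (r       : Vec (suc n))
    (r-orth  : ∀ {μ v} → Eigen A μ v → r ∙ v ≈ 0#) where

    record Deflated (H : Mat (suc n)) : Set where
      field
        symmetric : SymmetricM H
        psd       : PSD H
        square    : ∀ x i → (B ·ᵥ (H ·ᵥ x)) i ≈ (H ·ᵥ (H ·ᵥ x)) i

    module Step (H : Mat (suc n)) (D : Deflated H) (μ : Carrier) (v : Vec (suc n))
      (μ≉0 : ¬ μ ≈ 0#) (v-eigen : Eigen H μ v)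
      (w : Carrier) (w-inv : (v ∙ v) * w ≈ 1#) where
      open Deflated D
      open Eigen v-eigen

      c = μ * w
      H′ : Mat (suc n)
      H′ i j = H i j + - (c * v i) * v j

      w≥0 : NonNeg w
      w≥0 = inverse-nn (∙-nn v) w-inv

      Bv : ∀ i → (B ·ᵥ v) i ≈ μ * v i
      Bv i = ≈-stable λ k → inverse μ≉0 λ (μ′ , e) → k (begin
        (B ·ᵥ v) i                              ≈⟨ *-identityˡ _ ⟨
        1# * (B ·ᵥ v) i                         ≈⟨ *-congʳ e ⟨
        μ * μ′ * (B ·ᵥ v) i                     ≈⟨ solve 3 (λ a b x → a :* b :* x := b :* (a :* x)) refl μ μ′ _ ⟩
        μ′ * (μ * (B ·ᵥ v) i)                   ≈⟨ *-congˡ (sym (∙-*ʳ (B i) μ v)) ⟩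
        μ′ * (B ·ᵥ (λ j → μ * v j)) i           ≈⟨ *-congˡ (∙-cong (λ _ → refl) (λ j → sym (eigen j))) ⟩
        μ′ * (B ·ᵥ (H ·ᵥ v)) i                  ≈⟨ *-congˡ (square v i) ⟩
        μ′ * (H ·ᵥ (H ·ᵥ v)) i                  ≈⟨ *-congˡ (∙-cong (λ _ → refl) eigen) ⟩
        μ′ * (H ·ᵥ (λ j → μ * v j)) i           ≈⟨ *-congˡ (trans (∙-*ʳ (H i) μ v) (*-congˡ (eigen i))) ⟩
        μ′ * (μ * (μ * v i))                    ≈⟨ solve 3 (λ a b x → b :* (a :* x) := a :* b :* x) refl μ μ′ _ ⟩
        μ * μ′ * (μ * v i)                      ≈⟨ *-congʳ e ⟩
        1# * (μ * v i)                          ≈⟨ *-identityˡ _ ⟩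
        μ * v i ∎)

      A-eigen : Eigen A (μ - s) v
      A-eigen = mkEigen nonzero λ i → begin
        (A ·ᵥ v) i                         ≈⟨ solve 2 (λ a b → a := (a :+ b) :- b) refl _ (s * v i) ⟩
        ((A ·ᵥ v) i + s * v i) - s * v i   ≈⟨ +-congʳ (trans (sym (B-· v i)) (Bv i)) ⟩
        μ * v i - s * v i                  ≈⟨ solve 3 (λ a b x → a :* x :- b :* x := (a :- b) :* x) refl μ s (v i) ⟩
        (μ - s) * v i ∎

      μ≥1 : NonNeg (μ - 1#)
      μ≥1 = nn-resp (begin
        (v ∙ (B ·ᵥ v) - v ∙ v) * w      ≈⟨ *-congʳ (+-congʳ (trans (∙-cong (λ _ → refl) Bv) (∙-*ʳ v μ v))) ⟩
        (μ * v ∙ v - v ∙ v) * w         ≈⟨ solve 3 (λ m x w → (m :* x :- x) :* w := m :* (x :* w) :- x :* w) refl μ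
            (v ∙ v) w ⟩
        μ * (v ∙ v * w) - v ∙ v * w     ≈⟨ +-cong (*-congˡ w-inv) (-‿cong w-inv) ⟩
        μ * 1# - 1#                     ≈⟨ +-congʳ (*-identityʳ μ) ⟩
        μ - 1# ∎) (nn-* (B≥1 v) w≥0)

      H′-· : ∀ x i → (H′ ·ᵥ x) i ≈ (H ·ᵥ x) i + - (c * v ∙ x) * v i
      H′-· x i = trans (∙-+ˡ (H i) _ x) (+-congˡ (trans (∙-*ˡ _ v x)
        (solve 3 (λ c v d → (:- (c :* v)) :* d := (:- (c :* d)) :* v) refl c (v i) (v ∙ x))))

      v∙Hx : ∀ x → v ∙ (H ·ᵥ x) ≈ μ * v ∙ x
      v∙Hx x = begin
        v ∙ (H ·ᵥ x)          ≈⟨ selfadjoint H symmetric v x ⟩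
        (H ·ᵥ v) ∙ x          ≈⟨ ∙-cong eigen (λ _ → refl) ⟩
        (λ i → μ * v i) ∙ x   ≈⟨ ∙-*ˡ μ v x ⟩
        μ * v ∙ x ∎

      -- The quadratic form of H′ at x is that of H at the component of x orthogonal to v.
      H′-form : ∀ x → let y = λ i → x i + - (w * v ∙ x) * v i in x ∙ (H′ ·ᵥ x) ≈ y ∙ (H ·ᵥ y)
      H′-form x = begin
        x ∙ (H′ ·ᵥ x)
          ≈⟨ trans (∙-cong (λ _ → refl) (H′-· x))
              (trans (∙-+ʳ x _ _) (+-congˡ (trans (∙-*ʳ x _ v) (*-congˡ (∙-comm x v))))) ⟩
        x ∙ (H ·ᵥ x) + - (c * d) * d
          ≈⟨ solve 4 (λ q m w d → q :+ (:- (m :* w :* d)) :* d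
                := (q :+ (:- (w :* d)) :* (m :* d)) :+ (:- (w :* d)) :* (m :* d :+ (:- (d :* con 1ℚ)) :* m)) refl
                    (x ∙ (H ·ᵥ x)) μ w d ⟩
        (x ∙ (H ·ᵥ x) + e * (μ * d)) + e * (μ * d + - (d * ι 1ℚ) * μ)
          ≈⟨ +-congˡ (*-congˡ (+-congˡ (*-congʳ (-‿cong (*-congˡ (trans ι-1 (sym w-inv))))))) ⟩
        (x ∙ (H ·ᵥ x) + e * (μ * d)) + e * (μ * d + - (d * (v ∙ v * w)) * μ)
          ≈⟨ solve 5 (λ q m w d z → let e = :- (w :* d) in
               (q :+ e :* (m :* d)) :+ e :* (m :* d :+ (:- (d :* (z :* w))) :* m)
               := (q :+ e :* (m :* d)) :+ e :* (m :* d :+ e :* (m :* z))) refl (x ∙ (H ·ᵥ x)) μ w d (v ∙ v) ⟩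
        (x ∙ (H ·ᵥ x) + e * (μ * d)) + e * (μ * d + e * (μ * v ∙ v))
          ≈⟨ +-cong (+-congˡ (*-congˡ x∙Hv)) (*-congˡ (+-cong (v∙Hx x) (*-congˡ (v∙Hx v)))) ⟨
        (x ∙ (H ·ᵥ x) + e * x ∙ (H ·ᵥ v)) + e * (v ∙ (H ·ᵥ x) + e * v ∙ (H ·ᵥ v))
          ≈⟨ +-cong (expand x) (*-congˡ (expand v)) ⟨
        x ∙ (H ·ᵥ y) + e * v ∙ (H ·ᵥ y)
          ≈⟨ trans (∙-+ˡ x _ _) (+-congˡ (∙-*ˡ e v _)) ⟨
        y ∙ (H ·ᵥ y) ∎
        where
        d = v ∙ x
        e = - (w * d)
        y : Vec (suc n)
        y i = x i + e * v i
        expand : ∀ z → z ∙ (H ·ᵥ y) ≈ z ∙ (H ·ᵥ x) + e * z ∙ (H ·ᵥ v)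
        expand z = trans (∙-cong (λ _ → refl) (λ i → trans (∙-+ʳ (H i) x _) (+-congˡ (∙-*ʳ (H i) e v))))
          (trans (∙-+ʳ z _ _) (+-congˡ (∙-*ʳ z e _)))
        x∙Hv : x ∙ (H ·ᵥ v) ≈ μ * d
        x∙Hv = trans (selfadjoint H symmetric x v) (trans (∙-comm _ v) (v∙Hx x))

      v∙H′x : ∀ x → v ∙ (H′ ·ᵥ x) ≈ 0#
      v∙H′x x = begin
        v ∙ (H′ ·ᵥ x)                      ≈⟨ trans (∙-cong (λ _ → refl) (H′-· x)) (∙-+ʳ v _ _) ⟩
        v ∙ (H ·ᵥ x) + v ∙ (λ i → - (c * v ∙ x) * v i) ≈⟨ +-cong (v∙Hx x) (∙-*ʳ v _ v) ⟩
        μ * v ∙ x + - (c * v ∙ x) * v ∙ v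
          ≈⟨ solve 4 (λ m d w z → m :* d :+ (:- (m :* w :* d)) :* z := m :* d :+ (:- (m :* d)) :* (z :* w)) refl μ
              (v ∙ x) w (v ∙ v) ⟩
        μ * v ∙ x + - (μ * v ∙ x) * (v ∙ v * w)        ≈⟨ +-congˡ (*-congˡ w-inv) ⟩
        μ * v ∙ x + - (μ * v ∙ x) * 1#                 ≈⟨ +-congˡ (*-identityʳ _) ⟩
        μ * v ∙ x - μ * v ∙ x                          ≈⟨ -‿inverseʳ _ ⟩
        0# ∎

      deflated : Deflated H′
      deflated = record
        { symmetric = λ i j → +-cong (symmetric i j)
            (solve 3 (λ c x y → (:- (c :* x)) :* y := (:- (c :* y)) :* x) refl c (v i) (v j))
        ; psd = λ x → nn-resp (sym (H′-form x)) (psd _)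
        ; square = λ x i → begin
            (B ·ᵥ (H′ ·ᵥ x)) i
              ≈⟨ trans (∙-cong (λ _ → refl) (H′-· x)) (trans (∙-+ʳ (B i) _ _) (+-congˡ (∙-*ʳ (B i) _ v))) ⟩
            (B ·ᵥ (H ·ᵥ x)) i + - (c * v ∙ x) * (B ·ᵥ v) i
              ≈⟨ +-cong (square x i) (*-congˡ (trans (Bv i) (sym (eigen i)))) ⟩
            (H ·ᵥ (H ·ᵥ x)) i + - (c * v ∙ x) * (H ·ᵥ v) i
              ≈⟨ trans (∙-cong (λ _ → refl) (H′-· x)) (trans (∙-+ʳ (H i) _ _) (+-congˡ (∙-*ʳ (H i) _ v))) ⟨
            (H ·ᵥ (H′ ·ᵥ x)) i
              ≈⟨ solve 2 (λ h v → h := h :+ con 0ℚ :* v) refl _ (v i) ⟩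
            (H ·ᵥ (H′ ·ᵥ x)) i + ι 0ℚ * v i
              ≈⟨ +-congˡ (*-congʳ (trans ι-0 (sym zero-coefficient))) ⟩
            (H ·ᵥ (H′ ·ᵥ x)) i + - (c * v ∙ (H′ ·ᵥ x)) * v i
              ≈⟨ H′-· (H′ ·ᵥ x) i ⟨
            (H′ ·ᵥ (H′ ·ᵥ x)) i ∎
        }
        where
        zero-coefficient : ∀ {x} → - (c * v ∙ (H′ ·ᵥ x)) ≈ 0#
        zero-coefficient {x} = -0≈0 (trans (*-congˡ (v∙H′x x)) (zeroʳ c))

      trace-H′ : trace H ≈ trace H′ + μ
      trace-H′ = begin
        trace H
          ≈⟨ solve 2 (λ t m → t := t :- m :* con 1ℚ :+ m) refl (trace H) μ ⟩
        trace H - μ * ι 1ℚ + μ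
          ≈⟨ +-congʳ (+-congˡ (-‿cong (*-congˡ (trans ι-1 (sym w-inv))))) ⟩
        trace H - μ * (v ∙ v * w) + μ
          ≈⟨ +-congʳ (+-congˡ (solve 3 (λ m z w → :- (m :* (z :* w)) := (:- (m :* w)) :* z) refl μ (v ∙ v) w)) ⟩
        trace H + - c * v ∙ v + μ
          ≈⟨ +-congʳ (+-congˡ (*-sumˡ (- c) _)) ⟩
        trace H + sum (λ i → - c * (v i * v i)) + μ
          ≈⟨ +-congʳ (+-congˡ (sum-cong (λ i → solve 2 (λ c v → (:- c) :* (v :* v) := (:- (c :* v)) :* v) refl c
              (v i)))) ⟩
        trace H + sum (λ i → - (c * v i) * v i) + μ
          ≈⟨ +-congʳ (sum-+ _ _) ⟨
        trace H′ + μ ∎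

      same-r : ∀ i → (H′ ·ᵥ r) i ≈ 0# → (H ·ᵥ r) i ≈ 0#
      same-r i z = begin
        (H ·ᵥ r) i                             ≈⟨ solve 3 (λ h c v → h := h :+ (:- (c :* con 0ℚ)) :* v) refl _ c (v i)
            ⟩
        (H ·ᵥ r) i + - (c * ι 0ℚ) * v i
            ≈⟨ +-congˡ (*-congʳ (-‿cong (*-congˡ (trans ι-0 (sym (trans (∙-comm v r) (r-orth A-eigen))))))) ⟩
        (H ·ᵥ r) i + - (c * v ∙ r) * v i       ≈⟨ H′-· r i ⟨
        (H′ ·ᵥ r) i                            ≈⟨ z ⟩
        0# ∎

    -- Every deflation H of B satisfies Hr = 0.  The trace is nonnegative and each step lowers it by
    -- at least 1, so a natural number above the trace bounds the number of steps.
    annihilates : ∀ fuel H → Deflated H → NonNeg (nat fuel - trace H) → ∀ i → (H ·ᵥ r) i ≈ 0#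
    annihilates fuel H D t i = ≈-stable λ k → top-eigenvector H symmetric λ (μ , top , v , v-eigen) → ¬¬-lem λ
      { (inj₁ μ≈0) → k (psd-kernel H symmetric psd r (nn-resp (zero-top μ≈0 r) (top r)) i)
      ; (inj₂ μ≉0) → inverse (λ vv≈0 → Eigen.nonzero v-eigen (∙-definite v (nn-≈0 (-0≈0 vv≈0))))
          λ (w , w-inv) → next fuel t k (Step.deflated H D μ v μ≉0 v-eigen w w-inv)
            (Step.trace-H′ H D μ v μ≉0 v-eigen w w-inv) (Step.μ≥1 H D μ v μ≉0 v-eigen w w-inv)
            (Step.same-r H D μ v μ≉0 v-eigen w w-inv i) }
      where
      open Deflated D
      zero-top : ∀ {μ} → μ ≈ 0# → ∀ x → μ * x ∙ x - x ∙ (H ·ᵥ x) ≈ - (x ∙ (H ·ᵥ x))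
      zero-top μ≈0 x = trans (+-congʳ (trans (*-congʳ μ≈0) (zeroˡ _))) (+-identityˡ _)
      next : ∀ fuel → NonNeg (nat fuel - trace H) → ¬ (H ·ᵥ r) i ≈ 0# → ∀ {H′ μ} → Deflated H′ →
        trace H ≈ trace H′ + μ → NonNeg (μ - 1#) → ((H′ ·ᵥ r) i ≈ 0# → (H ·ᵥ r) i ≈ 0#) → ⊥
      next zero t k {H′} {μ} D′ tr μ≥1 same = ¬nn-−1 (nn-resp (begin
        (0# - trace H) + (trace H′ + (μ - 1#))
          ≈⟨ +-cong (+-cong (sym ι-0) (-‿cong tr)) (+-congˡ (+-congˡ (-‿cong (sym ι-1)))) ⟩
        (ι 0ℚ - (trace H′ + μ)) + (trace H′ + (μ - ι 1ℚ))
          ≈⟨ solve 2 (λ t m → (con 0ℚ :- (t :+ m)) :+ (t :+ (m :- con 1ℚ)) := :- con 1ℚ) refl (trace H′) μ ⟩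
        - ι 1ℚ ≈⟨ -‿cong ι-1 ⟩
        - 1# ∎) (nn-+ t (nn-+ (psd-trace H′ (Deflated.psd D′)) μ≥1)))
      next (suc fuel) t k {H′} {μ} D′ tr μ≥1 same = k (same (annihilates fuel H′ D′ (nn-resp (begin
        (1# + nat fuel - trace H) + (μ - 1#)
          ≈⟨ +-cong (+-cong (+-congʳ (sym ι-1)) (-‿cong tr)) (+-congˡ (-‿cong (sym ι-1))) ⟩
        (ι 1ℚ + nat fuel - (trace H′ + μ)) + (μ - ι 1ℚ)
          ≈⟨ solve 3 (λ f t m → (con 1ℚ :+ f :- (t :+ m)) :+ (m :- con 1ℚ) := f :- t) refl (nat fuel) (trace H′) μ ⟩
        nat fuel - trace H′ ∎) (nn-+ t μ≥1)) i))

  -- The eigenvectors of a symmetric matrix span the space: a vector orthogonal to all of them is 0.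
  complete : ∀ {n} (A : Mat n) → SymmetricM A → (r : Vec n) →
    (∀ {μ v} → Eigen A μ v → r ∙ v ≈ 0#) → ∀ i → r i ≈ 0#
  complete {suc n} A A-sym r r-orth i = ≈-stable λ k →
    top-eigenvector (λ i j → - A i j) (λ i j → -‿cong (A-sym i j)) λ (m , top , _) →
    -- m bounds the form of -A, so the form of B m = A + (m + 1)𝟙 is at least x·x.
    archimedean (trace (B m)) λ (fuel , t) → k (∙-definite r (nn-resp (begin
      r ∙ (B m ·ᵥ r) - r ∙ r
        ≈⟨ +-congʳ (∙-zeroʳ r _ (Deflation.annihilates A (m + 1#) (B m) (B-· m) (B≥1 m top) r r-orth fuel (B m)
            (D m top) t)) ⟩
      0# - r ∙ r
        ≈⟨ +-identityˡ _ ⟩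
      - (r ∙ r) ∎) (B≥1 m top r)) i)
    where
    B : Carrier → Mat (suc n)
    B m i j = A i j + (m + 1#) * 𝟙 i j
    B-· : ∀ m x i → (B m ·ᵥ x) i ≈ (A ·ᵥ x) i + (m + 1#) * x i
    B-· m x i = trans (∙-+ˡ (A i) _ x) (+-congˡ (trans (∙-*ˡ _ (𝟙 i) x) (*-congˡ (𝟙-· x i))))
    B≥1 : ∀ m → Top (λ i j → - A i j) m → ∀ x → NonNeg (x ∙ (B m ·ᵥ x) - x ∙ x)
    B≥1 m top x = nn-resp (begin
      m * x ∙ x - x ∙ ((λ i j → - A i j) ·ᵥ x)
        ≈⟨ +-congˡ (-‿cong (∙-cong (λ _ → refl) (λ i → ∙-cong (λ j → sym (-1*≈ (A i j))) (λ _ → refl)))) ⟩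
      m * x ∙ x - x ∙ ((λ i j → - 1# * A i j) ·ᵥ x)
        ≈⟨ +-congˡ (-‿cong (trans (∙-cong (λ _ → refl) (λ i → ∙-*ˡ (- 1#) (A i) x)) (trans (∙-*ʳ x _ _) (-1*≈ _)))) ⟩
      m * x ∙ x - - (x ∙ (A ·ᵥ x))
        ≈⟨ solve 3 (λ m z q → m :* z :- :- q := (q :+ (m :+ con 1ℚ) :* z) :- z) refl m (x ∙ x) (x ∙ (A ·ᵥ x)) ⟩
      (x ∙ (A ·ᵥ x) + (m + ι 1ℚ) * x ∙ x) - x ∙ x
        ≈⟨ +-congʳ (+-congˡ (*-congʳ (+-congˡ ι-1))) ⟩
      (x ∙ (A ·ᵥ x) + (m + 1#) * x ∙ x) - x ∙ x
        ≈⟨ +-congʳ (trans (∙-cong (λ _ → refl) (B-· m x)) (trans (∙-+ʳ x _ _) (+-congˡ (∙-*ʳ x _ x)))) ⟨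
      x ∙ (B m ·ᵥ x) - x ∙ x ∎) (top x)
    D : ∀ m (top : Top (λ i j → - A i j) m) → Deflation.Deflated A (m + 1#) (B m) (B-· m) (B≥1 m top) r r-orth (B m)
    D m top = record
      { symmetric = λ i j → +-cong (A-sym i j) (*-congˡ (𝟙-sym i j))
      ; psd = λ x → nn-resp (solve 2 (λ q z → (q :- z) :+ z := q) refl _ (x ∙ x)) (nn-+ (B≥1 m top x) (∙-nn x))
      ; square = λ x i → refl
      }

-- Graphs with three eigenvalues

module QuadraticRank (F : OrderedField) where
  open OrderedField F

  -- The matrix A² - sA + p𝟙
  quadratic : ∀ {n} → Mat n → Carrier → Carrier → Mat n
  quadratic A s p i j = (A i ∙ (λ k → A k j) + - s * A i j) + p * 𝟙 i j

  -- The consequences for A of C = A² - sA + p𝟙 being γ α αᵀ with a positive vector α: the 2 by 2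
  -- principal minors of C vanish, and vertices with equal diagonal entries in C have equal rows in C.
  record QuadraticallyRankOne {n} (A : Mat n) : Set where
    field
      s p       : Carrier
    C = quadratic A s p
    field
      minors    : ∀ i j → C i j * C i j ≈ C i i * C j j
      same-rows : ∀ i j → C i i ≈ C j j → ∀ k → C i k ≈ C j k

module ThreeEigenvalues (F : OrderedField) (near-top : Rayleigh.NearTop F) where
  open OrderedField F
  open OrderedFieldProperties F
  open Rayleigh F
  open QuadraticRank F
  open Spectral F near-top
  open SetoidReasoning setoid

  -- y is the absolute value of x.
  record IsAbs (x y : Carrier) : Set where
    field
      square : y * y ≈ x * x
      lower  : NonNeg (y - x)
      upper  : NonNeg (y + x)

  abs : ∀ x → ¬ ¬ (∃[ y ] IsAbs x y)
  abs x k = nn-total x λ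
    { (inj₁ p) → k (x , record { square = refl ; lower = nn-≈0 (-‿inverseʳ x) ; upper = nn-+ p p })
    ; (inj₂ p) → k (- x , record
        { square = solve 1 (λ x → (:- x) :* (:- x) := x :* x) refl x
        ; lower = nn-+ p p ; upper = nn-≈0 (-‿inverseˡ x) }) }

  abs-nn : ∀ {x y} → IsAbs x y → NonNeg y
  abs-nn {x} {y} a = ½-double (nn-resp (solve 2 (λ x y → (y :- x) :+ (y :+ x) := y :+ y) refl x y)
    (nn-+ (IsAbs.lower a) (IsAbs.upper a)))

  abs-zero : ∀ {x y} → IsAbs x y → y ≈ 0# → x ≈ 0#
  abs-zero a y≈0 = sq≈0 (trans (sym (IsAbs.square a)) (trans (*-congʳ y≈0) (zeroˡ _)))

  zero-abs : ∀ {x y} → IsAbs x y → x ≈ 0# → y ≈ 0#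
  zero-abs a x≈0 = sq≈0 (trans (IsAbs.square a) (trans (*-congʳ x≈0) (zeroˡ _)))

  -- Perron-Frobenius theory of the largest eigenvalue λ₀ of a connected matrix A with nonnegative
  -- entries.
  module Perron {n : ℕ} (A : Mat n) (A-sym : SymmetricM A) (A-nn : ∀ i j → NonNeg (A i j))
    (connected : ∀ i j → Star (λ i j → ¬ A i j ≈ 0#) i j) (λ₀ : Carrier) (top : Top A λ₀) where

    InKernel : Vec n → Set
    InKernel u = ∀ i → (A ·ᵥ u) i ≈ λ₀ * u i

    -- If u maximises the form of A then so does |u|, because x·Ax can only grow.
    abs-kernel : ∀ {u w} → (∀ i → IsAbs (u i) (w i)) → InKernel u → InKernel w
    abs-kernel {u} {w} a u-ker = top-kernel A A-sym top w (nn-resp (begin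
      sum (λ i → sum (λ j → A i j * (w i * w j - u i * u j)))
        ≈⟨ sum-cong (λ i → trans (sum-cong (λ j → solve 3 (λ a x y → a :* (x :- y) := a :* x :+ :- (a :* y)) refl _ _
            _)) (trans (sum-+ _ _) (+-congˡ (sum-neg _)))) ⟩
      sum (λ i → sum (λ j → A i j * (w i * w j)) - sum (λ j → A i j * (u i * u j)))
        ≈⟨ trans (sum-+ _ _) (+-congˡ (sum-neg _)) ⟩
      sum (λ i → sum (λ j → A i j * (w i * w j))) - sum (λ i → sum (λ j → A i j * (u i * u j)))
        ≈⟨ +-cong (form-expand A w) (-‿cong (form-expand A u)) ⟨
      w ∙ (A ·ᵥ w) - u ∙ (A ·ᵥ u)
        ≈⟨ +-congˡ (-‿cong (trans (∙-cong (λ _ → refl) u-ker)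
            (trans (∙-*ʳ u λ₀ u) (*-congˡ (sum-cong (λ i → sym (IsAbs.square (a i)))))))) ⟩
      w ∙ (A ·ᵥ w) - λ₀ * w ∙ w
        ≈⟨ solve 2 (λ q m → q :- m := :- (m :- q)) refl (w ∙ (A ·ᵥ w)) (λ₀ * w ∙ w) ⟩
      - (λ₀ * w ∙ w - w ∙ (A ·ᵥ w)) ∎)
      (sum-nn _ (λ i → sum-nn _ (λ j → nn-* (A-nn i j) (product i j)))))
      where
      product : ∀ i j → NonNeg (w i * w j - u i * u j)
      product i j = ½-double (nn-resp
        (solve 4 (λ x y x′ y′ → (y :- x) :* (y′ :+ x′) :+ (y :+ x) :* (y′ :- x′)
           := (y :* y′ :- x :* x′) :+ (y :* y′ :- x :* x′)) refl (u i) (w i) (u j) (w j))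
        (nn-+ (nn-* (IsAbs.lower (a i)) (IsAbs.upper (a j))) (nn-* (IsAbs.upper (a i)) (IsAbs.lower (a j)))))

    -- The zeros of a nonnegative eigenvector propagate along edges.
    spread : ∀ {w} → (∀ i → NonNeg (w i)) → InKernel w → ∀ {i j} → Star (λ i j → ¬ A i j ≈ 0#) i j →
      w i ≈ 0# → w j ≈ 0#
    spread w-nn w-ker Star.ε z = z
    spread {w} w-nn w-ker {i} (_◅_ {j = k} i~k path) z = spread w-nn w-ker path
      (*-cancel i~k (sum-nn≈0 _ (λ j → nn-* (A-nn i j) (w-nn j)) (nn-≈0 sum≈0) k))
      where
      sum≈0 : - (A i ∙ w) ≈ 0#
      sum≈0 = -0≈0 (trans (w-ker i) (trans (*-congˡ z) (zeroʳ λ₀)))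

    vanishing : ∀ {u} → InKernel u → ∀ {i} → u i ≈ 0# → ∀ j → u j ≈ 0#
    vanishing {u} u-ker {i} z j = ≈-stable λ k → ¬¬-choice (λ i → abs (u i)) λ a →
      k (abs-zero (proj₂ (a j)) (spread (λ i → abs-nn (proj₂ (a i))) (abs-kernel (λ i → proj₂ (a i)) u-ker)
        (connected i j) (zero-abs (proj₂ (a i)) z)))

    -- Eigenvectors for λ₀ are proportional, since α r u - u r α vanishes at r.
    kernel-line : ∀ {α u} → InKernel α → InKernel u → ∀ r i → α r * u i ≈ u r * α i
    kernel-line {α} {u} α-ker u-ker r i = ≈-difference (trans
      (+-congˡ (solve 2 (λ x y → :- (x :* y) := (:- x) :* y) refl (u r) (α i))) (vanishing d-ker d≈0 i))
      where
      d : Vec n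
      d i = α r * u i + - u r * α i
      d-ker : InKernel d
      d-ker i = begin
        A i ∙ d                                       ≈⟨ ∙-linʳ (A i) (α r) u (- u r) α ⟩
        α r * A i ∙ u + - u r * A i ∙ α               ≈⟨ +-cong (*-congˡ (u-ker i)) (*-congˡ (α-ker i)) ⟩
        α r * (λ₀ * u i) + - u r * (λ₀ * α i)
          ≈⟨ solve 5 (λ l a u b v → a :* (l :* u) :+ (:- b) :* (l :* v) := l :* (a :* u :+ (:- b) :* v)) refl λ₀ (α r)
              (u i) (u r) (α i) ⟩
        λ₀ * d i ∎
      d≈0 : d r ≈ 0#
      d≈0 = trans (solve 2 (λ a u → a :* u :+ (:- u) :* a := con 0ℚ) refl (α r) (u r)) ι-0

  quadratic-· : ∀ {n} (A : Mat n) s p v i →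
    (quadratic A s p ·ᵥ v) i ≈ ((A ·ᵥ (A ·ᵥ v)) i + - s * (A ·ᵥ v) i) + p * v i
  quadratic-· A s p v i = begin
    quadratic A s p i ∙ v
      ≈⟨ trans (∙-+ˡ _ _ v) (+-cong (∙-+ˡ _ _ v) (trans (∙-*ˡ p (𝟙 i) v) (*-congˡ (𝟙-· v i)))) ⟩
    ((λ j → A i ∙ (λ k → A k j)) ∙ v + (λ j → - s * A i j) ∙ v) + p * v i
      ≈⟨ +-congʳ (+-cong (sym (∙-·ᵥ (A i) A v)) (∙-*ˡ (- s) (A i) v)) ⟩
    ((A ·ᵥ (A ·ᵥ v)) i + - s * (A ·ᵥ v) i) + p * v i ∎

  module _ {n : ℕ} (A : Mat (suc n)) (A-sym : SymmetricM A) (A-nn : ∀ i j → NonNeg (A i j))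
    (connected : ∀ i j → Star (λ i j → ¬ A i j ≈ 0#) i j) where

    private
      -- α is a positive eigenvector for the largest eigenvalue λ₀, and every eigenvalue is λ₀, b or c.
      module _ (λ₀ : Carrier) (top : Top A λ₀) (α : Vec (suc n)) (α-nn : ∀ i → NonNeg (α i))
        (α≉0 : ∀ i → ¬ α i ≈ 0#) (α-ker : ∀ i → (A ·ᵥ α) i ≈ λ₀ * α i)
        (b c : Carrier) (roots : ∀ {μ v} → Eigen A μ v → (μ - λ₀) * ((μ - b) * (μ - c)) ≈ 0#) where
        open Perron A A-sym A-nn connected λ₀ top
        s₀ = b + c
        p₀ = b * c
        C₀ = quadratic A s₀ p₀

        C-sym : SymmetricM C₀
        C-sym i j = +-cong (+-cong (trans (∙-comm _ _) (∙-cong (λ k → A-sym k j) (λ k → A-sym i k)))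
          (*-congˡ (A-sym i j))) (*-congˡ (𝟙-sym i j))

        C-eigen : ∀ {μ v} → Eigen A μ v → ∀ i → (C₀ ·ᵥ v) i ≈ (μ - b) * (μ - c) * v i
        C-eigen {μ} {v} e i = begin
          (C₀ ·ᵥ v) i
            ≈⟨ quadratic-· A s₀ p₀ v i ⟩
          (A i ∙ (A ·ᵥ v) + - s₀ * (A ·ᵥ v) i) + p₀ * v i
            ≈⟨ +-congʳ (+-cong (trans (∙-cong (λ _ → refl) eigen) (trans (∙-*ʳ (A i) μ v) (*-congˡ (eigen i))))
                (*-congˡ (eigen i))) ⟩
          (μ * (μ * v i) + - s₀ * (μ * v i)) + p₀ * v i
            ≈⟨ solve 4 (λ m b c v → (m :* (m :* v) :+ (:- (b :+ c)) :* (m :* v)) :+ b :* c :* v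
                 := (m :- b) :* (m :- c) :* v) refl μ b c (v i) ⟩
          (μ - b) * (μ - c) * v i ∎
          where open Eigen e

        -- (A - λ₀)C kills every eigenvector, so it vanishes by completeness: the columns of C are
        -- eigenvectors for λ₀.
        C-column : ∀ j i → (A ·ᵥ (λ k → C₀ k j)) i ≈ λ₀ * C₀ i j
        C-column j i = ≈-difference (trans
          (solve 3 (λ x l c → x :- l :* c := con 1ℚ :* x :+ (:- l) :* c) refl _ λ₀ (C₀ i j))
          (complete A A-sym row row-orth j))
          where
          row : Vec (suc n)
          row j = ι 1ℚ * A i ∙ (λ k → C₀ k j) + - λ₀ * C₀ i j
          row-orth : ∀ {μ v} → Eigen A μ v → row ∙ v ≈ 0#
          row-orth {μ} {v} e = begin
            row ∙ v
              ≈⟨ ∙-linˡ (ι 1ℚ) (λ j → A i ∙ (λ k → C₀ k j)) (- λ₀) (C₀ i) v ⟩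
            ι 1ℚ * (λ j → A i ∙ (λ k → C₀ k j)) ∙ v + - λ₀ * (C₀ ·ᵥ v) i
              ≈⟨ +-cong (*-congˡ (trans (sym (∙-·ᵥ (A i) C₀ v))
                  (trans (∙-cong (λ _ → refl) (C-eigen e)) (trans (∙-*ʳ (A i) _ v) (*-congˡ (Eigen.eigen e i))))))
                      (*-congˡ (C-eigen e i)) ⟩
            ι 1ℚ * ((μ - b) * (μ - c) * (μ * v i)) + - λ₀ * ((μ - b) * (μ - c) * v i)
              ≈⟨ solve 5 (λ m l b c v → con 1ℚ :* ((m :- b) :* (m :- c) :* (m :* v)) :+ (:- l) :*
                  ((m :- b) :* (m :- c) :* v)
                   := (m :- l) :* ((m :- b) :* (m :- c)) :* v) refl μ λ₀ b c (v i) ⟩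
            (μ - λ₀) * ((μ - b) * (μ - c)) * v i
              ≈⟨ trans (*-congʳ (roots e)) (zeroˡ _) ⟩
            0# ∎

        -- C₀ has rank at most one, with columns proportional to α.
        line : ∀ r i j → α r * C₀ i j ≈ C₀ r j * α i
        line r i j = kernel-line α-ker (C-column j) r i

        minors₀ : ∀ i j → C₀ i j * C₀ i j ≈ C₀ i i * C₀ j j
        minors₀ i j = ≈-cancel (α≉0 j) (≈-cancel (α≉0 i) (begin
          α i * (α j * (C₀ i j * C₀ i j))
            ≈⟨ solve 3 (λ a b x → a :* (b :* (x :* x)) := (b :* x) :* (a :* x)) refl (α i) (α j) (C₀ i j) ⟩
          (α j * C₀ i j) * (α i * C₀ i j)
            ≈⟨ *-cong (line j i j) (trans (*-congˡ (C-sym i j)) (line i j i)) ⟩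
          (C₀ j j * α i) * (C₀ i i * α j)
            ≈⟨ solve 4 (λ a b x y → (y :* a) :* (x :* b) := a :* (b :* (x :* y))) refl (α i) (α j) (C₀ i i) (C₀ j j) ⟩
          α i * (α j * (C₀ i i * C₀ j j)) ∎))
          where
          ≈-cancel : ∀ {a x y} → ¬ a ≈ 0# → a * x ≈ a * y → x ≈ y
          ≈-cancel {a} {x} {y} a≉0 e = ≈-difference (*-cancel a≉0 (trans
            (solve 3 (λ a x y → a :* (x :- y) := a :* x :- a :* y) refl a x y) (difference≈0 e)))

        α+α≉0 : ∀ i j → ¬ α i + α j ≈ 0#
        α+α≉0 i j e = α≉0 i (squeeze (α-nn i) (α-nn j) (nn-≈0 (-0≈0 e)))

        same-rows₀ : ∀ i j → C₀ i i ≈ C₀ j j → ∀ k → C₀ i k ≈ C₀ j k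
        same-rows₀ i j e k = ≈-difference (*-cancel (α≉0 j) scaled)
          where
          δ = α i - α j
          -- C₀ i i = C₀ j j amounts to γ (αᵢ + αⱼ)(αᵢ - αⱼ) = 0 with C₀ = γ α αᵀ.
          Cjj-δ : C₀ j j * δ ≈ 0#
          Cjj-δ = *-cancel (α+α≉0 i j) (begin
            (α i + α j) * (C₀ j j * (α i - α j))
              ≈⟨ solve 3 (λ a b x → (a :+ b) :* (x :* (a :- b)) := a :* (x :* a) :- b :* (x :* b)) refl (α i) (α j)
                  (C₀ j j) ⟩
            α i * (C₀ j j * α i) - α j * (C₀ j j * α j)
              ≈⟨ +-cong (*-congˡ (sym (line j i j)))
                  (-‿cong (*-congˡ (trans (*-congʳ (sym e)) (trans (sym (line i j i)) (*-congˡ (C-sym j i)))))) ⟩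
            α i * (α j * C₀ i j) - α j * (α i * C₀ i j)
              ≈⟨ solve 3 (λ a b x → a :* (b :* x) :- b :* (a :* x) := con 0ℚ) refl (α i) (α j) (C₀ i j) ⟩
            ι 0ℚ ≈⟨ ι-0 ⟩
            0# ∎)
          Cjk-δ : C₀ j k * δ ≈ 0#
          Cjk-δ = sq≈0 (begin
            C₀ j k * δ * (C₀ j k * δ)          ≈⟨ solve 2 (λ x d → x :* d :* (x :* d) := x :* x :* (d :* d)) refl
                (C₀ j k) δ ⟩
            C₀ j k * C₀ j k * (δ * δ)          ≈⟨ *-congʳ (minors₀ j k) ⟩
            C₀ j j * C₀ k k * (δ * δ)          ≈⟨ solve 3 (λ x y d → x :* y :* (d :* d) := (x :* d) :* (y :* d)) refl
                (C₀ j j) (C₀ k k) δ ⟩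
            (C₀ j j * δ) * (C₀ k k * δ)        ≈⟨ trans (*-congʳ Cjj-δ) (zeroˡ _) ⟩
            0# ∎)
          scaled : α j * (C₀ i k - C₀ j k) ≈ 0#
          scaled = begin
            α j * (C₀ i k - C₀ j k)           ≈⟨ solve 3 (λ a x y → a :* (x :- y) := a :* x :- y :* a) refl (α j)
                (C₀ i k) (C₀ j k) ⟩
            α j * C₀ i k - C₀ j k * α j       ≈⟨ +-congʳ (line j i k) ⟩
            C₀ j k * α i - C₀ j k * α j       ≈⟨ solve 3 (λ x a b → x :* a :- x :* b := x :* (a :- b)) refl (C₀ j k)
                (α i) (α j) ⟩
            C₀ j k * δ                        ≈⟨ Cjk-δ ⟩
            0# ∎

        conclusion : QuadraticallyRankOne A
        conclusion = record { s = s₀ ; p = p₀ ; minors = minors₀ ; same-rows = same-rows₀ }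

    -- For a connected nonnegative symmetric A whose eigenvalues lie in a set of three elements, with
    -- top eigenvalue λ₀ and other elements b, c, the matrix (A - b)(A - c) has rank at most one.
    three-eigenvalues⇒rank-one : (θ : Fin 3 → Carrier) →
      (∀ {μ v} → Eigen A μ v → ∃[ a ] μ ≈ θ a) → ¬ ¬ QuadraticallyRankOne A
    three-eigenvalues⇒rank-one θ spectrum k = top-eigenvector A A-sym λ (λ₀ , top , v , v-eigen) →
      ¬¬-choice (λ i → abs (v i)) λ a →
      let open Perron A A-sym A-nn connected λ₀ top
          α : Vec (suc n)
          α i = proj₁ (a i)
          α-nn : ∀ i → NonNeg (α i)
          α-nn i = abs-nn (proj₂ (a i))
          α-ker : InKernel α
          α-ker = abs-kernel (λ i → proj₂ (a i)) (Eigen.eigen v-eigen)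
          α≉0 : ∀ i → ¬ α i ≈ 0#
          α≉0 i z = Eigen.nonzero v-eigen (λ j → abs-zero (proj₂ (a j)) (vanishing α-ker z j))
      in k (conclude λ₀ top α α-nn α≉0 α-ker (spectrum v-eigen))
      where
      kills : ∀ {μ λ₀ a b c d} → λ₀ ≈ θ a → μ ≈ θ d → d ≡ a ⊎ d ≡ b ⊎ d ≡ c →
        (μ - λ₀) * ((μ - θ b) * (μ - θ c)) ≈ 0#
      kills e f (inj₁ ≡.refl)        = trans (*-congʳ (difference≈0 (trans f (sym e)))) (zeroˡ _)
      kills e f (inj₂ (inj₁ ≡.refl)) = trans (*-congˡ (trans (*-congʳ (difference≈0 f)) (zeroˡ _))) (zeroʳ _)
      kills e f (inj₂ (inj₂ ≡.refl)) = trans (*-congˡ (trans (*-congˡ (difference≈0 f)) (zeroʳ _))) (zeroʳ _)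

      others : (a : Fin 3) → ∃[ b ] ∃[ c ] (∀ d → d ≡ a ⊎ d ≡ b ⊎ d ≡ c)
      others 0F = 1F , 2F , λ { 0F → inj₁ ≡.refl ; 1F → inj₂ (inj₁ ≡.refl) ; 2F → inj₂ (inj₂ ≡.refl) }
      others 1F = 0F , 2F , λ { 0F → inj₂ (inj₁ ≡.refl) ; 1F → inj₁ ≡.refl ; 2F → inj₂ (inj₂ ≡.refl) }
      others 2F = 0F , 1F , λ { 0F → inj₂ (inj₁ ≡.refl) ; 1F → inj₂ (inj₂ ≡.refl) ; 2F → inj₁ ≡.refl }

      conclude : ∀ λ₀ → Top A λ₀ → (α : Vec (suc n)) → (∀ i → NonNeg (α i)) → (∀ i → ¬ α i ≈ 0#) →
        (∀ i → (A ·ᵥ α) i ≈ λ₀ * α i) → ∃[ a ] λ₀ ≈ θ a → QuadraticallyRankOne A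
      conclude λ₀ top α α-nn α≉0 α-ker (a , e) =
        let b , c , cover = others a in
        conclusion λ₀ top α α-nn α≉0 α-ker (θ b) (θ c)
          (λ v-eigen → let d , f = spectrum v-eigen in kills e f (cover d))

-- Joins of two graphs

-- How two vertices of a graph with a two-part vertex partition are related: equal, or distinct in the
-- same part and adjacent or not, or in different parts.
data Kind : Set where
  eq adj non cross : Kind

-- The part of the second vertex, given the part of the first and the relation.
target : Bool → Kind → Bool
target f eq    = f
target f adj   = f
target f non   = f
target f cross = not f

module Partition {n : ℕ} (Γ : Graph n) (φ : Fin n → Bool) where
  open Graph Γ

  data Kinded (i j : Fin n) : Kind → Set where
    equal       : i ≡ j → Kinded i j eq
    adjacent    : φ i ≡ φ j → i ~ j → Kinded i j adj
    nonadjacent : φ i ≡ φ j → ¬ i ≡ j → ¬ i ~ j → Kinded i j non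
    crossing    : ¬ φ i ≡ φ j → Kinded i j cross

  opaque
    kind-of : ∀ i j → ∃[ κ ] Kinded i j κ
    kind-of i j with φ i Bool.≟ φ j
    ... | no φ≢ = cross , crossing φ≢
    ... | yes φ≡ with i Fin.≟ j
    ...   | yes i≡j = eq , equal i≡j
    ...   | no i≢j with i ~? j
    ...     | yes i~j = adj , adjacent φ≡ i~j
    ...     | no i≁j  = non , nonadjacent φ≡ i≢j i≁j

  kind : Fin n → Fin n → Kind
  kind i j = proj₁ (kind-of i j)

  kinded : ∀ i j → Kinded i j (kind i j)
  kinded i j = proj₂ (kind-of i j)

  kind-unique : ∀ {i j κ κ′} → Kinded i j κ → Kinded i j κ′ → κ ≡ κ′
  kind-unique (equal _)           (equal _)           = ≡.refl
  kind-unique (equal p)           (adjacent _ q)      = ⊥-elim (~-irrefl p q)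
  kind-unique (equal p)           (nonadjacent _ q _) = ⊥-elim (q p)
  kind-unique (equal p)           (crossing q)        = ⊥-elim (q (≡.cong φ p))
  kind-unique (adjacent _ p)      (equal q)           = ⊥-elim (~-irrefl q p)
  kind-unique (adjacent _ _)      (adjacent _ _)      = ≡.refl
  kind-unique (adjacent _ p)      (nonadjacent _ _ q) = ⊥-elim (q p)
  kind-unique (adjacent p _)      (crossing q)        = ⊥-elim (q p)
  kind-unique (nonadjacent _ p _) (equal q)           = ⊥-elim (p q)
  kind-unique (nonadjacent _ _ p) (adjacent _ q)      = ⊥-elim (p q)
  kind-unique (nonadjacent _ _ _) (nonadjacent _ _ _) = ≡.refl
  kind-unique (nonadjacent p _ _) (crossing q)        = ⊥-elim (q p)
  kind-unique (crossing p)        (equal q)           = ⊥-elim (p (≡.cong φ q))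
  kind-unique (crossing p)        (adjacent q _)      = ⊥-elim (p q)
  kind-unique (crossing p)        (nonadjacent q _ _) = ⊥-elim (p q)
  kind-unique (crossing _)        (crossing _)        = ≡.refl

  kinded⇒kind : ∀ {i j κ} → Kinded i j κ → kind i j ≡ κ
  kinded⇒kind k = kind-unique (kinded _ _) k

  kind-sym : ∀ i j → kind i j ≡ kind j i
  kind-sym i j = kind-unique (kinded i j) (swap (kinded j i))
    where
    swap : ∀ {κ} → Kinded j i κ → Kinded i j κ
    swap (equal p)           = equal (≡.sym p)
    swap (adjacent p q)      = adjacent (≡.sym p) (~-sym q)
    swap (nonadjacent p q r) = nonadjacent (≡.sym p) (q ∘ ≡.sym) (r ∘ ~-sym)
    swap (crossing p)        = crossing (p ∘ ≡.sym)

  target-kind : ∀ i j → φ j ≡ target (φ i) (kind i j)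
  target-kind i j with kind i j | kinded i j
  ... | _ | equal p           = ≡.cong φ (≡.sym p)
  ... | _ | adjacent p _      = ≡.sym p
  ... | _ | nonadjacent p _ _ = ≡.sym p
  ... | _ | crossing p        = Bool.¬-not (p ∘ ≡.sym)

  -- The 0/1 matrices Ind κ of the four relations, and matrices depending only on labels, that is, on
  -- the part of the row and the relation between row and column.
  module Indicators (𝕜 : ℚAlgebra) where
    open ℚAlgebra 𝕜
    open LinearAlgebra 𝕜
    open IdentityMatrix 𝕜
    open SetoidReasoning setoid

    δ : Kind → Kind → Carrier
    δ eq    eq    = 1#
    δ adj   adj   = 1#
    δ non   non   = 1#
    δ cross cross = 1#
    δ _     _     = 0#

    δ-refl : ∀ κ → δ κ κ ≈ 1#
    δ-refl eq    = refl
    δ-refl adj   = refl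
    δ-refl non   = refl
    δ-refl cross = refl

    δ-cases : ∀ κ κ′ → κ ≡ κ′ ⊎ δ κ κ′ ≈ 0#
    δ-cases eq    eq    = inj₁ ≡.refl
    δ-cases eq    adj   = inj₂ refl
    δ-cases eq    non   = inj₂ refl
    δ-cases eq    cross = inj₂ refl
    δ-cases adj   eq    = inj₂ refl
    δ-cases adj   adj   = inj₁ ≡.refl
    δ-cases adj   non   = inj₂ refl
    δ-cases adj   cross = inj₂ refl
    δ-cases non   eq    = inj₂ refl
    δ-cases non   adj   = inj₂ refl
    δ-cases non   non   = inj₁ ≡.refl
    δ-cases non   cross = inj₂ refl
    δ-cases cross eq    = inj₂ refl
    δ-cases cross adj   = inj₂ refl
    δ-cases cross non   = inj₂ refl
    δ-cases cross cross = inj₁ ≡.refl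

    Ind : Kind → Mat n
    Ind κ i j = δ κ (kind i j)

    Ind-sym : ∀ κ → SymmetricM (Ind κ)
    Ind-sym κ i j = reflexive (≡.cong (δ κ) (kind-sym i j))

    𝟙-off : ∀ {n} {i j : Fin n} → ¬ i ≡ j → 𝟙 i j ≈ 0#
    𝟙-off {i = i} {j} i≢j with i Fin.≟ j
    ... | yes i≡j = ⊥-elim (i≢j i≡j)
    ... | no  _   = refl

    𝟙≈eq : ∀ i j → 𝟙 i j ≈ Ind eq i j
    𝟙≈eq i j with kind i j | kinded i j
    ... | _ | equal ≡.refl      = 𝟙-diag i
    ... | _ | adjacent _ i~j    = 𝟙-off (λ p → ~-irrefl p i~j)
    ... | _ | nonadjacent _ p _ = 𝟙-off p
    ... | _ | crossing p        = 𝟙-off (p ∘ ≡.cong φ)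

    -- A function of the part is constant along Ind adj.
    along : ∀ (u : Bool → Carrier) i m → Ind adj i m * u (φ m) ≈ Ind adj i m * u (φ i)
    along u i m with kind i m | kinded i m
    ... | _ | equal p           = *-congˡ (reflexive (≡.cong (u ∘ φ) (≡.sym p)))
    ... | _ | adjacent p _      = *-congˡ (reflexive (≡.cong u (≡.sym p)))
    ... | _ | nonadjacent p _ _ = *-congˡ (reflexive (≡.cong u (≡.sym p)))
    ... | _ | crossing p        = trans (zeroˡ _) (sym (zeroˡ _))

    -- If the adjacency relation inside the parts has constant row sums and its square depends
    -- only on labels, then so does the product of any two matrices depending only on labels.
    module _ (k : Bool → Carrier) (t : Bool → Kind → Carrier)
      (row-sum : ∀ i → sum (Ind adj i) ≈ k (φ i))
      (square  : ∀ i j → Ind adj i ∙ (λ m → Ind adj m j) ≈ t (φ i) (kind i j))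
      where

      private
        Ã = Ind adj

        column-sum : ∀ j → sum (λ m → Ã m j) ≈ k (φ j)
        column-sum j = trans (sum-cong (λ m → Ind-sym adj m j)) (row-sum j)

        -- A matrix that depends only on labels is Z + X 𝟙 + Y Ã, with Z constant on the blocks of the
        -- partition and X, Y depending only on the part of the row.
        module Decompose (F : Bool → Kind → Carrier) where
          X Y : Bool → Carrier
          X f = F f eq - F f non
          Y f = F f adj - F f non
          Z : Bool → Bool → Carrier
          Z f g = if does (f Bool.≟ g) then F f non else F f cross

          Z-same : ∀ {f g} → f ≡ g → Z f g ≈ F f non
          Z-same {f} {g} p with f Bool.≟ g
          ... | yes _ = refl
          ... | no ¬p = ⊥-elim (¬p p)

          Z-cross : ∀ {f g} → ¬ f ≡ g → Z f g ≈ F f cross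
          Z-cross {f} {g} ¬p with f Bool.≟ g
          ... | yes p = ⊥-elim (¬p p)
          ... | no _  = refl

          private
            base : ∀ {f z} x y → z ≈ F f non → z + (x * 0# + y * 0#) ≈ F f non
            base {f} {z} x y e = begin
              z + (x * 0# + y * 0#)      ≈⟨ +-cong e (+-cong (zeroʳ x) (zeroʳ y)) ⟩
              F f non + (0# + 0#)        ≈⟨ trans (+-congˡ (+-identityˡ 0#)) (+-identityʳ _) ⟩
              F f non ∎
            shift : ∀ a b → b + (a - b) ≈ a
            shift = solve 2 (λ a b → b :+ (a :- b) := a) refl

          decompose : ∀ i j → F (φ i) (kind i j) ≈ Z (φ i) (φ j) + (X (φ i) * 𝟙 i j + Y (φ i) * Ã i j)
          decompose i j = trans (go (kinded i j)) (+-congˡ (+-congʳ (*-congˡ (sym (𝟙≈eq i j)))))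
            where
            f = φ i
            go : ∀ {κ} → Kinded i j κ → F f κ ≈ Z f (φ j) + (X f * δ eq κ + Y f * δ adj κ)
            go (equal p) = sym (trans (+-cong (Z-same (≡.cong φ p))
                (trans (+-cong (*-identityʳ _) (zeroʳ _)) (+-identityʳ _))) (shift _ _))
            go (adjacent p _) = sym (trans (+-cong (Z-same p)
                (trans (+-cong (zeroʳ _) (*-identityʳ _)) (+-identityˡ _))) (shift _ _))
            go (nonadjacent p _ _) = sym (base _ _ (Z-same p))
            go (crossing p) = sym (trans (+-cong (Z-cross p) (trans (+-cong (zeroʳ _) (zeroʳ _)) (+-identityˡ 0#)))
                (+-identityʳ _))

          -- The coefficients may equally be read off at the end point.
          decompose′ : ∀ i j → F (φ i) (kind i j) ≈ Z (φ i) (φ j) + (X (φ j) * 𝟙 i j + Y (φ j) * Ã i j)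
          decompose′ i j = at (φ i Bool.≟ φ j)
            where
            at : Dec (φ i ≡ φ j) → F (φ i) (kind i j) ≈ Z (φ i) (φ j) + (X (φ j) * 𝟙 i j + Y (φ j) * Ã i j)
            at (yes p) = ≡.subst (λ f → F (φ i) (kind i j) ≈ Z (φ i) (φ j) + (X f * 𝟙 i j + Y f * Ã i j)) p
                (decompose i j)
            at (no ¬p) = trans (decompose i j) (+-congˡ (+-cong (both (λ e → ¬p (≡.cong φ e))) Ã-cross))
              where
              both : ¬ i ≡ j → X (φ i) * 𝟙 i j ≈ X (φ j) * 𝟙 i j
              both i≢j = trans (trans (*-congˡ (𝟙-off i≢j)) (zeroʳ _)) (sym (trans (*-congˡ (𝟙-off i≢j)) (zeroʳ _)))
              Ã≈0 : Ã i j ≈ 0#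
              Ã≈0 = reflexive (≡.cong (δ adj) (kinded⇒kind (crossing ¬p)))
              Ã-cross : Y (φ i) * Ã i j ≈ Y (φ j) * Ã i j
              Ã-cross = trans (trans (*-congˡ Ã≈0) (zeroʳ _)) (sym (trans (*-congˡ Ã≈0) (zeroʳ _)))

      block-product : (F G : Bool → Kind → Carrier) → ∃[ H ] (∀ i j →
        (λ m → F (φ i) (kind i m)) ∙ (λ m → G (φ m) (kind m j)) ≈ H (φ i) (kind i j))
      block-product F G = H , proof
        where
        open Decompose F
        module G = Decompose G
        H′ : Bool → Bool → Kind → Carrier
        H′ f g κ = ((λ m → Z f (φ m)) ∙ (λ m → G.Z (φ m) g) + (G.X g * Z f g + G.Y g * (Z f g * k g)))
          + (X f * (G.Z f g + (G.X g * δ eq κ + G.Y g * δ adj κ))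
          + Y f * (k f * G.Z f g + (G.X g * δ adj κ + G.Y g * t f κ)))
        H : Bool → Kind → Carrier
        H f κ = H′ f (target f κ) κ
        proof : ∀ i j → (λ m → F (φ i) (kind i m)) ∙ (λ m → G (φ m) (kind m j)) ≈ H (φ i) (kind i j)
        proof i j = begin
          (λ m → F f (kind i m)) ∙ (λ m → G (φ m) (kind m j))
            ≈⟨ ∙-cong (decompose i) (λ m → G.decompose′ m j) ⟩
          (λ m → Z f (φ m) + (X f * 𝟙 i m + Y f * Ã i m)) ∙ v
            ≈⟨ trans (∙-+ˡ _ _ v) (+-congˡ (∙-linˡ (X f) (𝟙 i) (Y f) (Ã i) v)) ⟩
          (λ m → Z f (φ m)) ∙ v + (X f * 𝟙 i ∙ v + Y f * Ã i ∙ v)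
            ≈⟨ +-cong (trans (expand _) (+-congˡ (+-cong (*-congˡ z-𝟙) (*-congˡ z-Ã))))
                 (+-cong (*-congˡ (trans (𝟙-· v i) (+-congˡ (+-congʳ (*-congˡ (𝟙≈eq i j))))))
                     (*-congˡ (trans (expand _) (+-cong Ã-z (+-cong (*-congˡ Ã-𝟙) (*-congˡ (square i j))))))) ⟩
          H′ f g (kind i j)
            ≈⟨ reflexive (≡.cong (λ g → H′ f g (kind i j)) (target-kind i j)) ⟩
          H f (kind i j) ∎
          where
          f = φ i
          g = φ j
          v : Vec n
          v m = G.Z (φ m) g + (G.X g * 𝟙 m j + G.Y g * Ã m j)
          expand : ∀ u → u ∙ v ≈ u ∙ (λ m → G.Z (φ m) g) + (G.X g * u ∙ (λ m → 𝟙 m j) + G.Y g * u ∙ (λ m → Ã m j))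
          expand u = trans (∙-+ʳ u _ _) (+-congˡ (∙-linʳ u (G.X g) _ (G.Y g) _))
          col-𝟙 : ∀ u → u ∙ (λ m → 𝟙 m j) ≈ u j
          col-𝟙 u = trans (∙-comm u _) (trans (∙-cong (λ m → 𝟙-sym m j) (λ _ → refl)) (𝟙-· u j))
          z-𝟙 : (λ m → Z f (φ m)) ∙ (λ m → 𝟙 m j) ≈ Z f g
          z-𝟙 = col-𝟙 _
          z-Ã : (λ m → Z f (φ m)) ∙ (λ m → Ã m j) ≈ Z f g * k g
          z-Ã = begin
            (λ m → Z f (φ m)) ∙ (λ m → Ã m j)
              ≈⟨ sum-cong (λ m → trans (*-congˡ (Ind-sym adj m j))
                  (trans (*-comm _ _) (trans (along (Z f) j m) (trans (*-comm _ _) (*-congˡ (Ind-sym adj j m)))))) ⟩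
            sum (λ m → Z f g * Ã m j)
              ≈⟨ *-sumˡ (Z f g) _ ⟨
            Z f g * sum (λ m → Ã m j)
              ≈⟨ *-congˡ (column-sum j) ⟩
            Z f g * k g ∎
          Ã-z : Ã i ∙ (λ m → G.Z (φ m) g) ≈ k f * G.Z f g
          Ã-z = begin
            Ã i ∙ (λ m → G.Z (φ m) g)     ≈⟨ sum-cong (along (λ f → G.Z f g) i) ⟩
            sum (λ m → Ã i m * G.Z f g)   ≈⟨ *-sumʳ (G.Z f g) _ ⟨
            sum (Ã i) * G.Z f g           ≈⟨ *-congʳ (row-sum i) ⟩
            k f * G.Z f g ∎
          Ã-𝟙 : Ã i ∙ (λ m → 𝟙 m j) ≈ Ã i j
          Ã-𝟙 = col-𝟙 (Ã i)

module Adjacency (𝕜 : ℚAlgebra) {n : ℕ} (Γ : Graph n) where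
  open ℚAlgebra 𝕜
  open LinearAlgebra 𝕜
  open Graph Γ

  -- The adjacency matrix of Γ over 𝕜
  Adj : Mat n
  Adj i j = if does (i ~? j) then 1# else 0#

  Adj-edge : ∀ {i j} → i ~ j → Adj i j ≈ 1#
  Adj-edge {i} {j} p with i ~? j
  ... | yes _ = refl
  ... | no ¬p = ⊥-elim (¬p p)

  Adj-nonedge : ∀ {i j} → ¬ i ~ j → Adj i j ≈ 0#
  Adj-nonedge {i} {j} ¬p with i ~? j
  ... | yes p = ⊥-elim (¬p p)
  ... | no _  = refl

  Adj-sym : SymmetricM Adj
  Adj-sym i j with i ~? j
  ... | yes p = sym (Adj-edge (~-sym p))
  ... | no ¬p = sym (Adj-nonedge (¬p ∘ ~-sym))

-- The graph Γ is the join of its two parts.  For the adjacency matrix A of Γ and the matrix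
-- Ã = Ind adj of adjacency inside the parts, A = Ã + Ind cross.
module Join (F : OrderedField) {n : ℕ} (Γ : Graph n) (φ : Fin n → Bool)
  (join : ∀ i j → ¬ φ i ≡ φ j → Graph._~_ Γ i j) where
  open OrderedField F
  open OrderedFieldProperties F
  open QuadraticRank F
  open Graph Γ
  open Partition Γ φ
  open Indicators algebra
  open Adjacency algebra Γ
  open SetoidReasoning setoid

  A² : Mat n
  A² i j = Adj i ∙ (λ m → Adj m j)

  -- The numbers of neighbours and of non-neighbours of i inside its part, and the size of the other part.
  k h x : Vec n
  k i = sum (Ind adj i)
  h i = sum (Ind non i)
  x i = sum (Ind cross i)

  Ind-nn : ∀ κ i j → NonNeg (Ind κ i j)
  Ind-nn κ i j with δ-cases κ (kind i j)
  ... | inj₁ e   = nn-resp (trans (sym (δ-refl κ)) (reflexive (≡.cong (δ κ) e))) nn-1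
  ... | inj₂ δ≈0 = nn-≈0 δ≈0

  occurs⇒sum≉0 : ∀ {i j κ} → kind i j ≡ κ → ¬ sum (Ind κ i) ≈ 0#
  occurs⇒sum≉0 {i} {j} {κ} e s≈0 = 1≉0 (trans (sym (δ-refl κ)) (trans (reflexive (≡.cong (δ κ) (≡.sym e)))
    (sum-nn≈0 _ (Ind-nn κ i) (nn-≈0 (-0≈0 s≈0)) j)))

  sum-eq : ∀ i → sum (Ind eq i) ≈ 1#
  sum-eq i = trans (sum-cong (λ j → trans (sym (𝟙≈eq i j)) (sym (*-identityʳ _)))) (𝟙-· (λ _ → 1#) i)

  -- The indicator of different parts
  ξ : Bool → Bool → Carrier
  ξ f g = if does (f Bool.≟ g) then 0# else 1#

  ξ-sym : ∀ f g → ξ f g ≈ ξ g f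
  ξ-sym false false = refl
  ξ-sym false true  = refl
  ξ-sym true  false = refl
  ξ-sym true  true  = refl

  ξ-refl : ∀ f → ξ f f ≈ 0#
  ξ-refl false = refl
  ξ-refl true  = refl

  ξ-≡ : ∀ {f g} → f ≡ g → ξ f g ≈ 0#
  ξ-≡ {f} ≡.refl = ξ-refl f

  ξ-≢ : ∀ {f g} → ¬ f ≡ g → ξ f g ≈ 1#
  ξ-≢ {false} {false} p = ⊥-elim (p ≡.refl)
  ξ-≢ {false} {true}  p = refl
  ξ-≢ {true}  {false} p = refl
  ξ-≢ {true}  {true}  p = ⊥-elim (p ≡.refl)

  cross≈ξ : ∀ i j → Ind cross i j ≈ ξ (φ i) (φ j)
  cross≈ξ i j with kind i j | kinded i j
  ... | _ | equal p           = sym (ξ-≡ (≡.cong φ p))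
  ... | _ | adjacent p _      = sym (ξ-≡ p)
  ... | _ | nonadjacent p _ _ = sym (ξ-≡ p)
  ... | _ | crossing p        = sym (ξ-≢ p)

  Adj≈ : ∀ i j → Adj i j ≈ Ind adj i j + Ind cross i j
  Adj≈ i j with kind i j | kinded i j
  ... | _ | equal p           = trans (Adj-nonedge (~-irrefl p)) (sym (+-identityʳ 0#))
  ... | _ | adjacent _ p      = trans (Adj-edge p) (sym (+-identityʳ 1#))
  ... | _ | nonadjacent _ _ p = trans (Adj-nonedge p) (sym (+-identityʳ 0#))
  ... | _ | crossing p        = trans (Adj-edge (join i j p)) (sym (+-identityˡ 1#))

  -- The matrix of the relation of lying in the same part
  same : Mat n
  same i j = Ind eq i j + (Ind adj i j + Ind non i j)

  δ-total : ∀ κ → (δ eq κ + (δ adj κ + δ non κ)) + δ cross κ ≈ 1#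
  δ-total eq    = trans (+-identityʳ _) (trans (+-congˡ (+-identityʳ 0#)) (+-identityʳ 1#))
  δ-total adj   = trans (+-identityʳ _) (trans (+-identityˡ _) (+-identityʳ 1#))
  δ-total non   = trans (+-identityʳ _) (trans (+-identityˡ _) (+-identityˡ 1#))
  δ-total cross = trans (+-congʳ (trans (+-identityˡ _) (+-identityʳ 0#))) (+-identityˡ 1#)

  same≈ : ∀ i j → same i j ≈ 1# - ξ (φ i) (φ j)
  same≈ i j = begin
    same i j                                             ≈⟨ solve 2 (λ s c → s := (s :+ c) :- c) refl (same i j)
        (Ind cross i j) ⟩
    (same i j + Ind cross i j) - Ind cross i j           ≈⟨ +-cong (δ-total (kind i j)) (-‿cong (cross≈ξ i j)) ⟩
    1# - ξ (φ i) (φ j) ∎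

  sum-same : ∀ i → sum (same i) ≈ 1# + (k i + h i)
  sum-same i = trans (sum-+ _ _) (+-cong (sum-eq i) (sum-+ _ _))

  x-cross : ∀ {i j} → ¬ φ i ≡ φ j → x i ≈ 1# + (k j + h j)
  x-cross {i} {j} ¬p = trans (sum-cong
      (λ m → trans (cross≈ξ i m) (trans (flip (φ i) (φ j) (φ m) ¬p) (sym (same≈ j m))))) (sum-same j)
    where
    1-0≈1 : 1# - 0# ≈ 1#
    1-0≈1 = trans (+-congˡ (-0≈0 refl)) (+-identityʳ 1#)
    flip : ∀ f g u → ¬ f ≡ g → ξ f u ≈ 1# - ξ g u
    flip false false u     p = ⊥-elim (p ≡.refl)
    flip true  true  u     p = ⊥-elim (p ≡.refl)
    flip false true  false p = sym (-‿inverseʳ 1#)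
    flip false true  true  p = sym 1-0≈1
    flip true  false false p = sym 1-0≈1
    flip true  false true  p = sym (-‿inverseʳ 1#)

  x-same : ∀ {i j} → φ i ≡ φ j → x i ≈ x j
  x-same {i} {j} p = sum-cong (λ m → trans (cross≈ξ i m) (trans (reflexive (≡.cong (λ f → ξ f (φ m)) p))
      (sym (cross≈ξ j m))))

  -- The square of the adjacency relation inside the parts
  T : Mat n
  T i j = Ind adj i ∙ (λ m → Ind adj m j)

  adj*cross : ∀ i j → Ind adj i ∙ (λ m → Ind cross m j) ≈ k i * ξ (φ i) (φ j)
  adj*cross i j = begin
    Ind adj i ∙ (λ m → Ind cross m j)
      ≈⟨ sum-cong (λ m → trans (*-congˡ (cross≈ξ m j)) (along (λ f → ξ f (φ j)) i m)) ⟩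
    sum (λ m → Ind adj i m * ξ (φ i) (φ j))
      ≈⟨ *-sumʳ _ _ ⟨
    k i * ξ (φ i) (φ j) ∎

  cross*adj : ∀ i j → Ind cross i ∙ (λ m → Ind adj m j) ≈ k j * ξ (φ i) (φ j)
  cross*adj i j = begin
    Ind cross i ∙ (λ m → Ind adj m j)
      ≈⟨ ∙-comm _ _ ⟩
    (λ m → Ind adj m j) ∙ Ind cross i
      ≈⟨ ∙-cong (λ m → Ind-sym adj m j) (λ m → Ind-sym cross i m) ⟩
    Ind adj j ∙ (λ m → Ind cross m i)
      ≈⟨ trans (adj*cross j i) (*-congˡ (ξ-sym (φ j) (φ i))) ⟩
    k j * ξ (φ i) (φ j) ∎

  A²-expand : ∀ i j → A² i j ≈ (T i j + k i * ξ (φ i) (φ j)) +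
      (k j * ξ (φ i) (φ j) + Ind cross i ∙ (λ m → Ind cross m j))
  A²-expand i j = begin
    Adj i ∙ (λ m → Adj m j)
      ≈⟨ ∙-cong (Adj≈ i) (λ m → Adj≈ m j) ⟩
    (λ m → Ind adj i m + Ind cross i m) ∙ (λ m → Ind adj m j + Ind cross m j)
      ≈⟨ trans (∙-+ˡ _ _ _) (+-cong (∙-+ʳ _ _ _) (∙-+ʳ _ _ _)) ⟩
    (T i j + Ind adj i ∙ (λ m → Ind cross m j)) + (Ind cross i ∙ (λ m → Ind adj m j) + Ind cross i ∙
        (λ m → Ind cross m j))
      ≈⟨ +-cong (+-congˡ (adj*cross i j)) (+-congʳ (cross*adj i j)) ⟩
    (T i j + k i * ξ (φ i) (φ j)) + (k j * ξ (φ i) (φ j) + Ind cross i ∙ (λ m → Ind cross m j)) ∎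

  A²-same : ∀ {i j} → φ i ≡ φ j → A² i j ≈ T i j + x i
  A²-same {i} {j} p = begin
    A² i j
      ≈⟨ A²-expand i j ⟩
    (T i j + k i * ξ (φ i) (φ j)) + (k j * ξ (φ i) (φ j) + Ind cross i ∙ (λ m → Ind cross m j))
      ≈⟨ +-cong (trans (+-congˡ (trans (*-congˡ (ξ-≡ p)) (zeroʳ _))) (+-identityʳ _))
           (trans (+-cong (trans (*-congˡ (ξ-≡ p)) (zeroʳ _)) (sum-cong cc)) (+-identityˡ _)) ⟩
    T i j + x i ∎
    where
    ξ-idem : ∀ f u → ξ f u * ξ u f ≈ ξ f u
    ξ-idem false false = zeroˡ _
    ξ-idem false true  = *-identityˡ _
    ξ-idem true  false = *-identityˡ _
    ξ-idem true  true  = zeroˡ _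
    cc : ∀ m → Ind cross i m * Ind cross m j ≈ Ind cross i m
    cc m = trans (*-cong (cross≈ξ i m) (trans (cross≈ξ m j) (reflexive (≡.cong (ξ (φ m)) (≡.sym p)))))
        (trans (ξ-idem (φ i) (φ m)) (sym (cross≈ξ i m)))

  T-cross : ∀ {i j} → ¬ φ i ≡ φ j → T i j ≈ 0#
  T-cross {i} {j} ¬p = sum-zero _ λ m → term m
    where
    term : ∀ m → Ind adj i m * Ind adj m j ≈ 0#
    term m with kind i m | kinded i m
    ... | _ | equal _           = zeroˡ _
    ... | _ | nonadjacent _ _ _ = zeroˡ _
    ... | _ | crossing _        = zeroˡ _
    ... | _ | adjacent p _ with kind m j | kinded m j
    ...   | _ | equal _           = zeroʳ _
    ...   | _ | nonadjacent _ _ _ = zeroʳ _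
    ...   | _ | crossing _        = zeroʳ _
    ...   | _ | adjacent q _      = ⊥-elim (¬p (≡.trans p q))

  A²-cross : ∀ {i j} → ¬ φ i ≡ φ j → A² i j ≈ k i + k j
  A²-cross {i} {j} ¬p = begin
    A² i j
      ≈⟨ A²-expand i j ⟩
    (T i j + k i * ξ (φ i) (φ j)) + (k j * ξ (φ i) (φ j) + Ind cross i ∙ (λ m → Ind cross m j))
      ≈⟨ +-cong (trans (+-cong (T-cross ¬p) (trans (*-congˡ (ξ-≢ ¬p)) (*-identityʳ _))) (+-identityˡ _))
           (trans (+-cong (trans (*-congˡ (ξ-≢ ¬p)) (*-identityʳ _)) (sum-zero _ cc)) (+-identityʳ _)) ⟩
    k i + k j ∎
    where
    ξ-no-third : ∀ f u g → ¬ f ≡ g → ξ f u * ξ u g ≈ 0#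
    ξ-no-third false u     false p = ⊥-elim (p ≡.refl)
    ξ-no-third true  u     true  p = ⊥-elim (p ≡.refl)
    ξ-no-third false false true  p = zeroˡ _
    ξ-no-third false true  true  p = zeroʳ _
    ξ-no-third true  false false p = zeroʳ _
    ξ-no-third true  true  false p = zeroˡ _
    cc : ∀ m → Ind cross i m * Ind cross m j ≈ 0#
    cc m = trans (*-cong (cross≈ξ i m) (cross≈ξ m j)) (ξ-no-third (φ i) (φ m) (φ j) ¬p)

  T-diag : ∀ i → T i i ≈ k i
  T-diag i = sum-cong λ m → trans (*-congˡ (Ind-sym adj m i)) (idem (kind i m))
    where
    idem : ∀ κ → δ adj κ * δ adj κ ≈ δ adj κ
    idem eq    = zeroˡ _
    idem adj   = *-identityˡ _
    idem non   = zeroˡ _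
    idem cross = zeroˡ _

  A²-diag : ∀ i → A² i i ≈ k i + x i
  A²-diag i = trans (A²-same ≡.refl) (+-congʳ (T-diag i))

  -- If A² - sA + p𝟙 has rank at most one and degrees are constant on the parts, then the parts are regular with
  -- Ã² = (k + p)S + sÃ - p𝟙, S being the matrix of lying in the same part.  Together with the entries of
  -- A² between the parts, this leaves two equations for the parameters.
  module Equations (rank-one : QuadraticallyRankOne Adj)
    (same-degree : ∀ {i j} → φ i ≡ φ j → A² i i ≈ A² j j) where
    open QuadraticallyRankOne rank-one

    k-same : ∀ {i j} → φ i ≡ φ j → k i ≈ k j
    k-same {i} {j} p = begin
      k i                    ≈⟨ solve 2 (λ a b → a := (a :+ b) :- b) refl (k i) (x i) ⟩
      (k i + x i) - x i      ≈⟨ +-cong (trans (sym (A²-diag i)) (trans (same-degree p) (A²-diag j)))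
          (-‿cong (x-same p)) ⟩
      (k j + x j) - x j      ≈⟨ solve 2 (λ a b → a := (a :+ b) :- b) refl (k j) (x j) ⟨
      k j ∎

    C-diag : ∀ i → C i i ≈ (k i + x i) + p
    C-diag i = begin
      (A² i i + - s * Adj i i) + p * 𝟙 i i
        ≈⟨ +-cong (+-cong (A²-diag i) (*-congˡ (trans (Adj-nonedge (~-irrefl ≡.refl)) (sym ι-0))))
            (*-congˡ (trans (𝟙-diag i) (sym ι-1))) ⟩
      ((k i + x i) + - s * ι 0ℚ) + p * ι 1ℚ
        ≈⟨ solve 3 (λ d s p → (d :+ (:- s) :* con 0ℚ) :+ p :* con 1ℚ := d :+ p) refl (k i + x i) s p ⟩
      (k i + x i) + p ∎

    C-same : ∀ {i j} → φ i ≡ φ j → C i j ≈ C i i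
    C-same {i} {j} q = trans (same-rows i j C≈ j) (sym C≈)
      where
      C≈ : C i i ≈ C j j
      C≈ = trans (C-diag i) (trans (+-congʳ (+-cong (k-same q) (x-same q))) (sym (C-diag j)))

    T-formula : ∀ i j → T i j ≈ (k i + p) * same i j + (s * Ind adj i j - p * Ind eq i j)
    T-formula i j = at (φ i Bool.≟ φ j)
      where
      at : Dec (φ i ≡ φ j) → T i j ≈ (k i + p) * same i j + (s * Ind adj i j - p * Ind eq i j)
      at (yes q) = begin
        T i j
          ≈⟨ solve 5 (λ t x a s e → t := ((t :+ x) :+ (:- s) :* a :+ e) :- x :+ (s :* a :- e)) refl (T i j) (x i)
              (Ind adj i j) s (p * Ind eq i j) ⟩
        (T i j + x i + - s * Ind adj i j + p * Ind eq i j) - x i + (s * Ind adj i j - p * Ind eq i j)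
          ≈⟨ +-congʳ (+-congʳ (+-cong (+-cong (sym (A²-same q)) (*-congˡ (sym Adj-same))) (*-congˡ (sym (𝟙≈eq i j)))))
              ⟩
        C i j - x i + (s * Ind adj i j - p * Ind eq i j)
          ≈⟨ +-congʳ (+-congʳ (trans (C-same q) (C-diag i))) ⟩
        (k i + x i + p) - x i + (s * Ind adj i j - p * Ind eq i j)
          ≈⟨ +-congʳ (solve 3 (λ k x p → (k :+ x :+ p) :- x := (k :+ p) :* con 1ℚ) refl (k i) (x i) p) ⟩
        (k i + p) * ι 1ℚ + (s * Ind adj i j - p * Ind eq i j)
          ≈⟨ +-congʳ (*-congˡ (trans ι-1 (sym same≈1))) ⟩
        (k i + p) * same i j + (s * Ind adj i j - p * Ind eq i j) ∎
        where
        Adj-same : Adj i j ≈ Ind adj i j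
        Adj-same = trans (Adj≈ i j) (trans (+-congˡ (trans (cross≈ξ i j) (ξ-≡ q))) (+-identityʳ _))
        same≈1 : same i j ≈ 1#
        same≈1 = trans (same≈ i j) (trans (+-congˡ (-0≈0 (ξ-≡ q))) (+-identityʳ _))
      at (no ¬q) = trans (T-cross ¬q) (sym (begin
        (k i + p) * same i j + (s * Ind adj i j - p * Ind eq i j)
          ≈⟨ +-cong (*-congˡ (trans (reflexive (≡.cong (λ κ → δ eq κ + (δ adj κ + δ non κ)) e))
              (trans (+-identityˡ _) (+-identityˡ 0#))))
               (+-cong (*-congˡ (reflexive (≡.cong (δ adj) e))) (-‿cong (*-congˡ (reflexive (≡.cong (δ eq) e))))) ⟩
        (k i + p) * 0# + (s * 0# - p * 0#)
          ≈⟨ +-cong (zeroʳ _) (+-cong (zeroʳ _) (-0≈0 (zeroʳ _))) ⟩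
        0# + (0# + 0#)
          ≈⟨ trans (+-identityˡ _) (+-identityˡ 0#) ⟩
        0# ∎))
        where
        e : kind i j ≡ cross
        e = kinded⇒kind (crossing ¬q)

    -- The row sums of the formula for T
    regular-equation : ∀ i → k i * k i ≈ (k i + p) * (1# + (k i + h i)) + (s * k i - p * 1#)
    regular-equation i = begin
      k i * k i
        ≈⟨ *-sumʳ (k i) _ ⟩
      sum (λ m → Ind adj i m * k i)
        ≈⟨ sum-cong constant ⟨
      sum (λ m → Ind adj i m * k m)
        ≈⟨ ∙-·ᵥ-ones ⟨
      sum (λ j → T i j)
        ≈⟨ sum-cong (T-formula i) ⟩
      sum (λ j → (k i + p) * same i j + (s * Ind adj i j - p * Ind eq i j))
        ≈⟨ trans (sum-+ _ _) (+-cong (sym (*-sumˡ _ _))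
            (trans (sum-+ _ _) (+-cong (sym (*-sumˡ _ _)) (trans (sum-neg _) (-‿cong (sym (*-sumˡ _ _))))))) ⟩
      (k i + p) * sum (same i) + (s * k i - p * sum (Ind eq i))
        ≈⟨ +-cong (*-congˡ (sum-same i)) (+-congˡ (-‿cong (*-congˡ (sum-eq i)))) ⟩
      (k i + p) * (1# + (k i + h i)) + (s * k i - p * 1#) ∎
      where
      constant : ∀ m → Ind adj i m * k m ≈ Ind adj i m * k i
      constant m with kind i m | kinded i m
      ... | _ | equal _           = trans (zeroˡ _) (sym (zeroˡ _))
      ... | _ | adjacent p _      = *-congˡ (k-same (≡.sym p))
      ... | _ | nonadjacent _ _ _ = trans (zeroˡ _) (sym (zeroˡ _))
      ... | _ | crossing _        = trans (zeroˡ _) (sym (zeroˡ _))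
      ∙-·ᵥ-ones : sum (λ j → T i j) ≈ sum (λ m → Ind adj i m * k m)
      ∙-·ᵥ-ones = trans (sum-comm _) (sum-cong (λ m → sym (*-sumˡ _ _)))

    -- The minor (A²_ij - s)² = C_ii C_jj for i and j in different parts
    cross-equation : ∀ {i j} → ¬ φ i ≡ φ j →
      (k i + k j - s) * (k i + k j - s) ≈ ((k i + (1# + (k j + h j))) + p) * ((k j + (1# + (k i + h i))) + p)
    cross-equation {i} {j} ¬q = begin
      (k i + k j - s) * (k i + k j - s)
        ≈⟨ *-cong C-cross C-cross ⟨
      C i j * C i j
        ≈⟨ minors i j ⟩
      C i i * C j j
        ≈⟨ *-cong (trans (C-diag i) (+-congʳ (+-congˡ (x-cross ¬q))))
            (trans (C-diag j) (+-congʳ (+-congˡ (x-cross (¬q ∘ ≡.sym))))) ⟩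
      ((k i + (1# + (k j + h j))) + p) * ((k j + (1# + (k i + h i))) + p) ∎
      where
      C-cross : C i j ≈ k i + k j - s
      C-cross = begin
        (A² i j + - s * Adj i j) + p * 𝟙 i j
          ≈⟨ +-cong (+-cong (A²-cross ¬q) (*-congˡ (trans (Adj-edge (join i j ¬q)) (sym ι-1))))
              (*-congˡ (trans (𝟙-off (¬q ∘ ≡.cong φ)) (sym ι-0))) ⟩
        (k i + k j + - s * ι 1ℚ) + p * ι 0ℚ
          ≈⟨ solve 3 (λ a s p → (a :+ (:- s) :* con 1ℚ) :+ p :* con 0ℚ := a :- s) refl (k i + k j) s p ⟩
        k i + k j - s ∎

    part-size≉0 : ∀ i → ¬ 1# + (k i + h i) ≈ 0#
    part-size≉0 i e = 1≉0 (squeeze nn-1 (nn-+ (sum-nn _ (Ind-nn adj i)) (sum-nn _ (Ind-nn non i))) (nn-≈0 (-0≈0 e)))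

    -- The part of i cannot be a clique on at least two vertices if the part of j is not a clique: the
    -- equations give s = -1 - p and p = -kⱼ, and then (1 + kᵢ)hⱼ = 0.
    no-complete-part : ∀ {i j} → ¬ φ i ≡ φ j → h i ≈ 0# → ¬ k i ≈ 0# → ¬ h j ≈ 0# → ⊥
    no-complete-part {i} {j} ¬q hᵢ≈0 kᵢ≉0 hⱼ≉0 = hⱼ≉0 (*-cancel (part-size≉0 i) final)
      where
      s+p+1 : s + p + ι 1ℚ ≈ 0#
      s+p+1 = *-cancel kᵢ≉0 (begin
        k i * (s + p + ι 1ℚ)
          ≈⟨ solve 3 (λ k s p → k :* (s :+ p :+ con 1ℚ) :=
              ((k :+ p) :* (con 1ℚ :+ (k :+ con 0ℚ)) :+ (s :* k :- p :* con 1ℚ)) :- k :* k) refl (k i) s p ⟩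
        ((k i + p) * (ι 1ℚ + (k i + ι 0ℚ)) + (s * k i - p * ι 1ℚ)) - k i * k i
          ≈⟨ +-congʳ (+-cong (*-congˡ (+-cong ι-1 (+-congˡ (trans ι-0 (sym hᵢ≈0))))) (+-congˡ (-‿cong (*-congˡ ι-1))))
              ⟩
        ((k i + p) * (1# + (k i + h i)) + (s * k i - p * 1#)) - k i * k i
          ≈⟨ difference≈0 (sym (regular-equation i)) ⟩
        0# ∎)
      s≈ : s ≈ - p - ι 1ℚ
      s≈ = ≈-difference (trans (solve 2 (λ s p → s :- (:- p :- con 1ℚ) := s :+ p :+ con 1ℚ) refl s p) s+p+1)
      kⱼ+p : k j + p ≈ 0#
      kⱼ+p = *-cancel hⱼ≉0 (begin
        h j * (k j + p)
          ≈⟨ solve 3 (λ k h p → h :* (k :+ p) :=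
              ((k :+ p) :* (con 1ℚ :+ (k :+ h)) :+ ((:- p :- con 1ℚ) :* k :- p :* con 1ℚ)) :- k :* k) refl (k j) (h j)
                  p ⟩
        ((k j + p) * (ι 1ℚ + (k j + h j)) + ((- p - ι 1ℚ) * k j - p * ι 1ℚ)) - k j * k j
          ≈⟨ +-congʳ (+-cong (*-congˡ (+-congʳ ι-1)) (+-cong (*-congʳ (sym s≈)) (-‿cong (*-congˡ ι-1)))) ⟩
        ((k j + p) * (1# + (k j + h j)) + (s * k j - p * 1#)) - k j * k j
          ≈⟨ difference≈0 (sym (regular-equation j)) ⟩
        0# ∎)
      p≈ : p ≈ - k j
      p≈ = ≈-difference (trans (solve 2 (λ k p → p :- :- k := k :+ p) refl (k j) p) kⱼ+p)
      s≈′ : s ≈ k j - ι 1ℚ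
      s≈′ = trans s≈ (trans (+-congʳ (-‿cong p≈)) (solve 1 (λ k → :- :- k :- con 1ℚ := k :- con 1ℚ) refl (k j)))
      final : (1# + (k i + h i)) * h j ≈ 0#
      final = begin
        (1# + (k i + h i)) * h j
          ≈⟨ *-congʳ (+-cong (sym ι-1) (+-congˡ (trans hᵢ≈0 (sym ι-0)))) ⟩
        (ι 1ℚ + (k i + ι 0ℚ)) * h j
          ≈⟨ solve 3 (λ a b h → (con 1ℚ :+ (a :+ con 0ℚ)) :* h
               := ((a :+ (con 1ℚ :+ (b :+ h))) :+ :- b) :* ((b :+ (con 1ℚ :+ (a :+ con 0ℚ))) :+ :- b)
                  :- (a :+ b :- (b :- con 1ℚ)) :* (a :+ b :- (b :- con 1ℚ))) refl (k i) (k j) (h j) ⟩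
        ((k i + (ι 1ℚ + (k j + h j))) + - k j) * ((k j + (ι 1ℚ + (k i + ι 0ℚ))) + - k j)
          - (k i + k j - (k j - ι 1ℚ)) * (k i + k j - (k j - ι 1ℚ))
          ≈⟨ +-cong (*-cong (+-cong (+-congˡ (+-congʳ ι-1)) (sym p≈))
              (+-cong (+-congˡ (+-cong ι-1 (+-congˡ (trans ι-0 (sym hᵢ≈0))))) (sym p≈)))
               (-‿cong (*-cong (+-congˡ (-‿cong (sym s≈′))) (+-congˡ (-‿cong (sym s≈′))))) ⟩
        ((k i + (1# + (k j + h j))) + p) * ((k j + (1# + (k i + h i))) + p) - (k i + k j - s) * (k i + k j - s)
          ≈⟨ difference≈0 (sym (cross-equation ¬q)) ⟩
        0# ∎

    -- If the part of i is a coclique on at least two vertices and the part of j is not a coclique, then Γ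
    -- is regular: the equations give p = 0 and s = kⱼ - nⱼ, and then nⱼ = kⱼ + nᵢ for the part sizes.
    empty-part⇒regular : ∀ {i j} → ¬ φ i ≡ φ j → k i ≈ 0# → ¬ h i ≈ 0# → ¬ k j ≈ 0# → A² i i ≈ A² j j
    empty-part⇒regular {i} {j} ¬q kᵢ≈0 hᵢ≉0 kⱼ≉0 = begin
      A² i i           ≈⟨ trans (A²-diag i) (+-cong kᵢ≈0 (x-cross ¬q)) ⟩
      0# + nⱼ          ≈⟨ +-identityˡ _ ⟩
      nⱼ               ≈⟨ ≈-difference (*-cancel (part-size≉0 j) final) ⟩
      k j + nᵢ         ≈⟨ trans (A²-diag j) (+-congˡ (x-cross (¬q ∘ ≡.sym))) ⟨
      A² j j ∎
      where
      nᵢ = 1# + (k i + h i)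
      nⱼ = 1# + (k j + h j)
      kᵢ≈ι0 : k i ≈ ι 0ℚ
      kᵢ≈ι0 = trans kᵢ≈0 (sym ι-0)
      p≈0 : p ≈ ι 0ℚ
      p≈0 = trans (*-cancel hᵢ≉0 (begin
        h i * p
          ≈⟨ solve 3 (λ h s p → h :* p := ((con 0ℚ :+ p) :* (con 1ℚ :+ (con 0ℚ :+ h)) :+ (s :* con 0ℚ :- p :* con 1ℚ))
              :- con 0ℚ :* con 0ℚ) refl (h i) s p ⟩
        ((ι 0ℚ + p) * (ι 1ℚ + (ι 0ℚ + h i)) + (s * ι 0ℚ - p * ι 1ℚ)) - ι 0ℚ * ι 0ℚ
          ≈⟨ +-cong (+-cong (*-cong (+-congʳ (sym kᵢ≈ι0)) (+-cong ι-1 (+-congʳ (sym kᵢ≈ι0))))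
              (+-cong (*-congˡ (sym kᵢ≈ι0)) (-‿cong (*-congˡ ι-1))))
               (-‿cong (*-cong (sym kᵢ≈ι0) (sym kᵢ≈ι0))) ⟩
        ((k i + p) * nᵢ + (s * k i - p * 1#)) - k i * k i
          ≈⟨ difference≈0 (sym (regular-equation i)) ⟩
        0# ∎)) (sym ι-0)
      s≈ : s ≈ k j - nⱼ
      s≈ = sym (≈-difference (*-cancel kⱼ≉0 (begin
        k j * ((k j - nⱼ) - s)
          ≈⟨ solve 3 (λ k n s → k :* ((k :- n) :- s) := :- (((k :+ con 0ℚ) :* n :+ (s :* k :- con 0ℚ :* con 1ℚ)) :- k
              :* k)) refl (k j) nⱼ s ⟩
        - (((k j + ι 0ℚ) * nⱼ + (s * k j - ι 0ℚ * ι 1ℚ)) - k j * k j)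
          ≈⟨ -‿cong (+-congʳ (+-cong (*-congʳ (+-congˡ (sym p≈0))) (+-congˡ (-‿cong (*-cong (sym p≈0) ι-1))))) ⟩
        - (((k j + p) * nⱼ + (s * k j - p * 1#)) - k j * k j)
          ≈⟨ -0≈0 (difference≈0 (sym (regular-equation j))) ⟩
        0# ∎)))
      final : nⱼ * (nⱼ - (k j + nᵢ)) ≈ 0#
      final = begin
        nⱼ * (nⱼ - (k j + nᵢ))
          ≈⟨ solve 3 (λ k n m → n :* (n :- (k :+ m)) := (con 0ℚ :+ k :- (k :- n)) :* (con 0ℚ :+ k :- (k :- n)) :-
              ((con 0ℚ :+ n) :+ con 0ℚ) :* ((k :+ m) :+ con 0ℚ)) refl (k j) nⱼ nᵢ ⟩
        (ι 0ℚ + k j - (k j - nⱼ)) * (ι 0ℚ + k j - (k j - nⱼ)) - ((ι 0ℚ + nⱼ) + ι 0ℚ) * ((k j + nᵢ) + ι 0ℚ)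
          ≈⟨ +-cong (*-cong side side) (-‿cong (*-cong (+-cong (+-congʳ (sym kᵢ≈ι0)) (sym p≈0)) (+-congˡ (sym p≈0))))
              ⟩
        (k i + k j - s) * (k i + k j - s) - ((k i + nⱼ) + p) * ((k j + nᵢ) + p)
          ≈⟨ difference≈0 (cross-equation ¬q) ⟩
        0# ∎
        where
        side : ι 0ℚ + k j - (k j - nⱼ) ≈ k i + k j - s
        side = +-cong (+-congʳ (sym kᵢ≈ι0)) (-‿cong (sym s≈))

-- The real numbers as an ordered field

module RealField where
  open ≡ using (refl)
  open import Data.Integer.Base using (+_; -[1+_])

  ℚ-algebra : ℚAlgebra
  ℚ-algebra = record
    { commutativeRing = ℚ.+-*-commutativeRing
    ; ι     = id
    ; ι-+   = λ _ _ → refl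
    ; ι-*   = λ _ _ → refl
    ; ι-neg = λ _ → refl
    ; ι-0   = refl
    ; ι-1   = refl
    }

  module ℚ-linear = LinearAlgebra ℚ-algebra
  open ℚ-linear using (solve; _:+_; _:*_; _:-_; :-_; _:=_; con)

  -- The inverse, extended by 0 at 0.
  invℚ : ℚ → ℚ
  invℚ q with q ℚ.≟ 0ℚ
  ... | yes _   = 0ℚ
  ... | no  q≢0 = ℚ.1/_ q {{ℚ.≢-nonZero q≢0}}

  invℚ-inverse : ∀ q → ¬ q ≡ 0ℚ → q ℚ.* invℚ q ≡ 1ℚ
  invℚ-inverse q q≢0 with q ℚ.≟ 0ℚ
  ... | yes q≡0 = ⊥-elim (q≢0 q≡0)
  ... | no  q≢  = ℚ.*-inverseʳ q {{ℚ.≢-nonZero q≢}}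

  0≤-resp : ∀ {p q} → p ≡ q → 0ℚ ℚ.≤ p → 0ℚ ℚ.≤ q
  0≤-resp refl p = p

  0<-resp : ∀ {p q} → p ≡ q → 0ℚ ℚ.< p → 0ℚ ℚ.< q
  0<-resp refl p = p

  0≤-+ : ∀ {p q} → 0ℚ ℚ.≤ p → 0ℚ ℚ.≤ q → 0ℚ ℚ.≤ p ℚ.+ q
  0≤-+ {p} {q} = ℚ.+-mono-≤ {0ℚ} {p} {0ℚ} {q}

  0<-+ : ∀ {p q} → 0ℚ ℚ.< p → 0ℚ ℚ.≤ q → 0ℚ ℚ.< p ℚ.+ q
  0<-+ {p} {q} = ℚ.+-mono-<-≤ {0ℚ} {p} {0ℚ} {q}

  0≤-* : ∀ {p q} → 0ℚ ℚ.≤ p → 0ℚ ℚ.≤ q → 0ℚ ℚ.≤ p ℚ.* q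
  0≤-* {p} {q} 0≤p 0≤q = ℚ.nonNegative⁻¹ (p ℚ.* q)
    {{ℚ.nonNeg*nonNeg⇒nonNeg p {{ℚ.nonNegative 0≤p}} q {{ℚ.nonNegative 0≤q}}}}

  0<-* : ∀ {p q} → 0ℚ ℚ.< p → 0ℚ ℚ.< q → 0ℚ ℚ.< p ℚ.* q
  0<-* {p} {q} 0<p 0<q = ℚ.positive⁻¹ (p ℚ.* q) {{ℚ.pos*pos⇒pos p {{ℚ.positive 0<p}} q {{ℚ.positive 0<q}}}}

  ≤⇒0≤ : ∀ {p q} → p ℚ.≤ q → 0ℚ ℚ.≤ q ℚ.- p
  ≤⇒0≤ {p} {q} p≤q = ≡.subst (ℚ._≤ q ℚ.- p) (ℚ.+-inverseʳ p) (ℚ.+-monoˡ-≤ (ℚ.- p) p≤q)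

  <⇒0< : ∀ {p q} → p ℚ.< q → 0ℚ ℚ.< q ℚ.- p
  <⇒0< {p} {q} p<q = ≡.subst (ℚ._< q ℚ.- p) (ℚ.+-inverseʳ p) (ℚ.+-monoˡ-< (ℚ.- p) p<q)

  0≤⇒≤ : ∀ {p q} → 0ℚ ℚ.≤ q ℚ.- p → p ℚ.≤ q
  0≤⇒≤ {p} {q} h = ≡.subst₂ ℚ._≤_ (ℚ.+-identityˡ p) (solve 2 (λ p q → q :- p :+ p := q) refl p q) (ℚ.+-monoˡ-≤ p h)

  0<⇒< : ∀ {p q} → 0ℚ ℚ.< q ℚ.- p → p ℚ.< q
  0<⇒< {p} {q} h = ≡.subst₂ ℚ._<_ (ℚ.+-identityˡ p) (solve 2 (λ p q → q :- p :+ p := q) refl p q) (ℚ.+-monoˡ-< p h)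

  0<½ : 0ℚ ℚ.< ½
  0<½ = ℚ.positive⁻¹ ½

  0<1 : 0ℚ ℚ.< 1ℚ
  0<1 = ℚ.positive⁻¹ 1ℚ

  half-pos : ∀ {ε} → 0ℚ ℚ.< ε → 0ℚ ℚ.< ½ ℚ.* ε
  half-pos = 0<-* 0<½

  0<⇒≢ : ∀ {q} → 0ℚ ℚ.< q → ¬ q ≡ 0ℚ
  0<⇒≢ 0<q refl = ℚ.<-irrefl refl 0<q

  ¬0≤neg : ∀ {q} → 0ℚ ℚ.< q → ¬ 0ℚ ℚ.≤ ℚ.- q
  ¬0≤neg {q} 0<q h = ℚ.<-irrefl (≡.sym (ℚ.+-inverseʳ q)) (0<-+ 0<q h)

  invℚ-pos : ∀ {q} → 0ℚ ℚ.< q → 0ℚ ℚ.< invℚ q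
  invℚ-pos {q} 0<q with q ℚ.≟ 0ℚ
  ... | yes q≡0 = ⊥-elim (0<⇒≢ 0<q q≡0)
  ... | no  q≢0 = ℚ.positive⁻¹ _ {{ℚ.1/pos⇒pos q {{ℚ.positive 0<q}}}}

  -- In the next lemmas |d| < ε is exchanged for the pair 0 < ε - d and 0 < ε + d.
  0≤∣d∣-d : ∀ d → 0ℚ ℚ.≤ ℚ.∣ d ∣ ℚ.- d
  0≤∣d∣-d d with ℚ.∣p∣≡p∨∣p∣≡-p d
  ... | inj₁ e = ℚ.≤-reflexive (≡.sym (≡.trans (≡.cong (ℚ._- d) e) (ℚ.+-inverseʳ d)))
  ... | inj₂ e = 0≤-resp (≡.cong (ℚ.∣ d ∣ ℚ.+_) e) (0≤-+ (ℚ.0≤∣p∣ d) (ℚ.0≤∣p∣ d))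

  <-minus : ∀ {d ε} → ℚ.∣ d ∣ ℚ.< ε → 0ℚ ℚ.< ε ℚ.- d
  <-minus {d} {ε} h = 0<-resp (solve 3 (λ a e d → (e :- a) :+ (a :- d) := e :- d) refl ℚ.∣ d ∣ ε d)
    (0<-+ (<⇒0< h) (0≤∣d∣-d d))

  <-plus : ∀ {d ε} → ℚ.∣ d ∣ ℚ.< ε → 0ℚ ℚ.< ε ℚ.+ d
  <-plus {d} {ε} h = 0<-resp (solve 2 (λ d e → e :- :- d := e :+ d) refl d ε)
    (<-minus (≡.subst (ℚ._< ε) (≡.sym (ℚ.∣-p∣≡∣p∣ d)) h))

  ∣∣<-intro : ∀ {d ε} → 0ℚ ℚ.< ε ℚ.- d → 0ℚ ℚ.< ε ℚ.+ d → ℚ.∣ d ∣ ℚ.< ε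
  ∣∣<-intro {d} {ε} p q with ℚ.∣p∣≡p∨∣p∣≡-p d
  ... | inj₁ e = ≡.subst (ℚ._< ε) (≡.sym e) (0<⇒< p)
  ... | inj₂ e = ≡.subst (ℚ._< ε) (≡.sym e) (0<⇒< (0<-resp (solve 2 (λ d e → e :+ d := e :- :- d) refl d ε) q))

  -- Sequences of rational numbers that tend to 0
  Null : (ℕ → ℚ) → Set
  Null s = ∀ ε → 0ℚ ℚ.< ε → ∃[ N ] (∀ n → N ℕ.≤ n → ℚ.∣ s n ∣ ℚ.< ε)

  null-resp : ∀ {s t} → (∀ n → s n ≡ t n) → Null s → Null t
  null-resp e p ε ε>0 = let N , h = p ε ε>0 in N , λ n N≤n → ≡.subst (λ q → ℚ.∣ q ∣ ℚ.< ε) (e n) (h n N≤n)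

  null-+ : ∀ {s t} → Null s → Null t → Null (λ n → s n ℚ.+ t n)
  null-+ {s} {t} p q ε ε>0 =
    let M , f = p _ (half-pos ε>0) ; N , g = q _ (half-pos ε>0) in
    M ℕ.⊔ N , λ n ≤n → ℚ.≤-<-trans (ℚ.∣p+q∣≤∣p∣+∣q∣ (s n) (t n))
      (≡.subst (ℚ.∣ s n ∣ ℚ.+ ℚ.∣ t n ∣ ℚ.<_) (solve 1 (λ e → con ½ :* e :+ con ½ :* e := e) refl ε)
        (ℚ.+-mono-< (f n (ℕ.m⊔n≤o⇒m≤o M N ≤n)) (g n (ℕ.m⊔n≤o⇒n≤o M N ≤n))))

  null-neg : ∀ {s} → Null s → Null (λ n → ℚ.- s n)
  null-neg {s} p ε ε>0 = let N , f = p ε ε>0 in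
    N , λ n ≤n → ≡.subst (ℚ._< ε) (≡.sym (ℚ.∣-p∣≡∣p∣ (s n))) (f n ≤n)

  Bounded : (ℕ → ℚ) → Set
  Bounded s = ∃[ b ] 0ℚ ℚ.< b × ∃[ N ] (∀ n → N ℕ.≤ n → ℚ.∣ s n ∣ ℚ.≤ b)

  cauchy-bounded : ∀ {s} → Cauchy s → Bounded s
  cauchy-bounded {s} c =
    let N , h = c 1ℚ 0<1 in
    1ℚ ℚ.+ ℚ.∣ s N ∣ , 0<-+ 0<1 (ℚ.0≤∣p∣ (s N)) , N , λ n ≤n → ℚ.≤-trans
      (≡.subst (λ q → ℚ.∣ q ∣ ℚ.≤ ℚ.∣ s n ℚ.- s N ∣ ℚ.+ ℚ.∣ s N ∣)
        (solve 2 (λ a b → a :- b :+ b := a) refl (s n) (s N)) (ℚ.∣p+q∣≤∣p∣+∣q∣ (s n ℚ.- s N) (s N)))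
      (ℚ.+-monoˡ-≤ ℚ.∣ s N ∣ (ℚ.<⇒≤ (h n N ≤n ℕ.≤-refl)))

  null-* : ∀ {s t} → Bounded s → Null t → Null (λ n → s n ℚ.* t n)
  null-* {s} {t} (b , 0<b , M , f) q ε ε>0 =
    let N , g = q (invℚ b ℚ.* ε) (0<-* (invℚ-pos 0<b) ε>0) in
    M ℕ.⊔ N , λ n ≤n → let open ℚ.≤-Reasoning in begin-strict
      ℚ.∣ s n ℚ.* t n ∣          ≡⟨ ℚ.∣p*q∣≡∣p∣*∣q∣ (s n) (t n) ⟩
      ℚ.∣ s n ∣ ℚ.* ℚ.∣ t n ∣    ≤⟨ ℚ.*-monoʳ-≤-nonNeg ℚ.∣ t n ∣ {{ℚ.∣-∣-nonNeg (t n)}} (f n (ℕ.m⊔n≤o⇒m≤o M N ≤n)) ⟩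
      b ℚ.* ℚ.∣ t n ∣            <⟨ ℚ.*-monoʳ-<-pos b {{ℚ.positive 0<b}} (g n (ℕ.m⊔n≤o⇒n≤o M N ≤n)) ⟩
      b ℚ.* (invℚ b ℚ.* ε)       ≡⟨ ℚ.*-assoc b (invℚ b) ε ⟨
      b ℚ.* invℚ b ℚ.* ε         ≡⟨ ≡.cong (ℚ._* ε) (invℚ-inverse b (0<⇒≢ 0<b)) ⟩
      1ℚ ℚ.* ε                   ≡⟨ ℚ.*-identityˡ ε ⟩
      ε                          ∎

  pointwise : ∀ {x y} → (∀ n → seq x n ≡ seq y n) → x ≈ᴿ y
  pointwise {x} {y} e = mk≈ᴿ λ ε ε>0 → 0 , λ n _ →
    ≡.subst (λ q → ℚ.∣ q ∣ ℚ.< ε) (≡.sym (≡.trans (≡.cong (ℚ._- seq y n) (e n)) (ℚ.+-inverseʳ (seq y n)))) ε>0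

  from-null : ∀ {x y} (s : ℕ → ℚ) → Null s → (∀ n → s n ≡ seq x n ℚ.- seq y n) → x ≈ᴿ y
  from-null s p e = mk≈ᴿ (null-resp e p)

  ℝ-commutativeRing : CommutativeRing 0ℓ 0ℓ
  ℝ-commutativeRing = record
    { Carrier = ℝ
    ; _≈_     = _≈ᴿ_
    ; _+_     = _+ᴿ_
    ; _*_     = _*ᴿ_
    ; -_      = -ᴿ_
    ; 0#      = fromℚᴿ 0ℚ
    ; 1#      = fromℚᴿ 1ℚ
    ; isCommutativeRing = record
      { isRing = record
        { +-isAbelianGroup = record
          { isGroup = record
            { isMonoid = record
              { isSemigroup = record
                { isMagma = record
                  { isEquivalence = ≈-equivalence
                  ; ∙-cong = λ {x} {y} {u} {v} p q → from-null _ (null-+ (tends-to-0 p) (tends-to-0 q))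
                      λ n → solve 4 (λ a b c d → a :- b :+ (c :- d) := (a :+ c) :- (b :+ d)) refl (seq x n) (seq y n)
                          (seq u n) (seq v n)
                  }
                ; assoc = λ x y z → pointwise λ n → ℚ.+-assoc (seq x n) (seq y n) (seq z n)
                }
              ; identity = (λ x → pointwise λ n → ℚ.+-identityˡ (seq x n)) ,
                  (λ x → pointwise λ n → ℚ.+-identityʳ (seq x n))
              }
            ; inverse = (λ x → pointwise λ n → ℚ.+-inverseˡ (seq x n)) ,
                (λ x → pointwise λ n → ℚ.+-inverseʳ (seq x n))
            ; ⁻¹-cong = λ {x} {y} p → from-null _ (null-neg (tends-to-0 p))
                λ n → solve 2 (λ a b → :- (a :- b) := (:- a) :- (:- b)) refl (seq x n) (seq y n)
            }
          ; comm = λ x y → pointwise λ n → ℚ.+-comm (seq x n) (seq y n)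
          }
        ; *-cong = λ {x} {y} {u} {v} p q → from-null _
            (null-+ {λ n → seq x n ℚ.* (seq u n ℚ.- seq v n)} {λ n → seq v n ℚ.* (seq x n ℚ.- seq y n)}
              (null-* {seq x} (cauchy-bounded {seq x} (cauchy x)) (tends-to-0 q))
              (null-* {seq v} (cauchy-bounded {seq v} (cauchy v)) (tends-to-0 p)))
            λ n → solve 4 (λ a b c d → a :* (c :- d) :+ d :* (a :- b) := a :* c :- b :* d) refl (seq x n) (seq y n)
                (seq u n) (seq v n)
        ; *-assoc = λ x y z → pointwise λ n → ℚ.*-assoc (seq x n) (seq y n) (seq z n)
        ; *-identity = (λ x → pointwise λ n → ℚ.*-identityˡ (seq x n)) ,
            (λ x → pointwise λ n → ℚ.*-identityʳ (seq x n))
        ; distrib = (λ x y z → pointwise λ n → ℚ.*-distribˡ-+ (seq x n) (seq y n) (seq z n))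
                  , (λ x y z → pointwise λ n → ℚ.*-distribʳ-+ (seq x n) (seq y n) (seq z n))
        }
      ; *-comm = λ x y → pointwise λ n → ℚ.*-comm (seq x n) (seq y n)
      }
    }
    where
    ≈-equivalence : IsEquivalence _≈ᴿ_
    ≈-equivalence = record
      { refl  = pointwise λ _ → refl
      ; sym   = λ {x} {y} p → from-null _ (null-neg (tends-to-0 p))
          λ n → solve 2 (λ a b → :- (a :- b) := b :- a) refl (seq x n) (seq y n)
      ; trans = λ {x} {y} {z} p q → from-null _ (null-+ (tends-to-0 p) (tends-to-0 q))
          λ n → solve 3 (λ a b c → (a :- b) :+ (b :- c) := a :- c) refl (seq x n) (seq y n) (seq z n)
      }

  ℝ-algebra : ℚAlgebra
  ℝ-algebra = record
    { commutativeRing = ℝ-commutativeRing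
    ; ι     = fromℚᴿ
    ; ι-+   = λ _ _ → pointwise λ _ → refl
    ; ι-*   = λ _ _ → pointwise λ _ → refl
    ; ι-neg = λ _ → pointwise λ _ → refl
    ; ι-0   = pointwise λ _ → refl
    ; ι-1   = pointwise λ _ → refl
    }

  open ℚAlgebra ℝ-algebra using () renaming (sym to ≈ᴿ-sym; trans to ≈ᴿ-trans)

  -- x ≥ 0: for every ε > 0, eventually xₙ ≥ -ε.
  Nonnegᴿ : ℝ → Set
  Nonnegᴿ x = ∀ ε → 0ℚ ℚ.< ε → ∃[ N ] (∀ n → N ℕ.≤ n → 0ℚ ℚ.≤ seq x n ℚ.+ ε)

  -- x > 0: for some rational c > 0, eventually xₙ ≥ c.
  Posᴿ : ℝ → Set
  Posᴿ x = ∃[ c ] 0ℚ ℚ.< c × ∃[ N ] (∀ n → N ℕ.≤ n → 0ℚ ℚ.≤ seq x n ℚ.- c)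

  nonneg-resp : ∀ {x y} → x ≈ᴿ y → Nonnegᴿ x → Nonnegᴿ y
  nonneg-resp {x} {y} e p ε ε>0 =
    let M , f = p _ (half-pos ε>0) ; N , g = tends-to-0 e _ (half-pos ε>0) in
    M ℕ.⊔ N , λ n ≤n → 0≤-resp
      (solve 3 (λ a b e → (a :+ con ½ :* e) :+ (con ½ :* e :- (a :- b)) := b :+ e) refl (seq x n) (seq y n) ε)
      (0≤-+ (f n (ℕ.m⊔n≤o⇒m≤o M N ≤n)) (ℚ.<⇒≤ (<-minus (g n (ℕ.m⊔n≤o⇒n≤o M N ≤n)))))

  nonneg-+ : ∀ {x y} → Nonnegᴿ x → Nonnegᴿ y → Nonnegᴿ (x +ᴿ y)
  nonneg-+ {x} {y} p q ε ε>0 =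
    let M , f = p _ (half-pos ε>0) ; N , g = q _ (half-pos ε>0) in
    M ℕ.⊔ N , λ n ≤n → 0≤-resp
      (solve 3 (λ a b e → (a :+ con ½ :* e) :+ (b :+ con ½ :* e) := (a :+ b) :+ e) refl (seq x n) (seq y n) ε)
      (0≤-+ (f n (ℕ.m⊔n≤o⇒m≤o M N ≤n)) (g n (ℕ.m⊔n≤o⇒n≤o M N ≤n)))

  nonneg-eventually : ∀ {x} N → (∀ n → N ℕ.≤ n → 0ℚ ℚ.≤ seq x n) → Nonnegᴿ x
  nonneg-eventually N f ε ε>0 = N , λ n ≤n → 0≤-+ (f n ≤n) (ℚ.<⇒≤ ε>0)

  pos⇒nonneg : ∀ {x} → Posᴿ x → Nonnegᴿ x
  pos⇒nonneg {x} (c , 0<c , N , f) = nonneg-eventually {x} N λ n ≤n →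
    0≤-resp (solve 2 (λ a c → a :- c :+ c := a) refl (seq x n) c) (0≤-+ (f n ≤n) (ℚ.<⇒≤ 0<c))

  pos⇒¬nonneg-neg : ∀ {x} → Posᴿ x → ¬ Nonnegᴿ (-ᴿ x)
  pos⇒¬nonneg-neg {x} (c , 0<c , M , f) p =
    let N , g = p _ (half-pos 0<c) ; n = M ℕ.⊔ N in
    ¬0≤neg (half-pos 0<c) (0≤-resp
      (solve 2 (λ a c → (a :- c) :+ (:- a :+ con ½ :* c) := :- (con ½ :* c)) refl (seq x n) c)
      (0≤-+ (f n (ℕ.m≤m⊔n M N)) (g n (ℕ.m≤n⊔m M N))))

  -- Let x vary by less than ε/4 beyond its N-th term.  If that term is at most ε/2, then x ≤ ε eventually;
  -- otherwise x > 0.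
  ¬pos⇒nonneg-neg : ∀ {x} → ¬ Posᴿ x → Nonnegᴿ (-ᴿ x)
  ¬pos⇒nonneg-neg {x} ¬pos ε ε>0 with cauchy x _ (half-pos (half-pos ε>0))
  ... | N , close with seq x N ℚ.≤? ½ ℚ.* ε
  ... | yes small = N , λ n ≤n → 0≤-resp
          (solve 3 (λ a b e → ((con ½ :* e :- b) :+ (con ½ :* (con ½ :* e) :- (a :- b))) :+ con ½ :* (con ½ :* e)
              := :- a :+ e) refl (seq x n) (seq x N) ε)
          (0≤-+ (0≤-+ (≤⇒0≤ small) (ℚ.<⇒≤ (<-minus (close n N ≤n ℕ.≤-refl)))) (ℚ.<⇒≤ (half-pos (half-pos ε>0))))
  ... | no large = ⊥-elim (¬pos (_ , half-pos (half-pos ε>0) , N , λ n ≤n → 0≤-resp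
          (solve 3 (λ a b e → (b :- con ½ :* e) :+ (con ½ :* (con ½ :* e) :+ (a :- b)) := a :- con ½ :* (con ½ :* e))
              refl (seq x n) (seq x N) ε)
          (0≤-+ (ℚ.<⇒≤ (<⇒0< (ℚ.≰⇒> large))) (ℚ.<⇒≤ (<-plus (close n N ≤n ℕ.≤-refl))))))

  nonneg-antisym : ∀ {x} → Nonnegᴿ x → Nonnegᴿ (-ᴿ x) → x ≈ᴿ fromℚᴿ 0ℚ
  nonneg-antisym {x} p q = mk≈ᴿ λ ε ε>0 →
    let M , f = p _ (half-pos ε>0) ; N , g = q _ (half-pos ε>0) in
    M ℕ.⊔ N , λ n ≤n → ∣∣<-intro
      (0<-resp (solve 2 (λ a e → con ½ :* e :+ (:- a :+ con ½ :* e) := e :- (a :- con 0ℚ)) refl (seq x n) ε)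
        (0<-+ (half-pos ε>0) (g n (ℕ.m⊔n≤o⇒n≤o M N ≤n))))
      (0<-resp (solve 2 (λ a e → con ½ :* e :+ (a :+ con ½ :* e) := e :+ (a :- con 0ℚ)) refl (seq x n) ε)
        (0<-+ (half-pos ε>0) (f n (ℕ.m⊔n≤o⇒m≤o M N ≤n))))

  neg-neg : ∀ x → -ᴿ (-ᴿ x) ≈ᴿ x
  neg-neg x = pointwise λ n → solve 1 (λ a → :- :- a := a) refl (seq x n)

  nonneg-stable : ∀ {x} → ¬ ¬ Nonnegᴿ x → Nonnegᴿ x
  nonneg-stable {x} p = nonneg-resp (neg-neg x) (¬pos⇒nonneg-neg { -ᴿ x} λ pos →
    p λ q → pos⇒¬nonneg-neg { -ᴿ x} pos (nonneg-resp (≈ᴿ-sym (neg-neg x)) q))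

  sign : ∀ x → ¬ ¬ (Posᴿ x ⊎ Nonnegᴿ (-ᴿ x))
  sign x k = k (inj₂ (¬pos⇒nonneg-neg {x} (k ∘ inj₁)))

  trichotomy : ∀ x → Nonnegᴿ x → ¬ ¬ (Posᴿ x ⊎ x ≈ᴿ fromℚᴿ 0ℚ)
  trichotomy x p k = sign x λ { (inj₁ pos) → k (inj₁ pos) ; (inj₂ q) → k (inj₂ (nonneg-antisym p q)) }

  nonneg-* : ∀ {x y} → Nonnegᴿ x → Nonnegᴿ y → Nonnegᴿ (x *ᴿ y)
  nonneg-* {x} {y} p q = nonneg-stable {x *ᴿ y} λ k → trichotomy x p λ
    { (inj₂ x≈0) → k (nonneg-resp {fromℚᴿ 0ℚ} (≈ᴿ-sym (≈ᴿ-trans (*-congʳ x≈0) (zeroˡ y)))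
        (nonneg-eventually {fromℚᴿ 0ℚ} 0 λ _ _ → ℚ.≤-refl))
    ; (inj₁ x>0) → trichotomy y q λ
      { (inj₂ y≈0) → k (nonneg-resp {fromℚᴿ 0ℚ} (≈ᴿ-sym (≈ᴿ-trans (*-congˡ y≈0) (zeroʳ x)))
          (nonneg-eventually {fromℚᴿ 0ℚ} 0 λ _ _ → ℚ.≤-refl))
      ; (inj₁ y>0) → k (both x>0 y>0) } }
    where
    open ℚAlgebra ℝ-algebra using (*-congʳ; *-congˡ; zeroˡ; zeroʳ)
    weaken : ∀ {a c} → 0ℚ ℚ.< c → 0ℚ ℚ.≤ a ℚ.- c → 0ℚ ℚ.≤ a
    weaken {a} {c} 0<c h = 0≤-resp (solve 2 (λ a c → a :- c :+ c := a) refl a c) (0≤-+ h (ℚ.<⇒≤ 0<c))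
    both : Posᴿ x → Posᴿ y → Nonnegᴿ (x *ᴿ y)
    both (c , 0<c , M , f) (d , 0<d , N , g) = nonneg-eventually {x *ᴿ y} (M ℕ.⊔ N) λ n ≤n →
      0≤-* {seq x n} {seq y n} (weaken 0<c (f n (ℕ.m⊔n≤o⇒m≤o M N ≤n))) (weaken 0<d (g n (ℕ.m⊔n≤o⇒n≤o M N ≤n)))

  const-≈0 : ∀ {q} → fromℚᴿ q ≈ᴿ fromℚᴿ 0ℚ → q ≡ 0ℚ
  const-≈0 {q} e with q ℚ.≟ 0ℚ
  ... | yes q≡0 = q≡0
  ... | no  q≢0 = ⊥-elim (ℚ.<-irrefl (≡.cong ℚ.∣_∣ (ℚ.+-identityʳ q))
          (proj₂ bound _ ℕ.≤-refl))
    where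
    0<∣q∣ : 0ℚ ℚ.< ℚ.∣ q ∣
    0<∣q∣ = ℚ.≰⇒> λ h → q≢0 (ℚ.∣p∣≡0⇒p≡0 q (ℚ.≤-antisym h (ℚ.0≤∣p∣ q)))
    bound = tends-to-0 e ℚ.∣ q ∣ 0<∣q∣

  pos-inverse : ∀ {x} → Posᴿ x → ∃[ y ] x *ᴿ y ≈ᴿ fromℚᴿ 1ℚ
  pos-inverse {x} (c , 0<c , N , f) = mkℝ y y-cauchy , mk≈ᴿ λ ε ε>0 → N , λ n ≤n →
    ≡.subst (λ q → ℚ.∣ q ∣ ℚ.< ε) (≡.sym (≡.trans (≡.cong (ℚ._- 1ℚ) (xy n ≤n)) (ℚ.+-inverseʳ 1ℚ))) ε>0
    where
    y : ℕ → ℚ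
    y n = invℚ (seq x n)
    xn>0 : ∀ n → N ℕ.≤ n → 0ℚ ℚ.< seq x n
    xn>0 n ≤n = 0<-resp (solve 2 (λ a c → c :+ (a :- c) := a) refl (seq x n) c) (0<-+ 0<c (f n ≤n))
    xy : ∀ n → N ℕ.≤ n → seq x n ℚ.* y n ≡ 1ℚ
    xy n ≤n = invℚ-inverse (seq x n) (0<⇒≢ (xn>0 n ≤n))
    y-cauchy : Cauchy y
    y-cauchy ε ε>0 =
      let M , g = cauchy x (ε ℚ.* (c ℚ.* c)) (0<-* ε>0 (0<-* 0<c 0<c)) in
      M ℕ.⊔ N , λ m n ≤m ≤n → ∣∣<-intro
        (bound (seq x m) (seq x n) (y m) (y n) (f m (ℕ.m⊔n≤o⇒n≤o M N ≤m)) (f n (ℕ.m⊔n≤o⇒n≤o M N ≤n))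
          (xy m (ℕ.m⊔n≤o⇒n≤o M N ≤m)) (xy n (ℕ.m⊔n≤o⇒n≤o M N ≤n))
          (invℚ-pos (xn>0 m (ℕ.m⊔n≤o⇒n≤o M N ≤m))) (invℚ-pos (xn>0 n (ℕ.m⊔n≤o⇒n≤o M N ≤n)))
          (<-plus (g m n (ℕ.m⊔n≤o⇒m≤o M N ≤m) (ℕ.m⊔n≤o⇒m≤o M N ≤n))))
        (0<-resp (solve 3 (λ a b e → e :- (b :- a) := e :+ (a :- b)) refl (y m) (y n) ε)
        (bound (seq x n) (seq x m) (y n) (y m) (f n (ℕ.m⊔n≤o⇒n≤o M N ≤n)) (f m (ℕ.m⊔n≤o⇒n≤o M N ≤m))
          (xy n (ℕ.m⊔n≤o⇒n≤o M N ≤n)) (xy m (ℕ.m⊔n≤o⇒n≤o M N ≤m))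
          (invℚ-pos (xn>0 n (ℕ.m⊔n≤o⇒n≤o M N ≤n))) (invℚ-pos (xn>0 m (ℕ.m⊔n≤o⇒n≤o M N ≤m)))
          (<-plus (g n m (ℕ.m⊔n≤o⇒m≤o M N ≤n) (ℕ.m⊔n≤o⇒m≤o M N ≤m)))))
      where
      -- With a′ = 1/a and b′ = 1/b one has ε - (a′ - b′) = a′b′(εab + (a - b)), where εab ≥ εc².
      bound : ∀ a b a′ b′ → 0ℚ ℚ.≤ a ℚ.- c → 0ℚ ℚ.≤ b ℚ.- c → a ℚ.* a′ ≡ 1ℚ → b ℚ.* b′ ≡ 1ℚ →
        0ℚ ℚ.< a′ → 0ℚ ℚ.< b′ → 0ℚ ℚ.< ε ℚ.* (c ℚ.* c) ℚ.+ (a ℚ.- b) → 0ℚ ℚ.< ε ℚ.- (a′ ℚ.- b′)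
      bound a b a′ b′ a≥c b≥c aa′ bb′ a′>0 b′>0 h = 0<-resp identity (0<-* (0<-* a′>0 b′>0)
        (0<-+ h (0≤-* (ℚ.<⇒≤ ε>0) (0≤-+ (0≤-* a≥c b≥c) (0≤-* (ℚ.<⇒≤ 0<c) (0≤-+ a≥c b≥c))))))
        where
        open ≡.≡-Reasoning
        identity : a′ ℚ.* b′ ℚ.* (ε ℚ.* (c ℚ.* c) ℚ.+ (a ℚ.- b)
            ℚ.+ ε ℚ.* ((a ℚ.- c) ℚ.* (b ℚ.- c) ℚ.+ c ℚ.* ((a ℚ.- c) ℚ.+ (b ℚ.- c)))) ≡ ε ℚ.- (a′ ℚ.- b′)
        identity = begin
          _ ≡⟨ solve 6 (λ a b a′ b′ ε c → a′ :* b′ :* (ε :* (c :* c) :+ (a :- b)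
                 :+ ε :* ((a :- c) :* (b :- c) :+ c :* ((a :- c) :+ (b :- c))))
               := ε :* (a :* a′) :* (b :* b′) :- (a′ :* (b :* b′) :- b′ :* (a :* a′))) refl a b a′ b′ ε c ⟩
          ε ℚ.* (a ℚ.* a′) ℚ.* (b ℚ.* b′) ℚ.- (a′ ℚ.* (b ℚ.* b′) ℚ.- b′ ℚ.* (a ℚ.* a′))
            ≡⟨ ≡.cong₂ (λ p q → ε ℚ.* p ℚ.* q ℚ.- (a′ ℚ.* q ℚ.- b′ ℚ.* p)) aa′ bb′ ⟩
          ε ℚ.* 1ℚ ℚ.* 1ℚ ℚ.- (a′ ℚ.* 1ℚ ℚ.- b′ ℚ.* 1ℚ)
            ≡⟨ solve 3 (λ ε a b → ε :* con 1ℚ :* con 1ℚ :- (a :* con 1ℚ :- b :* con 1ℚ) := ε :- (a :- b)) refl ε a′ b′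
                ⟩
          ε ℚ.- (a′ ℚ.- b′) ∎

  ℝ-inverse : ∀ {x} → ¬ x ≈ᴿ fromℚᴿ 0ℚ → ¬ ¬ (∃[ y ] x *ᴿ y ≈ᴿ fromℚᴿ 1ℚ)
  ℝ-inverse {x} x≉0 k = sign x λ
    { (inj₁ pos) → k (pos-inverse pos)
    ; (inj₂ p) → sign (-ᴿ x) λ
      { (inj₂ q) → x≉0 (nonneg-antisym (nonneg-resp (neg-neg x) q) p)
      ; (inj₁ pos) → let y , e = pos-inverse { -ᴿ x} pos in k (-ᴿ y , ≈ᴿ-trans
          (pointwise λ n → solve 2 (λ a b → a :* :- b := (:- a) :* b) refl (seq x n) (seq y n)) e) } }

  natℚ : ℕ → ℚ
  natℚ = IdentityMatrix.nat ℚ-algebra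

  natℝ : ℕ → ℝ
  natℝ = IdentityMatrix.nat ℝ-algebra

  seq-nat : ∀ k n → seq (natℝ k) n ≡ natℚ k
  seq-nat zero    n = refl
  seq-nat (suc k) n = ≡.cong (1ℚ ℚ.+_) (seq-nat k n)

  private
    integral : ℕ → ℚ
    integral k = mkℚ (+ k) 0 (Coprime.sym (Coprime.1-coprimeTo k))

    integral-suc : ∀ k → 1ℚ ℚ.+ integral k ≡ integral (suc k)
    integral-suc k = ℚ.toℚᵘ-injective (ℚᵘ.≃-trans (ℚ.toℚᵘ-homo-+ 1ℚ (integral k))
      (ℚᵘ.*≡* (≡.cong (ℤ._* ℤ.1ℤ) (≡.cong (λ z → ℤ.1ℤ ℤ.+ z) (ℤ.*-identityʳ (+ k))))))

    nat≡integral : ∀ k → natℚ k ≡ integral k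
    nat≡integral zero    = refl
    nat≡integral (suc k) = ≡.trans (≡.cong (1ℚ ℚ.+_) (nat≡integral k)) (integral-suc k)

  ℚ-archimedean : ∀ q → ∃[ k ] q ℚ.≤ natℚ k
  ℚ-archimedean q@(mkℚ n d _) = ℤ.∣ n ∣ , ≡.subst (q ℚ.≤_) (≡.sym (nat≡integral ℤ.∣ n ∣)) (ℚ.*≤* (begin
    n ℤ.* ℤ.1ℤ               ≡⟨ ℤ.*-identityʳ n ⟩
    n                        ≤⟨ n≤∣n∣ n ⟩
    + ℤ.∣ n ∣                ≤⟨ ℤ.+≤+ (ℕ.m≤m*n ℤ.∣ n ∣ (suc d)) ⟩
    + (ℤ.∣ n ∣ ℕ.* suc d)    ≡⟨ ℤ.pos-* ℤ.∣ n ∣ (suc d) ⟩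
    + ℤ.∣ n ∣ ℤ.* + suc d    ∎))
    where
    open ℤ.≤-Reasoning
    n≤∣n∣ : ∀ n → n ℤ.≤ + ℤ.∣ n ∣
    n≤∣n∣ (+ n)    = ℤ.≤-refl
    n≤∣n∣ -[1+ n ] = ℤ.-≤+

  0<natℚ-suc : ∀ k → 0ℚ ℚ.< natℚ (suc k)
  0<natℚ-suc k = 0<-+ 0<1 (nonneg k)
    where
    nonneg : ∀ k → 0ℚ ℚ.≤ natℚ k
    nonneg zero    = ℚ.≤-refl
    nonneg (suc k) = 0≤-+ (ℚ.<⇒≤ 0<1) (nonneg k)

  ℚ-orderedField : OrderedField
  ℚ-orderedField = record
    { algebra     = ℚ-algebra
    ; NonNeg      = 0ℚ ℚ.≤_
    ; nn-resp     = 0≤-resp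
    ; nn-+        = 0≤-+
    ; nn-*        = 0≤-*
    ; nn-ι        = id
    ; nn-antisym  = λ {x} p q → ℚ.≤-antisym
        (0≤⇒≤ (0≤-resp (solve 1 (λ x → :- x := con 0ℚ :- x) refl x) q)) p
    ; nn-stable   = λ {x} p → stable x p
    ; nn-total    = λ x k → k (total x)
    ; 1≉0         = λ ()
    ; inverse     = λ {x} x≢0 k → k (invℚ x , invℚ-inverse x x≢0)
    ; archimedean = λ x k → let m , h = ℚ-archimedean x in k (m , ≤⇒0≤ h)
    }
    where
    stable : ∀ x → ¬ ¬ 0ℚ ℚ.≤ x → 0ℚ ℚ.≤ x
    stable x p with 0ℚ ℚ.≤? x
    ... | yes h = h
    ... | no ¬h = ⊥-elim (p ¬h)
    total : ∀ x → 0ℚ ℚ.≤ x ⊎ 0ℚ ℚ.≤ ℚ.- x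
    total x with ℚ.≤-total 0ℚ x
    ... | inj₁ h = inj₁ h
    ... | inj₂ h = inj₂ (ℚ.neg-antimono-≤ h)

  ℝ-orderedField : OrderedField
  ℝ-orderedField = record
    { algebra     = ℝ-algebra
    ; NonNeg      = Nonnegᴿ
    ; nn-resp     = nonneg-resp
    ; nn-+        = λ {x} {y} → nonneg-+ {x} {y}
    ; nn-*        = λ {x} {y} → nonneg-* {x} {y}
    ; nn-ι        = λ {q} h → nonneg-eventually {fromℚᴿ q} 0 λ _ _ → h
    ; nn-antisym  = nonneg-antisym
    ; nn-stable   = λ {x} → nonneg-stable {x}
    ; nn-total    = λ x k → sign x λ { (inj₁ p) → k (inj₁ (pos⇒nonneg {x} p)) ; (inj₂ p) → k (inj₂ p) }
    ; 1≉0         = λ e → 1≢0 (const-≈0 {1ℚ} e)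
    ; inverse     = ℝ-inverse
    ; archimedean = λ x k → let b , _ , N , h = cauchy-bounded {seq x} (cauchy x) ; m , b≤m = ℚ-archimedean b in
        k (m , nonneg-eventually {natℝ m +ᴿ (-ᴿ x)} N λ n ≤n → 0≤-resp (≡.cong (ℚ._- seq x n) (≡.sym (seq-nat m n)))
          (0≤-resp (solve 4 (λ m b a x → (m :- b) :+ (b :- a) :+ (a :- x) := m :- x) refl (natℚ m) b ℚ.∣ seq x n ∣
              (seq x n))
            (0≤-+ (0≤-+ (≤⇒0≤ b≤m) (≤⇒0≤ (h n ≤n))) (0≤∣d∣-d (seq x n)))))
    }
    where
    1≢0 : ¬ 1ℚ ≡ 0ℚ
    1≢0 ()

open RealField

-- Least upper bounds of real quadratic forms

module TopOfRealForm where
  private module R = OrderedField ℝ-orderedField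
  open OrderedField ℚ-orderedField
  open OrderedFieldProperties ℚ-orderedField
  open ≡.≡-Reasoning

  Nonzero : ∀ {n} → Vec n → Set
  Nonzero x = ¬ (∀ i → x i ≡ 0ℚ)

  -- A rational quadratic form is found either to be nonnegative everywhere or to be nonpositive at
  -- some x ≠ 0.  The alternatives overlap; completing squares decides between them.
  decide-form : ∀ {n} (P : Mat n) → PSD P ⊎ ∃[ x ] Nonzero x × NonNeg (- (x ∙ (P ·ᵥ x)))
  decide-form {zero}  P = inj₁ λ x → nn-≈0 (sum-empty _)
  decide-form {suc n} P with P zero zero ℚ.≤? 0ℚ
  ... | yes a≤0 = inj₂ (e₀ , (λ z → 1≉0 (z zero)) , 0≤-resp (≡.cong -_ (≡.sym e₀-form)) (ℚ.neg-antimono-≤ a≤0))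
    where
    e₀ : Vec (suc n)
    e₀ = 𝟙 zero
    e₀-form : e₀ ∙ (P ·ᵥ e₀) ≡ P zero zero
    e₀-form = ≡.trans (𝟙-· _ zero) (≡.trans (∙-comm (P zero) e₀) (𝟙-· (P zero) zero))
  ... | no a≰0 = extend (decide-form S)
    where
    a = P zero zero
    a′ = invℚ a
    0<a = ℚ.≰⇒> a≰0
    aa′ : a * a′ ≡ 1ℚ
    aa′ = invℚ-inverse a (0<⇒≢ 0<a)
    g : Vec n
    g i = ½ * (P zero (suc i) + P (suc i) zero)
    S = Schur P g a′
    square = complete-square P g a′ (λ i → solve 1 (λ x → con ½ :* x :+ con ½ :* x := x) ≡.refl _) aa′
    extend : PSD S ⊎ ∃[ u ] Nonzero u × NonNeg (- (u ∙ (S ·ᵥ u))) →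
             PSD P ⊎ ∃[ x ] Nonzero x × NonNeg (- (x ∙ (P ·ᵥ x)))
    extend (inj₁ psd) = inj₁ λ x → 0≤-resp (≡.sym (square x))
      (0≤-+ (0≤-* (ℚ.<⇒≤ 0<a) (sq-nn (x zero + a′ * g ∙ (x ∘ suc)))) (psd (x ∘ suc)))
    extend (inj₂ (u , u≢0 , h)) = inj₂ (x , (λ z → u≢0 (z ∘ suc)) , 0≤-resp (≡.cong -_ (≡.sym form)) h)
      where
      x : Vec (suc n)
      x = - (a′ * g ∙ u) ∷ u
      form : x ∙ (P ·ᵥ x) ≡ u ∙ (S ·ᵥ u)
      form = begin
        x ∙ (P ·ᵥ x)
          ≡⟨ square x ⟩
        a * ((- (a′ * g ∙ u) + a′ * g ∙ u) * (- (a′ * g ∙ u) + a′ * g ∙ u)) + u ∙ (S ·ᵥ u)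
          ≡⟨ solve 3 (λ a t q → a :* ((:- t :+ t) :* (:- t :+ t)) :+ q := q) ≡.refl a (a′ * g ∙ u) (u ∙ (S ·ᵥ u)) ⟩
        u ∙ (S ·ᵥ u) ∎

  norm-pos : ∀ {n} {x : Vec n} → Nonzero x → 0ℚ ℚ.< x ∙ x
  norm-pos {x = x} x≢0 = ℚ.≰⇒> λ h → x≢0 (∙-definite x (ℚ.neg-antimono-≤ h))

  seq-sum : ∀ {n} (u : R.Vec n) m → seq (R.sum u) m ≡ sum (λ i → seq (u i) m)
  seq-sum {n} u m = ≡.trans (≡.cong (λ x → seq x m) (R.sum-def u)) (≡.trans (raw u) (≡.sym (sum-def _)))
    where
    module Σᴿ = SemiringSum R.semiring
    module Σ = SemiringSum semiring
    raw : ∀ {n} (u : R.Vec n) → seq (Σᴿ.sum u) m ≡ Σ.sum (λ i → seq (u i) m)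
    raw {zero}  u = ≡.refl
    raw {suc n} u = ≡.cong (seq (u zero) m +_) (raw (u ∘ suc))

  seq-∙ : ∀ {n} (u v : R.Vec n) m → seq (u R.∙ v) m ≡ (λ i → seq (u i) m) ∙ (λ i → seq (v i) m)
  seq-∙ u v m = seq-sum _ m

  -- The m-th rational approximation of a real matrix.
  stage : ∀ {n} → R.Mat n → ℕ → Mat n
  stage H m i j = seq (H i j) m

  seq-form : ∀ {n} (H : R.Mat n) (x : R.Vec n) m → let y = λ i → seq (x i) m in
    seq (x R.∙ (H R.·ᵥ x)) m ≡ y ∙ (stage H m ·ᵥ y)
  seq-form H x m = ≡.trans (seq-∙ x _ m) (sum-cong (λ i → ≡.cong (seq (x i) m *_) (seq-∙ (H i) x m)))

  -- The grid width 1/(m+1) used at stage m.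
  step : ℕ → ℚ
  step m = invℚ (nat (suc m))

  0<step : ∀ m → 0ℚ ℚ.< step m
  0<step m = invℚ-pos (0<natℚ-suc m)

  nat*step : ∀ m → nat (suc m) * step m ≡ 1ℚ
  nat*step m = invℚ-inverse _ (0<⇒≢ (0<natℚ-suc m))

  nat-mono : ∀ {N m} → N ℕ.≤ m → 0ℚ ℚ.≤ nat m - nat N
  nat-mono {m = zero}  ℕ.z≤n = ℚ.≤-refl
  nat-mono {m = suc m} ℕ.z≤n = 0≤-resp (solve 1 (λ m → m := m :- con 0ℚ) ≡.refl (nat (suc m))) (ℚ.<⇒≤ (0<natℚ-suc m))
  nat-mono {suc N} {suc m} (ℕ.s≤s N≤m) = 0≤-resp
    (solve 2 (λ m n → m :- n := (con 1ℚ :+ m) :- (con 1ℚ :+ n)) ≡.refl (nat m) (nat N)) (nat-mono N≤m)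

  step-small : ∀ ε → 0ℚ ℚ.< ε → ∃[ N ] (∀ m → N ℕ.≤ m → 0ℚ ℚ.< ε - step m)
  step-small ε 0<ε with ℚ-archimedean (invℚ ε)
  ... | N , h = N , λ m N≤m → 0<-resp (identity m) (0<-* (0<step m)
          (0<-+ {q = ε * ((nat m - nat N) + (nat N - invℚ ε))} 0<ε
            (0≤-* (ℚ.<⇒≤ 0<ε) (0≤-+ (nat-mono N≤m) (≤⇒0≤ h)))))
    where
    identity : ∀ m → step m * (ε + ε * ((nat m - nat N) + (nat N - invℚ ε))) ≡ ε - step m
    identity m = begin
      step m * (ε + ε * ((nat m - nat N) + (nat N - invℚ ε)))
        ≡⟨ solve 5 (λ s e m n i → s :* (e :+ e :* ((m :- n) :+ (n :- i))) := e :* ((con 1ℚ :+ m) :* s) :- s :*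
            (e :* i)) ≡.refl (step m) ε (nat m) (nat N) (invℚ ε) ⟩
      ε * (nat (suc m) * step m) - step m * (ε * invℚ ε)
        ≡⟨ ≡.cong₂ (λ a b → ε * a - step m * b) (nat*step m) (invℚ-inverse ε (0<⇒≢ 0<ε)) ⟩
      ε * 1ℚ - step m * 1ℚ
        ≡⟨ solve 2 (λ e s → e :* con 1ℚ :- s :* con 1ℚ := e :- s) ≡.refl ε (step m) ⟩
      ε - step m ∎

  -- A rational q with x·Mx ≤ q x·x for all x, such that q - δ fails to be a strict bound at some vector:
  -- a rational approximation of the maximum of x·Mx / x·x from above, with error at most δ.
  record NearlyTop {n} (M : Mat n) (δ : ℚ) : Set where
    field
      q       : ℚ
      above   : ∀ x → NonNeg (q * x ∙ x - x ∙ (M ·ᵥ x))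
      vector  : Vec n
      nonzero : Nonzero vector
      below   : NonNeg (vector ∙ (M ·ᵥ vector) - (q - δ) * vector ∙ vector)

  -- Descend in steps of δ from the bound U = n²c, where c bounds the entries of M, as long as the form
  -- stays nonnegative; K steps lead to at most the corner entry of M, where the form is nonpositive at
  -- the first basis vector.
  nearly-top : ∀ {n} (M : Mat (suc n)) m → NearlyTop M (step m)
  nearly-top {n} M m = search K K-negative
    where
    δ = step m
    D = nat (suc n)
    ∣M∣ : Mat (suc n)
    ∣M∣ i j = ℚ.∣ M i j ∣
    c = sum (λ i → sum (∣M∣ i))
    entry≤c : ∀ i j → 0ℚ ℚ.≤ c - ∣M∣ i j
    entry≤c i j = 0≤-resp (solve 3 (λ c s a → (c :- s) :+ (s :- a) := c :- a) ≡.refl c _ _)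
      (0≤-+ (term≤sum _ (λ i → sum-nn _ (λ j → ℚ.0≤∣p∣ (M i j))) i) (term≤sum _ (λ j → ℚ.0≤∣p∣ (M i j)) j))
    U = D * (D * c)
    grid : ℕ → ℚ
    grid j = U - nat j * δ
    Negative : ℕ → Set
    Negative j = ∃[ x ] Nonzero x × NonNeg (- (grid j * x ∙ x - x ∙ (M ·ᵥ x)))
    Above : ℕ → Set
    Above j = ∀ x → NonNeg (grid j * x ∙ x - x ∙ (M ·ᵥ x))
    decide : ∀ j → Above j ⊎ Negative j
    decide j with decide-form (grid j ⊝ M)
    ... | inj₁ psd = inj₁ λ x → 0≤-resp (⊝-form (grid j) M x) (psd x)
    ... | inj₂ (x , x≢0 , h) = inj₂ (x , x≢0 , 0≤-resp (≡.cong -_ (⊝-form (grid j) M x)) h)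
    above₀ : Above 0
    above₀ x = 0≤-resp (≡.cong (λ u → u * x ∙ x - x ∙ (M ·ᵥ x)) (solve 2 (λ u d → u := u :- con 0ℚ :* d) ≡.refl U δ))
      (form-bound M c
        (λ i j → 0≤-resp (solve 3 (λ c a m → (c :- a) :+ (a :- m) := c :- m) ≡.refl c (∣M∣ i j) (M i j))
            (0≤-+ (entry≤c i j) (0≤∣d∣-d (M i j))))
        (λ i j → 0≤-resp (≡.trans (≡.cong (λ a → c - ∣M∣ i j + (a - - M i j)) (ℚ.∣-p∣≡∣p∣ (M i j)))
            (solve 3 (λ c a m → (c :- a) :+ (a :- :- m) := c :+ m) ≡.refl c (∣M∣ i j) (M i j)))
          (0≤-+ (entry≤c i j) (0≤∣d∣-d (- M i j)))) x)
    found : ∀ j → Above j → Negative (suc j) → NearlyTop M δ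
    found j above (x , x≢0 , h) = record
      { q = grid j ; above = above ; vector = x ; nonzero = x≢0
      ; below = 0≤-resp (solve 5 (λ u j d X y → :- ((u :- (con 1ℚ :+ j) :* d) :* X :- y) := y :- ((u :- j :* d) :- d)
          :* X)
          ≡.refl U (nat j) δ (x ∙ x) (x ∙ (M ·ᵥ x))) h }
    search : ∀ j → Negative j → NearlyTop M δ
    search zero (x , x≢0 , h) = found 0 above₀ (x , x≢0 , 0≤-resp
      (solve 4 (λ u d X y → :- ((u :- con 0ℚ :* d) :* X :- y) :+ d :* X := :-
          ((u :- (con 1ℚ :+ con 0ℚ) :* d) :* X :- y)) ≡.refl U δ (x ∙ x) (x ∙ (M ·ᵥ x)))
      (0≤-+ h (0≤-* (ℚ.<⇒≤ (0<step m)) (∙-nn x))))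
    search (suc j) neg with decide j
    ... | inj₁ above = found j above neg
    ... | inj₂ neg′  = search j neg′
    e₀ : Vec (suc n)
    e₀ = 𝟙 zero
    h₀ = M zero zero
    K = proj₁ (ℚ-archimedean ((U - h₀) * nat (suc m)))
    K-bound = ≤⇒0≤ (proj₂ (ℚ-archimedean ((U - h₀) * nat (suc m))))
    K-negative : Negative K
    K-negative = e₀ , (λ z → 1≉0 (z zero)) , 0≤-resp (begin
      (nat K - (U - h₀) * nat (suc m)) * δ
        ≡⟨ solve 5 (λ k u h n d → (k :- (u :- h) :* n) :* d := k :* d :- (u :- h) :* (n :* d)) ≡.refl (nat K) U h₀
            (nat (suc m)) δ ⟩
      nat K * δ - (U - h₀) * (nat (suc m) * δ)
        ≡⟨ ≡.cong (λ z → nat K * δ - (U - h₀) * z) (nat*step m) ⟩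
      nat K * δ - (U - h₀) * 1ℚ
        ≡⟨ solve 3 (λ k u h → k :- (u :- h) :* con 1ℚ := :- ((u :- k) :* con 1ℚ :- h)) ≡.refl (nat K * δ) U h₀ ⟩
      - (grid K * 1ℚ - h₀)
        ≡⟨ ≡.cong₂ (λ a b → - (grid K * a - b)) (𝟙-· e₀ zero) e₀-form ⟨
      - (grid K * e₀ ∙ e₀ - e₀ ∙ (M ·ᵥ e₀)) ∎) (0≤-* K-bound (ℚ.<⇒≤ (0<step m)))
      where
      e₀-form : e₀ ∙ (M ·ᵥ e₀) ≡ h₀
      e₀-form = ≡.trans (𝟙-· _ zero) (≡.trans (∙-comm (M zero) e₀) (𝟙-· (M zero) zero))

  -- Finitely many thresholds have a common one.
  uniform : ∀ {n} {P : Fin n → ℕ → Set} → (∀ i {M N} → M ℕ.≤ N → P i M → P i N) →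
    (∀ i → ∃[ N ] P i N) → ∃[ N ] (∀ i → P i N)
  uniform {zero}  mono p = 0 , λ ()
  uniform {suc n} mono p =
    let M , h = p zero ; N , hs = uniform (λ i → mono (suc i)) (p ∘ suc) in
    M ℕ.⊔ N , λ { zero → mono zero (ℕ.m≤m⊔n M N) h ; (suc i) → mono (suc i) (ℕ.m≤n⊔m M N) (hs i) }

  -- Every real quadratic form has a least upper bound on the unit sphere: the rational approximations of
  -- the bound at the stages of H form a Cauchy sequence.
  module _ {n : ℕ} (H : R.Mat (suc n)) where
    private
      D = nat (suc n)
      module T m = NearlyTop (nearly-top (stage H m) m)

      D²-pos : 0ℚ ℚ.< D * D
      D²-pos = 0<-* (0<natℚ-suc n) (0<natℚ-suc n)

      -- From some stage on, the forms at two stages differ by at most τ x·x.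
      forms-close : ∀ τ → 0ℚ ℚ.< τ → ∃[ N ] (∀ m m′ → N ℕ.≤ m → N ℕ.≤ m′ → ∀ x →
        NonNeg (τ * x ∙ x - (x ∙ (stage H m′ ·ᵥ x) - x ∙ (stage H m ·ᵥ x))))
      forms-close τ 0<τ = N , λ m m′ ≤m ≤m′ x → 0≤-resp
        (≡.cong₂ (λ a b → a * x ∙ x - b) D²η (form-difference (stage H m′) (stage H m) x))
        (form-bound (λ i j → stage H m′ i j - stage H m i j) η
          (λ i j → ℚ.<⇒≤ (<-minus (close i j m′ m ≤m′ ≤m)))
          (λ i j → ℚ.<⇒≤ (<-plus (close i j m′ m ≤m′ ≤m))) x)
        where
        η = τ * invℚ (D * D)
        0<η = 0<-* 0<τ (invℚ-pos D²-pos)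
        D²η : D * (D * η) ≡ τ
        D²η = begin
          D * (D * (τ * invℚ (D * D)))    ≡⟨ solve 3 (λ d t i → d :* (d :* (t :* i)) := t :* (d :* d :* i)) ≡.refl D τ
              (invℚ (D * D)) ⟩
          τ * (D * D * invℚ (D * D))      ≡⟨ ≡.cong (τ *_) (invℚ-inverse (D * D) (0<⇒≢ D²-pos)) ⟩
          τ * 1ℚ                          ≡⟨ ℚ.*-identityʳ τ ⟩
          τ ∎
        Close : Fin (suc n) → Fin (suc n) → ℕ → Set
        Close i j N = ∀ m m′ → N ℕ.≤ m → N ℕ.≤ m′ → ℚ.∣ seq (H i j) m - seq (H i j) m′ ∣ ℚ.< η
        close-all : ∃[ N ] (∀ i j → Close i j N)
        close-all = uniform (λ i M≤N h j m m′ ≤m ≤m′ → h j m m′ (ℕ.≤-trans M≤N ≤m) (ℕ.≤-trans M≤N ≤m′))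
          λ i → uniform (λ j M≤N h m m′ ≤m ≤m′ → h m m′ (ℕ.≤-trans M≤N ≤m) (ℕ.≤-trans M≤N ≤m′))
          λ j → cauchy (H i j) η 0<η
        N = proj₁ close-all
        close = proj₂ close-all

      q-cauchy : Cauchy T.q
      q-cauchy ε 0<ε =
        let M , small = step-small (½ * ε) (half-pos 0<ε)
            N , close = forms-close (½ * ε) (half-pos 0<ε)
            bound : ∀ m m′ → M ℕ.⊔ N ℕ.≤ m → M ℕ.⊔ N ℕ.≤ m′ → 0ℚ ℚ.< ε - (T.q m′ - T.q m)
            bound m m′ ≤m ≤m′ = cancel m m′
              (small m′ (ℕ.m⊔n≤o⇒m≤o M N ≤m′)) (close m m′ (ℕ.m⊔n≤o⇒n≤o M N ≤m) (ℕ.m⊔n≤o⇒n≤o M N ≤m′))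
        in M ℕ.⊔ N , λ m m′ ≤m ≤m′ → ∣∣<-intro (bound m′ m ≤m′ ≤m)
          (0<-resp (solve 3 (λ e a b → e :- (b :- a) := e :+ (a :- b)) ≡.refl ε (T.q m) (T.q m′)) (bound m m′ ≤m ≤m′))
        where
        cancel : ∀ m m′ → 0ℚ ℚ.< ½ * ε - step m′ →
          (∀ x → NonNeg (½ * ε * x ∙ x - (x ∙ (stage H m′ ·ᵥ x) - x ∙ (stage H m ·ᵥ x)))) →
          0ℚ ℚ.< ε - (T.q m′ - T.q m)
        cancel m m′ small close = 0<-resp (begin
          (ε - (T.q m′ - T.q m)) * X * invℚ X     ≡⟨ ℚ.*-assoc (ε - (T.q m′ - T.q m)) X (invℚ X) ⟩
          (ε - (T.q m′ - T.q m)) * (X * invℚ X)   ≡⟨ ≡.cong ((ε - (T.q m′ - T.q m)) *_) (invℚ-inverse X (0<⇒≢ 0<X)) ⟩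
          (ε - (T.q m′ - T.q m)) * 1ℚ             ≡⟨ ℚ.*-identityʳ _ ⟩
          ε - (T.q m′ - T.q m) ∎) (0<-* (0<-resp
            (solve 7 (λ e s X q q′ y y′ → (con ½ :* e :- s) :* X :+
                ((q :* X :- y) :+ ((y′ :- (q′ :- s) :* X) :+ (con ½ :* e :* X :- (y′ :- y))))
                := (e :- (q′ :- q)) :* X) ≡.refl ε (step m′) X (T.q m) (T.q m′) (x ∙ (stage H m ·ᵥ x))
                    (x ∙ (stage H m′ ·ᵥ x)))
            (0<-+ (0<-* small 0<X) (0≤-+ (T.above m x) (0≤-+ (T.below m′) (close x))))) (invℚ-pos 0<X))
          where
          x = T.vector m′
          X = x ∙ x
          0<X : 0ℚ ℚ.< X
          0<X = norm-pos (T.nonzero m′)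

      -- The limit of the rational approximations.
      μ : ℝ
      μ = mkℝ T.q q-cauchy

      deficiency : R.Vec (suc n) → ℝ
      deficiency x = μ R.* x R.∙ x R.- x R.∙ (H R.·ᵥ x)

      seq-deficiency : ∀ x m → let y = λ i → seq (x i) m in
        seq (deficiency x) m ≡ T.q m * y ∙ y - y ∙ (stage H m ·ᵥ y)
      seq-deficiency x m = ≡.cong₂ (λ a b → T.q m * a - b) (seq-∙ x x m) (seq-form H x m)

      -- At a late stage N, the rational vector that witnesses the maximum up to δ also nearly attains μ:
      -- with τ = 1/(4(k+1)), the approximations, the step and the forms each contribute at most τ x·x.
      near : ∀ k → ∃[ x ] ¬ (∀ i → x i R.≈ R.0#) × R.NonNeg (x R.∙ x R.- R.nat k R.* deficiency x)
      near k = const , (λ z → T.nonzero N (λ i → const-≈0 (z i))) ,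
        nonneg-eventually {const R.∙ const R.- R.nat k R.* deficiency const} N λ m N≤m → 0≤-resp (≡.sym (value m))
            (bound m N≤m)
        where
        ε = step k
        τ = ½ * (½ * ε)
        0<τ = half-pos (half-pos (0<step k))
        small = step-small τ 0<τ
        forms = forms-close τ 0<τ
        q-close = q-cauchy τ 0<τ
        N₁ = proj₁ small
        N₂ = proj₁ forms
        N₃ = proj₁ q-close
        N = N₁ ℕ.⊔ (N₂ ℕ.⊔ N₃)
        N₁≤N : N₁ ℕ.≤ N
        N₁≤N = ℕ.m≤m⊔n N₁ _
        N₂≤N : N₂ ℕ.≤ N
        N₂≤N = ℕ.≤-trans (ℕ.m≤m⊔n N₂ N₃) (ℕ.m≤n⊔m N₁ _)
        N₃≤N : N₃ ℕ.≤ N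
        N₃≤N = ℕ.≤-trans (ℕ.m≤n⊔m N₂ N₃) (ℕ.m≤n⊔m N₁ _)
        x = T.vector N
        X = x ∙ x
        const : R.Vec (suc n)
        const i = fromℚᴿ (x i)
        form : ℕ → ℚ
        form m = x ∙ (stage H m ·ᵥ x)
        value : ∀ m → seq (const R.∙ const R.- R.nat k R.* deficiency const) m ≡ X - nat k * (T.q m * X - form m)
        value m = ≡.cong₂ (λ a b → a - b) (seq-∙ const const m) (≡.cong₂ _*_ (seq-nat k m) (seq-deficiency const m))
        split : X ≡ (1ℚ + nat k) * (τ + τ + τ + τ) * X
        split = begin
          X                                     ≡⟨ ℚ.*-identityˡ X ⟨
          1ℚ * X                                ≡⟨ ≡.cong (_* X) (nat*step k) ⟨
          nat (suc k) * ε * X                   ≡⟨ solve 3 (λ n e X → n :* e :* X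
              := n :* (con ½ :* (con ½ :* e) :+ con ½ :* (con ½ :* e) :+ con ½ :* (con ½ :* e) :+ con ½ :*
                  (con ½ :* e)) :* X) ≡.refl (nat (suc k)) ε X ⟩
          (1ℚ + nat k) * (τ + τ + τ + τ) * X ∎
        nat-nn : ∀ k → NonNeg (nat k)
        nat-nn zero    = ℚ.≤-refl
        nat-nn (suc k) = ℚ.<⇒≤ (0<natℚ-suc k)
        bound : ∀ m → N ℕ.≤ m → NonNeg (X - nat k * (T.q m * X - form m))
        bound m N≤m = 0≤-resp (begin
          nat k * ((τ - (T.q m - T.q N)) * X + ((τ - step N) * X + (T-below + (τ * X - (form N - form m)))))
              + (nat k * (τ * X) + (τ + τ + τ + τ) * X)
            ≡⟨ solve 8 (λ k t q q′ X s y y′ →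
                 k :* ((t :- (q :- q′)) :* X :+ ((t :- s) :* X :+ ((y′ :- (q′ :- s) :* X) :+ (t :* X :- (y′ :- y)))))
                     :+ (k :* (t :* X) :+ (t :+ t :+ t :+ t) :* X)
                 := (con 1ℚ :+ k) :* (t :+ t :+ t :+ t) :* X :- k :* (q :* X :- y)) ≡.refl (nat k) τ (T.q m) (T.q N) X
                     (step N) (form m) (form N) ⟩
          (1ℚ + nat k) * (τ + τ + τ + τ) * X - nat k * (T.q m * X - form m)
            ≡⟨ ≡.cong (_- nat k * (T.q m * X - form m)) split ⟨
          X - nat k * (T.q m * X - form m) ∎)
          (0≤-+ (0≤-* (nat-nn k) (0≤-+ (0≤-* (ℚ.<⇒≤ (<-minus (proj₂ q-close m N (ℕ.≤-trans N₃≤N N≤m) N₃≤N))) (∙-nn x))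
              (0≤-+ (0≤-* (ℚ.<⇒≤ (proj₂ small N N₁≤N)) (∙-nn x))
                (0≤-+ (T.below N) (proj₂ forms m N (ℕ.≤-trans N₂≤N N≤m) N₂≤N x)))))
            (0≤-+ (0≤-* (nat-nn k) (0≤-* (ℚ.<⇒≤ 0<τ) (∙-nn x)))
              (0≤-* (0≤-+ (0≤-+ (0≤-+ τ≥0 τ≥0) τ≥0) τ≥0) (∙-nn x))))
          where
          τ≥0 = ℚ.<⇒≤ 0<τ
          T-below = form N - (T.q N - step N) * X

    least-upper-bound : ∃[ μ ] Rayleigh.Top ℝ-orderedField H μ ×
      (∀ k → ∃[ x ] ¬ (∀ i → x i R.≈ R.0#) × R.NonNeg (x R.∙ x R.- R.nat k R.* (μ R.* x R.∙ x R.- x R.∙ (H R.·ᵥ x))))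
    least-upper-bound = μ , (λ x → nonneg-eventually {deficiency x} 0 λ m _ → 0≤-resp (≡.sym (seq-deficiency x m))
        (T.above m (λ i → seq (x i) m))) , near

  ℝ-near-top : Rayleigh.NearTop ℝ-orderedField
  ℝ-near-top = least-upper-bound

open TopOfRealForm using (ℝ-near-top)

module ComplexNumbers where
  open Defs using (ℂ; re; im; _+i_; re-≈; im-≈; mk≈; _≈_; _+_; _*_; -_; 0#; 1#; sum; _⊗_; module IsCoherentAlgebra)
  open ThreeEigenvalues ℝ-orderedField ℝ-near-top
  open ℚ-linear using (solve; _:+_; _:*_; _:-_; :-_; _:=_; con)

  private module R = OrderedField ℝ-orderedField

  -- Complex matrices

  ℂ-commutativeRing : CommutativeRing 0ℓ 0ℓ
  ℂ-commutativeRing = record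
    { Carrier = ℂ
    ; _≈_     = _≈_
    ; _+_     = _+_
    ; _*_     = _*_
    ; -_      = -_
    ; 0#      = 0#
    ; 1#      = 1#
    ; isCommutativeRing = record
      { isRing = record
        { +-isAbelianGroup = record
          { isGroup = record
            { isMonoid = record
              { isSemigroup = record
                { isMagma = record
                  { isEquivalence = record
                    { refl  = mk≈ R.refl R.refl
                    ; sym   = λ p → mk≈ (R.sym (re-≈ p)) (R.sym (im-≈ p))
                    ; trans = λ p q → mk≈ (R.trans (re-≈ p) (re-≈ q)) (R.trans (im-≈ p) (im-≈ q))
                    }
                  ; ∙-cong = λ p q → mk≈ (R.+-cong (re-≈ p) (re-≈ q)) (R.+-cong (im-≈ p) (im-≈ q))
                  }
                ; assoc = λ x y z → mk≈ (R.+-assoc _ _ _) (R.+-assoc _ _ _)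
                }
              ; identity = (λ x → mk≈ (R.+-identityˡ _) (R.+-identityˡ _)) ,
                  (λ x → mk≈ (R.+-identityʳ _) (R.+-identityʳ _))
              }
            ; inverse = (λ x → mk≈ (R.-‿inverseˡ _) (R.-‿inverseˡ _)) , (λ x → mk≈ (R.-‿inverseʳ _) (R.-‿inverseʳ _))
            ; ⁻¹-cong = λ p → mk≈ (R.-‿cong (re-≈ p)) (R.-‿cong (im-≈ p))
            }
          ; comm = λ x y → mk≈ (R.+-comm _ _) (R.+-comm _ _)
          }
        ; *-cong = λ p q → mk≈
            (R.+-cong (R.*-cong (re-≈ p) (re-≈ q)) (R.-‿cong (R.*-cong (im-≈ p) (im-≈ q))))
            (R.+-cong (R.*-cong (re-≈ p) (im-≈ q)) (R.*-cong (im-≈ p) (re-≈ q)))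
        ; *-assoc = λ x y z → mk≈
            (pointwise λ n → solve 6 (λ a b c d e f → (a :* c :- b :* d) :* e :- (a :* d :+ b :* c) :* f
               := a :* (c :* e :- d :* f) :- b :* (c :* f :+ d :* e)) ≡.refl
               (seq (re x) n) (seq (im x) n) (seq (re y) n) (seq (im y) n) (seq (re z) n) (seq (im z) n))
            (pointwise λ n → solve 6 (λ a b c d e f → (a :* c :- b :* d) :* f :+ (a :* d :+ b :* c) :* e
               := a :* (c :* f :+ d :* e) :+ b :* (c :* e :- d :* f)) ≡.refl
               (seq (re x) n) (seq (im x) n) (seq (re y) n) (seq (im y) n) (seq (re z) n) (seq (im z) n))
        ; *-identity =
            (λ x → mk≈ (pointwise λ n → solve 2 (λ a b → con 1ℚ :* a :- con 0ℚ :* b := a) ≡.refl (seq (re x) n)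
                (seq (im x) n))
                       (pointwise λ n → solve 2 (λ a b → con 1ℚ :* b :+ con 0ℚ :* a := b) ≡.refl (seq (re x) n)
                           (seq (im x) n)))
          , (λ x → mk≈ (pointwise λ n → solve 2 (λ a b → a :* con 1ℚ :- b :* con 0ℚ := a) ≡.refl (seq (re x) n)
              (seq (im x) n))
                       (pointwise λ n → solve 2 (λ a b → a :* con 0ℚ :+ b :* con 1ℚ := b) ≡.refl (seq (re x) n)
                           (seq (im x) n)))
        ; distrib =
            (λ x y z → mk≈
              (pointwise λ n → solve 6 (λ a b c d e f → a :* (c :+ e) :- b :* (d :+ f) := (a :* c :- b :* d) :+
                  (a :* e :- b :* f)) ≡.refl
                (seq (re x) n) (seq (im x) n) (seq (re y) n) (seq (im y) n) (seq (re z) n) (seq (im z) n))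
              (pointwise λ n → solve 6 (λ a b c d e f → a :* (d :+ f) :+ b :* (c :+ e) := (a :* d :+ b :* c) :+
                  (a :* f :+ b :* e)) ≡.refl
                (seq (re x) n) (seq (im x) n) (seq (re y) n) (seq (im y) n) (seq (re z) n) (seq (im z) n)))
          , (λ x y z → mk≈
              (pointwise λ n → solve 6 (λ a b c d e f → (c :+ e) :* a :- (d :+ f) :* b := (c :* a :- d :* b) :+
                  (e :* a :- f :* b)) ≡.refl
                (seq (re x) n) (seq (im x) n) (seq (re y) n) (seq (im y) n) (seq (re z) n) (seq (im z) n))
              (pointwise λ n → solve 6 (λ a b c d e f → (c :+ e) :* b :+ (d :+ f) :* a := (c :* b :+ d :* a) :+
                  (e :* b :+ f :* a)) ≡.refl
                (seq (re x) n) (seq (im x) n) (seq (re y) n) (seq (im y) n) (seq (re z) n) (seq (im z) n)))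
        }
      ; *-comm = λ x y → mk≈
          (pointwise λ n → solve 4 (λ a b c d → a :* c :- b :* d := c :* a :- d :* b) ≡.refl (seq (re x) n)
              (seq (im x) n) (seq (re y) n) (seq (im y) n))
          (pointwise λ n → solve 4 (λ a b c d → a :* d :+ b :* c := c :* b :+ d :* a) ≡.refl (seq (re x) n)
              (seq (im x) n) (seq (re y) n) (seq (im y) n))
      }
    }

  0ᴿ : ℝ
  0ᴿ = fromℚᴿ 0ℚ

  -- The embedding of ℝ into ℂ
  ↑ : ℝ → ℂ
  ↑ x = x +i 0ᴿ

  ↑-cong : ∀ {x y} → x ≈ᴿ y → ↑ x ≈ ↑ y
  ↑-cong p = mk≈ p R.refl

  ↑-+ : ∀ x y → ↑ (x +ᴿ y) ≈ ↑ x + ↑ y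
  ↑-+ x y = mk≈ R.refl (R.sym (R.+-identityˡ 0ᴿ))

  ↑-* : ∀ x y → ↑ (x *ᴿ y) ≈ ↑ x * ↑ y
  ↑-* x y = mk≈ (pointwise λ n → solve 2 (λ a b → a :* b := a :* b :- con 0ℚ :* con 0ℚ) ≡.refl (seq x n) (seq y n))
    (pointwise λ n → solve 2 (λ a b → con 0ℚ := a :* con 0ℚ :+ con 0ℚ :* b) ≡.refl (seq x n) (seq y n))

  ↑-neg : ∀ x → ↑ (-ᴿ x) ≈ - ↑ x
  ↑-neg x = mk≈ R.refl (pointwise λ n → ≡.refl)

  ℂ-algebra : ℚAlgebra
  ℂ-algebra = record
    { commutativeRing = ℂ-commutativeRing
    ; ι     = ↑ ∘ fromℚᴿ
    ; ι-+   = λ p q → K.trans (↑-cong (R.ι-+ p q)) (↑-+ _ _)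
    ; ι-*   = λ p q → K.trans (↑-cong (R.ι-* p q)) (↑-* _ _)
    ; ι-neg = λ p → K.trans (↑-cong (R.ι-neg p)) (↑-neg _)
    ; ι-0   = K.refl
    ; ι-1   = K.refl
    }
    where module K = CommutativeRing ℂ-commutativeRing

  module C where
    open ℚAlgebra ℂ-algebra public
    open LinearAlgebra ℂ-algebra public
    open IdentityMatrix ℂ-algebra public

  ↑-sum : ∀ {n} (u : R.Vec n) → ↑ (R.sum u) ≈ C.sum (λ i → ↑ (u i))
  ↑-sum {zero}  u = C.trans (↑-cong (R.sum-empty u)) (C.sym (C.sum-empty _))
  ↑-sum {suc n} u = C.trans (↑-cong (R.sum-suc u)) (C.trans (↑-+ _ _)
    (C.trans (C.+-congˡ (↑-sum (u ∘ suc))) (C.sym (C.sum-suc _))))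

  ↑-∙ : ∀ {n} (u v : R.Vec n) → ↑ (u R.∙ v) ≈ (λ i → ↑ (u i)) C.∙ (λ i → ↑ (v i))
  ↑-∙ u v = C.trans (↑-sum _) (C.sum-cong (λ i → ↑-* (u i) (v i)))

  sum≈ : ∀ {n} (u : Fin n → ℂ) → sum u ≈ C.sum u
  sum≈ u = C.reflexive (≡.sym (C.sum-def u))

  module _ {n : ℕ} (Γ : Graph n) where
    open Graph Γ
    open Adjacency ℝ-algebra Γ

    ↑-Adj : ∀ i j → ↑ (Adj i j) ≈ adjacencyMatrix Γ i j
    ↑-Adj i j with i ~? j
    ... | yes _ = C.refl
    ... | no _  = C.refl

    module S = Spectral ℝ-orderedField ℝ-near-top

    real-eigenvalue : ∀ {μ v} → S.Eigen Adj μ v → IsEigenvalue (adjacencyMatrix Γ) (↑ μ)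
    real-eigenvalue {μ} {v} e = record
      { vector  = λ i → ↑ (v i)
      ; nonzero = λ z → nonzero (λ i → re-≈ (z i))
      ; eigen   = λ i → begin
          sum (λ j → adjacencyMatrix Γ i j * ↑ (v j))     ≈⟨ sum≈ _ ⟩
          (adjacencyMatrix Γ i) C.∙ (λ j → ↑ (v j))       ≈⟨ C.∙-cong (↑-Adj i) (λ _ → C.refl) ⟨
          (λ j → ↑ (Adj i j)) C.∙ (λ j → ↑ (v j))         ≈⟨ ↑-∙ (Adj i) v ⟨
          ↑ (Adj i R.∙ v)                                 ≈⟨ ↑-cong (eigen i) ⟩
          ↑ (μ *ᴿ v i)                                    ≈⟨ ↑-* μ (v i) ⟩
          ↑ μ * ↑ (v i) ∎
      }
      where
      open S.Eigen e
      open SetoidReasoning C.setoid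

  -- Every real eigenvalue of A is the real part of one of the three complex eigenvalues, which is all that
  -- is needed of them.
  three-eigenvalues : ∀ {n} (Γ : Graph (suc n)) → 𝒢₃ Γ →
    ¬ ¬ QuadraticRank.QuadraticallyRankOne ℝ-orderedField (Adjacency.Adj ℝ-algebra Γ)
  three-eigenvalues Γ Γ∈𝒢₃ = three-eigenvalues⇒rank-one Adj Adj-sym Adj-nn
    (λ i j → Star.map (λ i~j z → R.1≉0 (R.trans (R.sym (Adj-edge i~j)) z)) (connected i j))
    (λ a → re (θ a))
    (λ e → let a , p = exhaustive (real-eigenvalue Γ e) in a , re-≈ p)
    where
    open 𝒢₃ Γ∈𝒢₃
    open HasDistinctEigenvalues threeEigenvalues
    open Graph Γ
    open Adjacency ℝ-algebra Γ
    Adj-nn : ∀ i j → Nonnegᴿ (Adj i j)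
    Adj-nn i j with i ~? j
    ... | yes _ = OrderedFieldProperties.nn-1 ℝ-orderedField
    ... | no _  = OrderedFieldProperties.nn-0 ℝ-orderedField

  -- Colours

  -- The 0/1 matrices of a standard basis partition the pairs of points; the colour of a pair is the index
  -- of the basis matrix with entry 1 there.
  module Colours {n r : ℕ} {𝒜 : Matrix n → Set} (isCoherent : IsCoherentAlgebra 𝒜) (basis : StandardBasis 𝒜 r) where
    open StandardBasis basis
    open IsCoherentAlgebra isCoherent
    open OrderedFieldProperties ℝ-orderedField using (nn-0; nn-1; nn-≈0; sum-nn≈0)

    χ : Bool → ℝ
    χ true  = R.1#
    χ false = R.0#

    χ-nn : ∀ b → Nonnegᴿ (χ b)
    χ-nn true  = nn-1
    χ-nn false = nn-0

    entry : ∀ k i j → ∃[ b ] B k i j ≈ ↑ (χ b)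
    entry k i j with zero-one k i j
    ... | inj₁ p = false , p
    ... | inj₂ p = true , p

    bit : Fin r → Fin n → Fin n → Bool
    bit k i j = proj₁ (entry k i j)

    B≈ : ∀ k i j → B k i j ≈ ↑ (χ (bit k i j))
    B≈ k i j = proj₂ (entry k i j)

    sum-bits : ∀ i j → R.sum (λ k → χ (bit k i j)) ≈ᴿ R.1#
    sum-bits i j = re-≈ (C.trans (↑-sum _)
        (C.trans (C.sum-cong (λ k → C.sym (B≈ k i j))) (C.trans (C.sym (sum≈ _)) (sum-ones i j))))

    true≢false : ∀ {b} → b ≡ true → b ≡ false → ⊥
    true≢false ≡.refl ()

    not-true : ∀ {b} → ¬ b ≡ true → b ≡ false
    not-true {true}  p = ⊥-elim (p ≡.refl)
    not-true {false} p = ≡.refl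

    opaque
      colour-of : ∀ i j → ∃[ k ] bit k i j ≡ true
      colour-of i j with Fin.any? (λ k → bit k i j Bool.≟ true)
      ... | yes p = p
      ... | no ¬p = ⊥-elim (R.1≉0 (R.trans (R.sym (sum-bits i j))
              (R.sum-zero _ (λ k → R.reflexive (≡.cong χ (not-true (λ e → ¬p (k , e))))))))

    colour : Fin n → Fin n → Fin r
    colour i j = proj₁ (colour-of i j)

    colour-bit : ∀ i j → bit (colour i j) i j ≡ true
    colour-bit i j = proj₂ (colour-of i j)

    -- If two basis matrices had entry 1 at (i , j), the remaining entries there would have sum 1 - 1 = 0
    -- after removing one of the two, against the other one.
    bit⇒colour : ∀ {k i j} → bit k i j ≡ true → colour i j ≡ k
    bit⇒colour {k} {i} {j} e with colour i j Fin.≟ k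
    ... | yes p = p
    ... | no ¬p = ⊥-elim (R.1≉0 (R.trans (R.sym (R.reflexive (≡.cong χ (colour-bit i j)))) excess))
      where
      open OrderedFieldProperties ℝ-orderedField using (≈-stable)
      others : R.Vec r
      others l = χ (bit l i j) R.- R.𝟙 k l
      others-nn : ∀ l → Nonnegᴿ (others l)
      others-nn l with k Fin.≟ l
      ... | yes ≡.refl = nn-≈0 (R.trans (R.+-congʳ (R.reflexive (≡.cong χ e))) (R.-‿inverseʳ R.1#))
      ... | no _ = nonneg-resp {χ (bit l i j)} {χ (bit l i j) R.- R.0#}
          (R.sym (R.trans (R.+-congˡ (R.-0≈0 R.refl)) (R.+-identityʳ _))) (χ-nn (bit l i j))
      sum-𝟙 : R.sum (R.𝟙 k) R.≈ R.1#
      sum-𝟙 = R.trans (R.sum-cong (λ l → R.sym (R.*-identityʳ (R.𝟙 k l)))) (R.𝟙-· (λ _ → R.1#) k)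
      -sum≈0 : R.- R.sum others R.≈ R.0#
      -sum≈0 = R.-0≈0 (R.trans (R.sum-+ _ _)
        (R.trans (R.+-cong (sum-bits i j) (R.trans (R.sum-neg _) (R.-‿cong sum-𝟙))) (R.-‿inverseʳ R.1#)))
      𝟙≈0 : R.𝟙 k (colour i j) R.≈ R.0#
      𝟙≈0 with k Fin.≟ colour i j
      ... | yes q = ⊥-elim (¬p (≡.sym q))
      ... | no _ = R.refl
      excess : χ (bit (colour i j) i j) R.≈ R.0#
      excess = R.trans (R.sym (R.trans (R.+-congˡ (R.-0≈0 𝟙≈0)) (R.+-identityʳ _)))
        (sum-nn≈0 others others-nn (nn-≈0 -sum≈0) (colour i j))

    bit-colour : ∀ {i j i′ j′} → colour i j ≡ colour i′ j′ → ∀ k → bit k i j ≡ bit k i′ j′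
    bit-colour {i} {j} {i′} {j′} e k with bit k i j in p | bit k i′ j′ in q
    ... | true  | true  = ≡.refl
    ... | false | false = ≡.refl
    ... | true  | false = ⊥-elim (true≢false (≡.subst (λ k → bit k i′ j′ ≡ true) (≡.trans (≡.sym e) (bit⇒colour p))
        (colour-bit i′ j′)) q)
    ... | false | true  = ⊥-elim (true≢false (≡.subst (λ k → bit k i j ≡ true) (≡.trans e (bit⇒colour q))
        (colour-bit i j)) p)

    -- Members of the algebra are constant on colours.
    constant : ∀ {M} → 𝒜 M → ∀ {i j i′ j′} → colour i j ≡ colour i′ j′ → M i j ≈ M i′ j′
    constant {M} M∈ {i} {j} {i′} {j′} e = let c , M≋ = spanning M∈ in C.trans (M≋ i j) (C.trans (C.trans (sum≈ _)
      (C.trans (C.sum-cong (λ k → C.*-congˡ (C.trans (B≈ k i j)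
        (C.trans (C.reflexive (≡.cong (↑ ∘ χ) (bit-colour e k))) (C.sym (B≈ k i′ j′)))))) (C.sym (sum≈ _))))
            (C.sym (M≋ i′ j′)))

    attained : ∀ k → ∃[ i ] ∃[ j ] colour i j ≡ k
    attained k with Fin.any? (λ i → Fin.any? (λ j → colour i j Fin.≟ k))
    ... | yes p = p
    ... | no ¬p = ⊥-elim (R.1≉0 (re-≈
        (C.trans (C.sym (C.𝟙-diag k)) (independent (C.𝟙 k)
            (λ i j → C.trans (sum≈ _) (C.trans (C.𝟙-· (λ l → B l i j) k)
            (C.trans (B≈ k i j) (C.reflexive (≡.cong (↑ ∘ χ) (not-true (λ e → ¬p (i , j , bit⇒colour e)))))))) k))))

    one≉zero : ¬ 1# ≈ 0#
    one≉zero e = R.1≉0 (re-≈ e)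

    bit-true : ∀ {b} → ↑ (χ b) ≈ 1# → b ≡ true
    bit-true {true}  _ = ≡.refl
    bit-true {false} p = ⊥-elim (one≉zero (C.sym p))

    colour-diagonal : ∀ {i j k} → colour i j ≡ colour k k → i ≡ j
    colour-diagonal {i} {j} {k} e with i Fin.≟ j in p
    ... | yes q = q
    ... | no _  = ⊥-elim (one≉zero (C.trans (C.sym (C.𝟙-diag k)) (C.trans (C.sym (constant 𝐈-mem e))
            (C.reflexive (≡.cong (λ d → if does d then 1# else 0#) p)))))

    colour-transpose : ∀ {i j i′ j′} → colour i j ≡ colour i′ j′ → colour j i ≡ colour j′ i′
    colour-transpose {i} {j} {i′} {j′} e = ≡.sym (bit⇒colour (bit-true (C.trans (C.sym (B≈ k j′ i′))
      (C.trans (C.sym (constant (ᵀ-closed (member k)) e))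
          (C.trans (B≈ k j i) (C.reflexive (≡.cong (↑ ∘ χ) (colour-bit j i))))))))
      where
      k = colour j i

    -- Whether two points are joined by a two-step path with given colours depends only on the colour of
    -- the pair, because this colour determines the number of such paths.
    colour-path : ∀ {i j i′ j′} → colour i j ≡ colour i′ j′ → ∀ m →
      ∃[ m′ ] colour i′ m′ ≡ colour i m × colour m′ j′ ≡ colour m j
    colour-path {i} {j} {i′} {j′} e m with Fin.any? (λ m′ → both m′)
      where
      both : ∀ m′ → Dec (colour i′ m′ ≡ colour i m × colour m′ j′ ≡ colour m j)
      both m′ = (colour i′ m′ Fin.≟ colour i m) ×-dec (colour m′ j′ Fin.≟ colour m j)
    ... | yes p = p
    ... | no ¬p = ⊥-elim (R.1≉0 (R.trans
        (R.sym (R.trans (R.*-cong (bit-one (colour-bit i m)) (bit-one (colour-bit m j))) (R.*-identityˡ R.1#)))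
            (sum-nn≈0 (λ m → χ (bit k i m) *ᴿ χ (bit l m j)) (λ m → nonneg-* {χ (bit k i m)} {χ (bit l m j)}
                (χ-nn (bit k i m)) (χ-nn (bit l m j))) (nn-≈0 (R.-0≈0 total)) m)))
      where
      k = colour i m
      l = colour m j
      bit-one : ∀ {b} → b ≡ true → χ b R.≈ R.1#
      bit-one e = R.reflexive (≡.cong χ e)
      paths : ∀ i j → (B k ⊗ B l) i j ≈ ↑ (R.sum (λ m → χ (bit k i m) *ᴿ χ (bit l m j)))
      paths i j = C.trans (sum≈ _) (C.trans
          (C.sum-cong (λ m → C.trans (C.*-cong (B≈ k i m) (B≈ l m j)) (C.sym (↑-* _ _)))) (C.sym (↑-sum _)))
      none : ∀ m′ → χ (bit k i′ m′) *ᴿ χ (bit l m′ j′) R.≈ R.0#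
      none m′ with bit k i′ m′ in p | bit l m′ j′ in q
      ... | true  | true  = ⊥-elim (¬p (m′ , bit⇒colour p , bit⇒colour q))
      ... | true  | false = R.zeroʳ _
      ... | false | b     = R.zeroˡ _
      total : R.sum (λ m → χ (bit k i m) *ᴿ χ (bit l m j)) R.≈ R.0#
      total = re-≈ (C.trans (C.sym (paths i j)) (C.trans (constant (⊗-closed (member k) (member l)) e)
          (C.trans (paths i′ j′) (↑-cong (R.sum-zero _ none)))))

    -- The colour of a pair determines the fibres of its two points, the fibre of a point i being
    -- represented by the colour of (i , i).
    colour-source : ∀ {i j i′ j′} → colour i j ≡ colour i′ j′ → colour i i ≡ colour i′ i′
    colour-source {i} {j} {i′} {j′} e with colour-path e i
    ... | m′ , p , _ = ≡.sym (≡.subst (λ m → colour i′ m ≡ colour i i) (≡.sym (colour-diagonal p)) p)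

    colour-target : ∀ {i j i′ j′} → colour i j ≡ colour i′ j′ → colour j j ≡ colour j′ j′
    colour-target e = colour-source (colour-transpose e)

open ComplexNumbers

module RankSeven where
  open Defs using (ℂ; re-≈; _≈_; _+_; _*_; 0#; 1#; _⊗_)
  open ≡ using (refl)
  private module R = OrderedField ℝ-orderedField

  -- Coherent rank seven

  no-injection : ∀ {m} {f : Fin (suc m) → Fin m} → ¬ Injective _≡_ _≡_ f
  no-injection {m} inj = ℕ.<-irrefl refl (Fin.injective⇒≤ inj)

  -- The numbering of triples of bits by Fin 8
  decode : Fin 8 → Bool × Bool × Bool
  decode 0F = true  , true  , true
  decode 1F = true  , true  , false
  decode 2F = true  , false , true
  decode 3F = true  , false , false
  decode 4F = false , true  , true
  decode 5F = false , true  , false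
  decode 6F = false , false , true
  decode 7F = false , false , false

  encode : Bool → Bool → Bool → Fin 8
  encode true  true  true  = 0F
  encode true  true  false = 1F
  encode true  false true  = 2F
  encode true  false false = 3F
  encode false true  true  = 4F
  encode false true  false = 5F
  encode false false true  = 6F
  encode false false false = 7F

  encode-decode : ∀ l → encode (proj₁ (decode l)) (proj₁ (proj₂ (decode l))) (proj₂ (proj₂ (decode l))) ≡ l
  encode-decode 0F = refl
  encode-decode 1F = refl
  encode-decode 2F = refl
  encode-decode 3F = refl
  encode-decode 4F = refl
  encode-decode 5F = refl
  encode-decode 6F = refl
  encode-decode 7F = refl

  decode-injective : ∀ {l l′} → decode l ≡ decode l′ → l ≡ l′
  decode-injective {l} {l′} e = ≡.trans (≡.sym (encode-decode l)) (≡.trans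
    (≡.cong (λ d → encode (proj₁ d) (proj₁ (proj₂ d)) (proj₂ (proj₂ d))) e) (encode-decode l′))

  -- The label of a pair of vertices in two parts consists of the part of the first vertex and the
  -- relation to the second.
  label-number : Bool → Kind → Fin 8
  label-number b eq    = encode b true true
  label-number b adj   = encode b true false
  label-number b non   = encode b false true
  label-number b cross = encode b false false

  label-of : Fin 8 → Bool × Kind
  label-of 0F = true , eq
  label-of 1F = true , adj
  label-of 2F = true , non
  label-of 3F = true , cross
  label-of 4F = false , eq
  label-of 5F = false , adj
  label-of 6F = false , non
  label-of 7F = false , cross

  label-of-number : ∀ b κ → label-of (label-number b κ) ≡ (b , κ)
  label-of-number true  eq    = refl
  label-of-number true  adj   = refl
  label-of-number true  non   = refl
  label-of-number true  cross = refl
  label-of-number false eq    = refl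
  label-of-number false adj   = refl
  label-of-number false non   = refl
  label-of-number false cross = refl

  number-of-label : ∀ l → uncurry label-number (label-of l) ≡ l
  number-of-label 0F = refl
  number-of-label 1F = refl
  number-of-label 2F = refl
  number-of-label 3F = refl
  number-of-label 4F = refl
  number-of-label 5F = refl
  number-of-label 6F = refl
  number-of-label 7F = refl

  -- A graph of coherent rank 7 whose adjacency matrix A makes some A² - sA + p𝟙 of rank at most one
  module Rank7 {n : ℕ} (Γ : Graph n) (basis : HasCoherentRank Γ 7)
    (rank-one : QuadraticRank.QuadraticallyRankOne ℝ-orderedField (Adjacency.Adj ℝ-algebra Γ)) where
    open Graph Γ
    open Colours (closure-isCoherentAlgebra (adjacencyMatrix Γ)) basis
    open Adjacency ℝ-algebra Γ
    open QuadraticRank.QuadraticallyRankOne rank-one using (s; p)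

    A² : R.Mat n
    A² i j = Adj i R.∙ (λ m → Adj m j)

    colour-adjacent : ∀ {i j i′ j′} → colour i j ≡ colour i′ j′ → i ~ j → i′ ~ j′
    colour-adjacent {i} {j} {i′} {j′} e i~j with i′ ~? j′
    ... | yes q = q
    ... | no ¬q = ⊥-elim (R.1≉0 (R.trans (R.sym (Adj-edge i~j)) (R.trans (re-≈ (C.trans (↑-Adj Γ i j)
            (C.trans (constant gen e) (C.sym (↑-Adj Γ i′ j′))))) (Adj-nonedge ¬q))))

    colour-degree : ∀ {i j} → colour i i ≡ colour j j → A² i i R.≈ A² j j
    colour-degree {i} {j} e = re-≈ (C.trans (square i i) (C.trans (constant (mult gen gen) e) (C.sym (square j j))))
      where
      square : ∀ i j → ↑ (A² i j) ≈ (adjacencyMatrix Γ ⊗ adjacencyMatrix Γ) i j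
      square i j = C.trans (↑-∙ (Adj i) (λ m → Adj m j)) (C.trans (C.∙-cong (↑-Adj Γ i) (λ m → ↑-Adj Γ m j))
          (C.sym (sum≈ _)))

    -- Matrices depending only on labels form a coherent algebra containing the adjacency matrix.  It
    -- contains the coherent closure, so the label of a pair determines its colour.  The vertices ρ b
    -- represent the parts that are not empty.
    module Labels (φ : Fin n → Bool) (join : ∀ i j → ¬ φ i ≡ φ j → i ~ j)
      (same-degree : ∀ {i j} → φ i ≡ φ j → A² i i R.≈ A² j j)
      (ρ : Bool → Fin n) (φ-ρ : ∀ i → φ (ρ (φ i)) ≡ φ i) where
      open Partition Γ φ public
      private
        module J = Join ℝ-orderedField Γ φ join
        module E = J.Equations rank-one same-degree
        module Rᵢ = Indicators ℝ-algebra
        module Cᵢ = Indicators ℂ-algebra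

      LabelMatrix : Matrix n → Set
      LabelMatrix M = Σ[ F ∈ (Bool → Kind → ℂ) ] (∀ i j → M i j ≈ F (φ i) (kind i j))

      private
        ↑-δ : ∀ κ → ↑ (Rᵢ.δ adj κ) ≈ Cᵢ.δ adj κ
        ↑-δ eq    = C.refl
        ↑-δ adj   = C.refl
        ↑-δ non   = C.refl
        ↑-δ cross = C.refl

        k : Bool → ℝ
        k f = J.k (ρ f)

        t : Bool → Kind → ℝ
        t f κ = (k f R.+ p) R.* (Rᵢ.δ eq κ R.+ (Rᵢ.δ adj κ R.+ Rᵢ.δ non κ)) R.+ (s R.* Rᵢ.δ adj κ R.- p R.* Rᵢ.δ eq κ)

        k≈ : ∀ i → J.k i R.≈ k (φ i)
        k≈ i = E.k-same (≡.sym (φ-ρ i))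

        row-sum : ∀ i → C.sum (Cᵢ.Ind adj i) ≈ ↑ (k (φ i))
        row-sum i = C.trans (C.sum-cong (λ j → C.sym (↑-δ (kind i j)))) (C.trans (C.sym (↑-sum _)) (↑-cong (k≈ i)))

        square : ∀ i j → Cᵢ.Ind adj i C.∙ (λ m → Cᵢ.Ind adj m j) ≈ ↑ (t (φ i) (kind i j))
        square i j = C.trans (C.∙-cong (λ m → C.sym (↑-δ (kind i m))) (λ m → C.sym (↑-δ (kind m j))))
            (C.trans (C.sym (↑-∙ (Rᵢ.Ind adj i) (λ m → Rᵢ.Ind adj m j)))
          (↑-cong (R.trans (E.T-formula i j) (R.+-congʳ (R.*-congʳ (R.+-congʳ (k≈ i)))))))

      labels-coherent : IsCoherentAlgebra LabelMatrix
      labels-coherent = record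
        { resp     = λ { M≋N (F , e) → F , λ i j → C.trans (C.sym (M≋N i j)) (e i j) }
        ; ⊕-closed = λ { (F , d) (G , e) → (λ f κ → F f κ + G f κ) , λ i j → C.+-cong (d i j) (e i j) }
        ; ·-closed = λ { c (F , d) → (λ f κ → c * F f κ) , λ i j → C.*-congˡ (d i j) }
        ; 𝐈-mem    = (λ _ → Cᵢ.δ eq) , Cᵢ.𝟙≈eq
        ; 𝐉-mem    = (λ _ _ → 1#) , λ _ _ → C.refl
        ; ᵀ-closed = λ { {M} (F , d) → (λ f κ → F (target f κ) κ) , λ i j → C.trans (d j i)
            (C.reflexive (≡.cong₂ F (target-kind i j) (kind-sym j i))) }
        ; ⊗-closed = λ { (F , d) (G , e) → let H , h = Cᵢ.block-product (↑ ∘ k) (λ f → ↑ ∘ t f) row-sum square F G in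
            H , λ i j → C.trans (sum≈ _) (C.trans (C.∙-cong (d i) (λ m → e m j)) (h i j)) }
        ; ⊙-closed = λ { (F , d) (G , e) → (λ f κ → F f κ * G f κ) , λ i j → C.*-cong (d i j) (e i j) }
        }

      adjacency-label : LabelMatrix (adjacencyMatrix Γ)
      adjacency-label = F , λ i j → value i j (kinded i j)
        where
        F : Bool → Kind → ℂ
        F _ eq    = 0#
        F _ adj   = 1#
        F _ non   = 0#
        F _ cross = 1#
        edge : ∀ {i j} → i ~ j → adjacencyMatrix Γ i j ≈ 1#
        edge {i} {j} q = C.trans (C.sym (↑-Adj Γ i j)) (↑-cong (Adj-edge q))
        nonedge : ∀ {i j} → ¬ i ~ j → adjacencyMatrix Γ i j ≈ 0#
        nonedge {i} {j} q = C.trans (C.sym (↑-Adj Γ i j)) (↑-cong (Adj-nonedge q))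
        value : ∀ i j {κ} → Kinded i j κ → adjacencyMatrix Γ i j ≈ F (φ i) κ
        value i j (equal q)           = nonedge (~-irrefl q)
        value i j (adjacent _ q)      = edge q
        value i j (nonadjacent _ _ q) = nonedge q
        value i j (crossing q)        = edge (join i j q)

      label : Fin n → Fin n → Fin 8
      label i j = label-number (φ i) (kind i j)

      label⇒colour : ∀ {i j i′ j′} → label i j ≡ label i′ j′ → colour i j ≡ colour i′ j′
      label⇒colour {i} {j} {i′} {j′} e = ≡.sym
          (bit⇒colour (bit-true (C.trans (C.sym (B≈ l i′ j′))
              (C.trans (C.sym same) (C.trans (B≈ l i j) (C.reflexive (≡.cong (↑ ∘ χ) (colour-bit i j))))))))
        where
        l = colour i j
        B∈ : LabelMatrix (StandardBasis.B basis l)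
        B∈ = closure-least labels-coherent adjacency-label (StandardBasis.member basis l)
        labels≡ : (φ i , kind i j) ≡ (φ i′ , kind i′ j′)
        labels≡ = ≡.trans (≡.sym (label-of-number _ _)) (≡.trans (≡.cong label-of e) (label-of-number _ _))
        same : StandardBasis.B basis l i j ≈ StandardBasis.B basis l i′ j′
        same = let F , d = B∈ in C.trans (d i j) (C.trans (C.reflexive (≡.cong (uncurry F) labels≡)) (C.sym (d i′ j′)))

      Used : Fin 8 → Set
      Used l = ∃[ i ] ∃[ j ] label i j ≡ l

      used? : ∀ l → Dec (Used l)
      used? l = Fin.any? (λ i → Fin.any? (λ j → label i j Fin.≟ l))

      -- At least seven of the eight labels occur, because every colour does.
      two-unused : ∀ {l l′} → ¬ l ≡ l′ → ¬ Used l → ¬ Used l′ → ⊥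
      two-unused {l} {l′} l≢l′ unused unused′ = no-injection {f = λ k → punchOut (avoids′ k)} λ e →
        f-injective (Fin.punchOut-injective (avoids _) (avoids _) (Fin.punchOut-injective (avoids′ _) (avoids′ _) e))
        where
        f : Fin 7 → Fin 8
        f c = let i , j , _ = attained c in label i j
        f-injective : ∀ {c d} → f c ≡ f d → c ≡ d
        f-injective {c} {d} e = let i , j , p = attained c ; i′ , j′ , q = attained d in
          ≡.trans (≡.sym p) (≡.trans (label⇒colour e) q)
        avoids : ∀ c → ¬ l ≡ f c
        avoids c e = let i , j , _ = attained c in unused (i , j , ≡.sym e)
        avoids′ : ∀ c → ¬ punchOut l≢l′ ≡ punchOut (avoids c)
        avoids′ c e = let i , j , _ = attained c in unused′ (i , j , ≡.sym (Fin.punchOut-injective l≢l′ (avoids c) e))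

    -- If Γ is regular, all vertices can be put into one part, and at most the three labels of that part
    -- occur.
    not-regular : Fin n → (∀ i j → A² i i R.≈ A² j j) → ⊥
    not-regular x regular = two-unused {4F} {5F} (λ ()) (unused eq) (unused adj)
      where
      open Labels (λ _ → true) (λ _ _ q → ⊥-elim (q refl)) (λ {i} {j} _ → regular i j) (λ _ → x) (λ _ → refl)
      unused : ∀ κ → ¬ Used (label-number false κ)
      unused κ (i , j , e) = case ≡.trans (≡.sym (label-of-number true (kind i j)))
          (≡.trans (≡.cong label-of e) (label-of-number false κ)) of λ ()

    -- The parts are the two fibres of the colouring.
    module TwoFibres (φ : Fin n → Bool) (join : ∀ i j → ¬ φ i ≡ φ j → i ~ j)
      (φ-colour : ∀ {i j} → φ i ≡ φ j → colour i i ≡ colour j j)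
      (colour-φ : ∀ {i j} → colour i i ≡ colour j j → φ i ≡ φ j)
      (ρ : Bool → Fin n) (φ-ρ : ∀ b → φ (ρ b) ≡ b) where
      open Labels φ join (colour-degree ∘ φ-colour) ρ (λ i → φ-ρ (φ i))
      module J = Join ℝ-orderedField Γ φ join
      module E = J.Equations rank-one (colour-degree ∘ φ-colour)

      colour⇒label : ∀ {i j i′ j′} → colour i j ≡ colour i′ j′ → label i j ≡ label i′ j′
      colour⇒label {i} {j} {i′} {j′} e = ≡.cong₂ label-number (colour-φ (colour-source e))
          (kind-unique (kinded i j) (transfer (kinded i′ j′)))
        where
        source : φ i ≡ φ i′
        source = colour-φ (colour-source e)
        goal : φ j ≡ φ j′
        goal = colour-φ (colour-target e)
        transfer : ∀ {κ} → Kinded i′ j′ κ → Kinded i j κ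
        transfer (equal refl)        = equal (colour-diagonal e)
        transfer (adjacent q r)      = adjacent (≡.trans source (≡.trans q (≡.sym goal)))
            (colour-adjacent (≡.sym e) r)
        transfer (nonadjacent q r s) = nonadjacent (≡.trans source (≡.trans q (≡.sym goal)))
          (λ { refl → r (colour-diagonal (≡.sym e)) }) (λ t → s (colour-adjacent e t))
        transfer (crossing q)        = crossing (λ r → q (≡.trans (≡.sym source) (≡.trans r goal)))

      not-all-used : ¬ (∀ l → Used l)
      not-all-used used = no-injection {f = λ l → let i , j , _ = used l in colour i j} λ {l} {l′} e →
        let i , j , p = used l ; i′ , j′ , q = used l′ in ≡.trans (≡.sym p) (≡.trans (colour⇒label e) q)

      used-label : ∀ b κ → Used (label-number b κ) → ∃[ i ] ∃[ j ] φ i ≡ b × kind i j ≡ κ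
      used-label b κ (i , j , e) = i , j , ≡.cong proj₁ e′ , ≡.cong proj₂ e′
        where
        e′ : (φ i , kind i j) ≡ (b , κ)
        e′ = ≡.trans (≡.sym (label-of-number _ _)) (≡.trans (≡.cong label-of e) (label-of-number _ _))

      unused-sum : ∀ i κ → ¬ Used (label-number (φ i) κ) → R.sum (λ j → Indicators.Ind ℝ-algebra κ i j) R.≈ R.0#
      unused-sum i κ unused = R.sum-zero _ off
        where
        open Indicators ℝ-algebra
        off : ∀ j → Ind κ i j R.≈ R.0#
        off j with δ-cases κ (kind i j)
        ... | inj₁ e   = ⊥-elim (unused (i , j , ≡.cong (label-number (φ i)) (≡.sym e)))
        ... | inj₂ δ≈0 = δ≈0

      ≢not : ∀ {f g b} → f ≡ b → g ≡ not b → ¬ f ≡ g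
      ≢not p q r = Bool.not-¬ (≡.trans (≡.sym q) (≡.trans (≡.sym r) p)) refl

      complete-part : ∀ b → ¬ Used (label-number b non) → Used (label-number b adj) → Used (label-number (not b) non)
          → ⊥
      complete-part b unused used used′ with used-label b adj used | used-label (not b) non used′
      ... | i , _ , refl , e | j , _ , q , e′ =
        E.no-complete-part {i} {j} (≢not refl q) (unused-sum i non unused) (J.occurs⇒sum≉0 e) (J.occurs⇒sum≉0 e′)

      empty-part : ∀ b → ¬ Used (label-number b adj) → Used (label-number b non) → Used (label-number (not b) adj) → ⊥
      empty-part b unused used used′ with used-label b non used | used-label (not b) adj used′
      ... | i , _ , refl , e | j , _ , q , e′ = not-regular i (λ u v → R.trans (degree u) (R.sym (degree v)))
        where
        equal-degrees : A² i i R.≈ A² j j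
        equal-degrees = E.empty-part⇒regular {i} {j} (≢not refl q) (unused-sum i adj unused) (J.occurs⇒sum≉0 e)
            (J.occurs⇒sum≉0 e′)
        degree : ∀ u → A² u u R.≈ A² i i
        degree u with φ u Bool.≟ φ i
        ... | yes r = colour-degree (φ-colour r)
        ... | no ¬r = R.trans (colour-degree (φ-colour (≡.trans (Bool.¬-not ¬r) (≡.sym q)))) (R.sym equal-degrees)

      -- Not all labels occur and at most one is missing, so one part is a clique or a coclique on at least
      -- two vertices while the other part is neither.
      contradiction : ⊥
      contradiction with used? 1F | used? 2F | used? 5F | used? 6F
      ... | yes u₁ | yes u₂ | yes u₅ | yes u₆ = not-all-used all
        where
        equal-used : ∀ b → Used (label-number b eq)
        equal-used b = ρ b , ρ b , ≡.cong₂ label-number (φ-ρ b) (kinded⇒kind (equal refl))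
        cross-used : ∀ b → Used (label-number b cross)
        cross-used b = ρ b , ρ (not b) , ≡.cong₂ label-number (φ-ρ b)
            (kinded⇒kind (crossing (≢not (φ-ρ b) (φ-ρ (not b)))))
        all : ∀ l → Used l
        all 0F = equal-used true
        all 1F = u₁
        all 2F = u₂
        all 3F = cross-used true
        all 4F = equal-used false
        all 5F = u₅
        all 6F = u₆
        all 7F = cross-used false
      ... | no u₁ | yes u₂ | yes u₅ | _      = empty-part true u₁ u₂ u₅
      ... | no u₁ | no u₂  | _      | _      = two-unused (λ ()) u₁ u₂
      ... | no u₁ | _      | no u₅  | _      = two-unused (λ ()) u₁ u₅
      ... | yes u₁ | no u₂ | _      | yes u₆ = complete-part true u₂ u₁ u₆
      ... | _     | no u₂  | _      | no u₆  = two-unused (λ ()) u₂ u₆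
      ... | yes u₁ | yes _ | no u₅  | yes u₆ = empty-part false u₅ u₆ u₁
      ... | _     | _      | no u₅  | no u₆  = two-unused (λ ()) u₅ u₆
      ... | _     | yes u₂ | yes u₅ | no u₆  = complete-part false u₆ u₅ u₂

    module _ (connected : Connected Γ) where

      -- Three different fibres give nine colours.
      no-three-fibres : (v : Fin 3 → Fin n) → (∀ {a b} → colour (v a) (v a) ≡ colour (v b) (v b) → a ≡ b) → ⊥
      no-three-fibres v distinct = ℕ.<⇒≱ (ℕ.m<m+n 7 {2} (ℕ.s≤s ℕ.z≤n)) (Fin.injective⇒≤ {f = f} f-injective)
        where
        f : Fin 9 → Fin 7
        f l = let a , b = remQuot {3} 3 l in colour (v a) (v b)
        f-injective : Injective _≡_ _≡_ f
        f-injective {l} {l′} e = ≡.trans (≡.sym (Fin.combine-remQuot {3} 3 l)) (≡.trans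
          (≡.cong₂ combine (distinct (colour-source e)) (distinct (colour-target e))) (Fin.combine-remQuot {3} 3 l′))

      -- x and y lie in different fibres, and φ tells whether a vertex lies in the fibre of x.
      module _ (x y : Fin n) (x≁y : ¬ colour x x ≡ colour y y) where
        φ : Fin n → Bool
        φ i = does (colour i i Fin.≟ colour x x)

        x-fibre : ∀ {i} → φ i ≡ true → colour i i ≡ colour x x
        x-fibre {i} e with colour i i Fin.≟ colour x x
        ... | yes q = q
        x-fibre () | no _

        y-fibre : ∀ {i} → φ i ≡ false → colour i i ≡ colour y y
        y-fibre {i} e with colour i i Fin.≟ colour x x | colour i i Fin.≟ colour y y
        y-fibre () | yes _ | _
        ... | no _ | yes q = q
        ... | no p | no q = ⊥-elim (no-three-fibres v distinct)
          where
          v : Fin 3 → Fin n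
          v 0F = x
          v 1F = y
          v 2F = i
          distinct : ∀ {a b} → colour (v a) (v a) ≡ colour (v b) (v b) → a ≡ b
          distinct {0F} {0F} _ = refl
          distinct {0F} {1F} r = ⊥-elim (x≁y r)
          distinct {0F} {2F} r = ⊥-elim (p (≡.sym r))
          distinct {1F} {0F} r = ⊥-elim (x≁y (≡.sym r))
          distinct {1F} {1F} _ = refl
          distinct {1F} {2F} r = ⊥-elim (q (≡.sym r))
          distinct {2F} {0F} r = ⊥-elim (p r)
          distinct {2F} {1F} r = ⊥-elim (q r)
          distinct {2F} {2F} _ = refl

        colour-φ : ∀ {i j} → colour i i ≡ colour j j → φ i ≡ φ j
        colour-φ e = ≡.cong (λ c → does (c Fin.≟ colour x x)) e

        φ-colour : ∀ {i j} → φ i ≡ φ j → colour i i ≡ colour j j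
        φ-colour {i} {j} e = go (φ j) e refl
          where
          go : ∀ b → φ i ≡ b → φ j ≡ b → colour i i ≡ colour j j
          go true  p q = ≡.trans (x-fibre p) (≡.sym (x-fibre q))
          go false p q = ≡.trans (y-fibre p) (≡.sym (y-fibre q))

        φ-x : φ x ≡ true
        φ-x with colour x x Fin.≟ colour x x
        ... | yes _ = refl
        ... | no p  = ⊥-elim (p refl)

        φ-y : φ y ≡ false
        φ-y with colour y y Fin.≟ colour x x
        ... | yes p = ⊥-elim (x≁y (≡.sym p))
        ... | no _  = refl

        true≢ : ¬ true ≡ false
        true≢ ()

        -- Two colours between the fibres, together with a second vertex in each fibre, give eight colours.
        module _ {x₁ y₁ i j i′ j′ : Fin n} (φ-x₁ : φ x₁ ≡ true) (x₁≢x : ¬ x₁ ≡ x) (φ-y₁ : φ y₁ ≡ false)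
            (y₁≢y : ¬ y₁ ≡ y)
          (φ-i : φ i ≡ true) (φ-j : φ j ≡ false) (φ-i′ : φ i′ ≡ true) (φ-j′ : φ j′ ≡ false) where
          private
            start end : Bool → Bool → Bool → Fin n
            start true  true  _     = x
            start true  false true  = i
            start true  false false = i′
            start false true  true  = j
            start false true  false = j′
            start false false _     = y
            end true  true  true  = x
            end true  true  false = x₁
            end true  false true  = j
            end true  false false = j′
            end false true  true  = i
            end false true  false = i′
            end false false true  = y
            end false false false = y₁

            code : Bool → Bool → Bool → Fin 7
            code f g b = colour (start f g b) (end f g b)

            φ-start : ∀ f g b → φ (start f g b) ≡ f
            φ-start true  true  _     = φ-x
            φ-start true  false true  = φ-i
            φ-start true  false false = φ-i′
            φ-start false true  true  = φ-j
            φ-start false true  false = φ-j′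
            φ-start false false _     = φ-y

            φ-end : ∀ f g b → φ (end f g b) ≡ g
            φ-end true  true  true  = φ-x
            φ-end true  true  false = φ-x₁
            φ-end true  false true  = φ-j
            φ-end true  false false = φ-j′
            φ-end false true  true  = φ-i
            φ-end false true  false = φ-i′
            φ-end false false true  = φ-y
            φ-end false false false = φ-y₁

          cross-colour-unique : ¬ ¬ colour i j ≡ colour i′ j′
          cross-colour-unique ij≢i′j′ = no-injection {f = λ l → code (proj₁ (decode l)) (proj₁ (proj₂ (decode l)))
              (proj₂ (proj₂ (decode l)))}
            λ {l} {l′} e → decode-injective (code-injective _ _ _ _ _ _ e)
            where
            separated : ∀ f g → ¬ code f g true ≡ code f g false
            separated true  true  e = x₁≢x (≡.sym (colour-diagonal {x} {x₁} {x} (≡.sym e)))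
            separated true  false e = ij≢i′j′ e
            separated false true  e = ij≢i′j′ (colour-transpose {j} {i} {j′} {i′} e)
            separated false false e = y₁≢y (≡.sym (colour-diagonal {y} {y₁} {y} (≡.sym e)))
            third : ∀ f g b b′ → code f g b ≡ code f g b′ → b ≡ b′
            third f g true  true  _ = refl
            third f g true  false e = ⊥-elim (separated f g e)
            third f g false true  e = ⊥-elim (separated f g (≡.sym e))
            third f g false false _ = refl
            code-injective : ∀ f g b f′ g′ b′ → code f g b ≡ code f′ g′ b′ → (f , g , b) ≡ (f′ , g′ , b′)
            code-injective f g b f′ g′ b′ e = assemble
              (≡.trans (≡.sym (φ-start f g b))
                  (≡.trans (colour-φ (colour-source {start f g b} {end f g b} {start f′ g′ b′} {end f′ g′ b′} e))
                      (φ-start f′ g′ b′)))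
              (≡.trans (≡.sym (φ-end f g b)) (≡.trans
                  (colour-φ (colour-target {start f g b} {end f g b} {start f′ g′ b′} {end f′ g′ b′} e))
                      (φ-end f′ g′ b′))) e
              where
              assemble : ∀ {f g f′ g′} → f ≡ f′ → g ≡ g′ → code f g b ≡ code f′ g′ b′ → (f , g , b) ≡ (f′ , g′ , b′)
              assemble {f} {g} refl refl e = ≡.cong (λ b → f , g , b) (third f g b b′ e)

        other? : ∀ b (z : Fin n) → Dec (∃[ u ] φ u ≡ b × ¬ u ≡ z)
        other? b z = Fin.any? (λ u → (φ u Bool.≟ b) ×-dec ¬? (u Fin.≟ z))

        singleton : ∀ {b z} → ¬ (∃[ u ] φ u ≡ b × ¬ u ≡ z) → ∀ {u w} → φ u ≡ b → φ w ≡ b → u ≡ w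
        singleton {b} {z} none p q = ≡.trans (only p) (≡.sym (only q))
          where
          only : ∀ {u} → φ u ≡ b → u ≡ z
          only {u} p = decidable-stable (u Fin.≟ z) (λ ¬r → none (u , p , ¬r))

        -- All pairs from the fibre of x to the fibre of y have the same colour.  If one fibre is a single
        -- point, this follows from the path property; otherwise from the number of colours.
        cross-colour : ∀ {i j i′ j′} → φ i ≡ true → φ j ≡ false → φ i′ ≡ true → φ j′ ≡ false → colour i j ≡ colour i′
            j′
        cross-colour {i} {j} {i′} {j′} pi pj pi′ pj′ = by-cases (other? true x) (other? false y)
          where
          by-cases : Dec (∃[ u ] φ u ≡ true × ¬ u ≡ x) → Dec (∃[ u ] φ u ≡ false × ¬ u ≡ y) → colour i j ≡ colour i′
              j′
          by-cases (no none) _ =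
            let m , _ , e = colour-path (φ-colour (≡.trans pj (≡.sym pj′))) i in
            ≡.trans (≡.sym e) (≡.cong (λ u → colour u j′) (singleton none (≡.trans (colour-φ (colour-source e)) pi)
                pi′))
          by-cases _ (no none) =
            let m , e , _ = colour-path (φ-colour (≡.trans pi (≡.sym pi′))) j in
            ≡.trans (≡.sym e) (≡.cong (colour i′) (singleton none (≡.trans (colour-φ (colour-target e)) pj) pj′))
          by-cases (yes (_ , px₁ , x₁≢x)) (yes (_ , py₁ , y₁≢y)) = decidable-stable (colour i j Fin.≟ colour i′ j′)
            (cross-colour-unique px₁ x₁≢x py₁ y₁≢y pi pj pi′ pj′)

        crossing-edge : ∀ {i j} → Star _~_ i j → φ i ≡ true → φ j ≡ false →
          ∃[ u ] ∃[ w ] u ~ w × φ u ≡ true × φ w ≡ false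
        crossing-edge Star.ε p q = ⊥-elim (true≢ (≡.trans (≡.sym p) q))
        crossing-edge {i} {j} (_◅_ {j = k} e path) p q = next (φ k) refl
          where
          next : ∀ b → φ k ≡ b → ∃[ u ] ∃[ w ] u ~ w × φ u ≡ true × φ w ≡ false
          next true  r = crossing-edge path r q
          next false r = i , k , e , p , r

        -- Γ is connected, so some edge joins the two fibres, and all pairs between them have its colour.
        join : ∀ i j → ¬ φ i ≡ φ j → i ~ j
        join i j ¬e = at (φ i) (φ j) refl refl
          where
          edge = crossing-edge (connected x y) φ-x φ-y
          adjacent-by : ∀ {i j} → φ i ≡ true → φ j ≡ false → i ~ j
          adjacent-by p q = let u , w , u~w , pu , pw = edge in colour-adjacent (cross-colour pu pw p q) u~w
          at : ∀ b c → φ i ≡ b → φ j ≡ c → i ~ j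
          at true  true  p q = ⊥-elim (¬e (≡.trans p (≡.sym q)))
          at false false p q = ⊥-elim (¬e (≡.trans p (≡.sym q)))
          at true  false p q = adjacent-by p q
          at false true  p q = ~-sym (adjacent-by q p)

        two-fibres : ⊥
        two-fibres = TwoFibres.contradiction φ join φ-colour colour-φ ρ φ-ρ
          where
          ρ : Bool → Fin n
          ρ true  = x
          ρ false = y
          φ-ρ : ∀ b → φ (ρ b) ≡ b
          φ-ρ true  = φ-x
          φ-ρ false = φ-y

      rank≢7 : Fin n → ⊥
      rank≢7 x = by-cases (Fin.any? (λ y → ¬? (colour x x Fin.≟ colour y y)))
        where
        by-cases : Dec (∃[ y ] ¬ colour x x ≡ colour y y) → ⊥
        by-cases (yes (y , x≁y)) = two-fibres x y x≁y
        by-cases (no none) = not-regular x (λ i j → colour-degree (≡.trans (≡.sym (fibre i)) (fibre j)))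
          where
          fibre : ∀ i → colour x x ≡ colour i i
          fibre i = decidable-stable (colour x x Fin.≟ colour i i) (λ ¬e → none (i , ¬e))

open RankSeven

theorem3p6 : (n : ℕ) (Γ : Graph n) → 𝒢₃ Γ → ¬ HasCoherentRank Γ 7
theorem3p6 zero    Γ Γ∈𝒢₃ basis = Fin.¬Fin0
    (proj₁ (Colours.attained (closure-isCoherentAlgebra (adjacencyMatrix Γ)) basis 0F))
theorem3p6 (suc n) Γ Γ∈𝒢₃ basis = three-eigenvalues Γ Γ∈𝒢₃ λ rank-one →
  Rank7.rank≢7 Γ basis rank-one (𝒢₃.connected Γ∈𝒢₃) zero
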